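{- Testing uniformity can be done using $\mathrm{poly}(\log n,\epsilon^{ -1},\log(\delta^{ -1}))$ non-adaptive conditional samples. That is, there is a polynomial $p$ and a non-adaptive distribution tester for the property of being the uniform distribution over $[n]$ such that for all $\epsilon,\delta\in(0,1)$ and all $n$ the tester makes at most $p(\log n,\epsilon^{ -1},\log(\delta^{ -1}))$ conditional samples.
   Context: $[n]=\{1,\ldots,n\}$. A conditional sampling oracle for a distribution $\mu$ over $[n]$ takes a nonempty set $A\subseteq[n]$ and returns $j\in A$ with probability $\mu(j)/\mu(A)$ if $\mu(A)>0$, and a uniformly random member of $A$ if $\mu(A)=0$, independently of all previous samples. The variation distance is $d(\mu,\mu')=\frac12\sum_{i=1}^n|\mu(i)-\mu'(i)|$. A property $\mathcal P$ is a set of distributions over $[n]$; $\mu$ is $\epsilon$-far from $\mathcal P$ if $d(\mu,\mu')\ge\epsilon$ for every $\mu'\in\mathcal P$. A non-adaptive distribution tester for $\mathcal P$ with conditional sample complexity $t(\epsilon,\delta,n)$ is a randomized algorithm that receives $\epsilon,\delta>0$, $n\in\mathbb N$ and a conditional sampling oracle for an unknown distribution $\mu$ over $[n]$. It first generates (before receiving any sample) a sequence of $t\le t(\epsilon,\delta,n)$ sets $A_1,\ldots,A_t\subseteq[n]$, then calls the oracle on $A_1,\ldots,A_t$ to receive $j_1,\ldots,j_t$, and then accepts or rejects based on $j_1,\ldots,j_t$ and its internal coin tosses. If $\mu\in\mathcal P$ it must accept with probability at least $1-\delta$; if $\mu$ is $\epsilon$-far from $\mathcal P$ it must reject with probability at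 least $1-\delta$. -}

module Defs where

import Algebra.Definitions.RawMonoid as RawMonoidDefinitions
import Algebra.Properties.CommutativeSemiring.Exp as CommutativeExp
import Algebra.Properties.Semiring.Exp as Exp
import Algebra.Properties.Semiring.Mult as Mult
open import Algebra.Bundles using (CommutativeRing)
open import Algebra.Bundles.Raw using (RawMonoid)
open import Data.Bool.Base using (Bool; true; false; not; if_then_else_)
open import Data.Fin.Base using (Fin)
open import Data.Fin.Properties using (nonZeroIndex)
open import Data.Fin.Subset using (Subset; Nonempty; _∈_; _∉_) renaming (∣_∣ to card)
open import Data.Fin.Subset.Properties using (x∈p⇒∣p-x∣<∣p∣)
import Data.Integer.Base as ℤ
import Data.Integer.DivMod as ℤ
import Data.Integer.Properties as ℤ
open import Data.List.Base using (List; []; _∷_; length)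
open import Data.Nat.Base as ℕ using (ℕ; zero; suc; z≤n; s≤s)
open import Data.Nat.Coprimality using (Coprime)
open import Data.Nat.DivMod using (m/n*n≤m; m%n<n; m≡m%n+[m/n]*n; m≥n⇒m/n>0)
open import Data.Nat.Induction using (<-rec)
open import Data.Nat.Logarithm
  using (⌊log₂_⌋; ⌊log₂⌋-mono-≤; ⌊log₂⌊n/2⌋⌋≡⌊log₂n⌋∸1; ⌊log₂[2^n]⌋≡n)
open import Data.Nat.Solver using () renaming (module +-*-Solver to ℕ-Solver)
import Data.Nat.Properties as ℕ
open import Data.Product.Base using (∃; _×_; _,_; proj₁; proj₂)
open import Data.Rational.Base as ℚ using (ℚ; mkℚ; 0ℚ; 1ℚ; ½)
import Data.Rational.Properties as ℚ
import Data.Rational.Unnormalised.Base as ℚᵘ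
import Data.Rational.Unnormalised.Properties as ℚᵘ
open import Data.Rational.Solver using () renaming (module +-*-Solver to ℚ-Solver)
open import Data.Sum.Base using (inj₁; inj₂)
open import Data.Vec.Base as Vec using (Vec; []; _∷_)
open import Function.Base using (_∘_)
open import Level using (0ℓ)
open import Relation.Binary.PropositionalEquality using (_≡_; refl; sym; trans; cong; cong₂; subst; subst₂; module ≡-Reasoning)

open CommutativeExp (CommutativeRing.commutativeSemiring ℚ.+-*-commutativeRing)
  using (^-distrib-*)
open Exp (CommutativeRing.semiring ℚ.+-*-commutativeRing)
  using (_^_; ^-homo-*; ^-assocʳ)
open Mult (CommutativeRing.semiring ℚ.+-*-commutativeRing)
  using (×-comm-*) renaming (_×_ to _⋆_)

∣-∣≤ : ∀ {p q} → p ℚ.≤ q → ℚ.- p ℚ.≤ q → ℚ.∣ p ∣ ℚ.≤ q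
∣-∣≤ {p} p≤q -p≤q with ℚ.∣p∣≡p∨∣p∣≡-p p
... | inj₁ eq = subst (ℚ._≤ _) (sym eq) p≤q
... | inj₂ eq = subst (ℚ._≤ _) (sym eq) -p≤q

p≤∣p∣ : ∀ p → p ℚ.≤ ℚ.∣ p ∣
p≤∣p∣ p with ℚ.≤-total 0ℚ p
... | inj₁ 0≤p = ℚ.≤-reflexive (sym (ℚ.0≤p⇒∣p∣≡p 0≤p))
... | inj₂ p≤0 = ℚ.≤-trans p≤0 (ℚ.0≤∣p∣ p)

∣p-q∣-sym : ∀ p q → ℚ.∣ p ℚ.- q ∣ ≡ ℚ.∣ q ℚ.- p ∣
∣p-q∣-sym p q = trans (cong ℚ.∣_∣ (solve 2 (λ p q → p :- q := :- (q :- p)) refl p q)) (ℚ.∣-p∣≡∣p∣ (q ℚ.- p))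
  where open ℚ-Solver

p-q≤r⇒p≤q+r : ∀ p q r → p ℚ.- q ℚ.≤ r → p ℚ.≤ q ℚ.+ r
p-q≤r⇒p≤q+r p q r h =
  subst (ℚ._≤ q ℚ.+ r) (solve 2 (λ p q → q :+ (p :- q) := p) refl p q) (ℚ.+-monoʳ-≤ q h)
  where open ℚ-Solver

p≤q+r⇒p-q≤r : ∀ p q r → p ℚ.≤ q ℚ.+ r → p ℚ.- q ℚ.≤ r
p≤q+r⇒p-q≤r p q r h =
  subst (p ℚ.- q ℚ.≤_) (solve 2 (λ q r → (q :+ r) :- q := r) refl q r) (ℚ.+-monoˡ-≤ (ℚ.- q) h)
  where open ℚ-Solver

∣p-q∣≤⇒p≤q+ : ∀ {p q r} → ℚ.∣ p ℚ.- q ∣ ℚ.≤ r → p ℚ.≤ q ℚ.+ r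
∣p-q∣≤⇒p≤q+ {p} {q} {r} h = p-q≤r⇒p≤q+r p q r (ℚ.≤-trans (p≤∣p∣ (p ℚ.- q)) h)

≤+⇒∣p-q∣≤ : ∀ {p q r} → p ℚ.≤ q ℚ.+ r → q ℚ.≤ p ℚ.+ r → ℚ.∣ p ℚ.- q ∣ ℚ.≤ r
≤+⇒∣p-q∣≤ {p} {q} {r} h₁ h₂ = ∣-∣≤ (p≤q+r⇒p-q≤r p q r h₁)
  (subst (ℚ._≤ r) (solve 2 (λ p q → q :- p := :- (p :- q)) refl p q) (p≤q+r⇒p-q≤r q p r h₂))
  where open ℚ-Solver

*-mono-≤ : ∀ {p q r s} → 0ℚ ℚ.≤ p → 0ℚ ℚ.≤ s → p ℚ.≤ q → r ℚ.≤ s → p ℚ.* r ℚ.≤ q ℚ.* s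
*-mono-≤ {p} {q} {r} {s} 0≤p 0≤s p≤q r≤s = ℚ.≤-trans
  (ℚ.*-monoˡ-≤-nonNeg p {{ℚ.nonNegative 0≤p}} r≤s)
  (ℚ.*-monoʳ-≤-nonNeg s {{ℚ.nonNegative 0≤s}} p≤q)

*-pos : ∀ {p q} → 0ℚ ℚ.< p → 0ℚ ℚ.< q → 0ℚ ℚ.< p ℚ.* q
*-pos {p} {q} 0<p 0<q = ℚ.positive⁻¹ _ {{ℚ.pos*pos⇒pos p {{ℚ.positive 0<p}} q {{ℚ.positive 0<q}}}}

0<½ : 0ℚ ℚ.< ½
0<½ = ℚ.positive⁻¹ ½

½ε+½ε≡ε : ∀ ε → ε ℚ.* ½ ℚ.+ ε ℚ.* ½ ≡ ε
½ε+½ε≡ε ε = trans (sym (ℚ.*-distribˡ-+ ε ½ ½)) (ℚ.*-identityʳ ε)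

reciprocal : ∀ {p} → 0ℚ ℚ.< p → ℚ
reciprocal {p} 0<p = ℚ.1/_ p {{ℚ.pos⇒nonZero p {{ℚ.positive 0<p}}}}

p*reciprocal : ∀ {p} (0<p : 0ℚ ℚ.< p) → p ℚ.* reciprocal 0<p ≡ 1ℚ
p*reciprocal {p} 0<p = ℚ.*-inverseʳ p {{ℚ.pos⇒nonZero p {{ℚ.positive 0<p}}}}

reciprocal-pos : ∀ {p} (0<p : 0ℚ ℚ.< p) → 0ℚ ℚ.< reciprocal 0<p
reciprocal-pos {p} 0<p = ℚ.positive⁻¹ _ {{ℚ.1/pos⇒pos p {{ℚ.positive 0<p}}}}

-- Real numbers: Cauchy sequences of rationals, with equality and order as
-- setoid relations.

Eventually : (ℕ → Set) → Set
Eventually P = ∃ λ N → ∀ n → N ℕ.≤ n → P n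

record ℝ : Set where
  constructor mkℝ
  field
    seq    : ℕ → ℚ
    cauchy : ∀ ε → 0ℚ ℚ.< ε →
             ∃ λ N → ∀ m n → N ℕ.≤ m → N ℕ.≤ n → ℚ.∣ seq m ℚ.- seq n ∣ ℚ.≤ ε

open ℝ public

infix 4 _≃_ _≤_ _<_

_≃_ : ℝ → ℝ → Set
x ≃ y = ∀ ε → 0ℚ ℚ.< ε → Eventually λ n → ℚ.∣ seq x n ℚ.- seq y n ∣ ℚ.≤ ε

_≤_ : ℝ → ℝ → Set
x ≤ y = ∀ ε → 0ℚ ℚ.< ε → Eventually λ n → seq x n ℚ.≤ seq y n ℚ.+ ε

_<_ : ℝ → ℝ → Set
x < y = ∃ λ ε → 0ℚ ℚ.< ε × Eventually λ n → seq x n ℚ.+ ε ℚ.≤ seq y n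

fromℚ : ℚ → ℝ
fromℚ q = mkℝ (λ _ → q) λ ε 0<ε → 0 , λ _ _ _ _ →
  subst (ℚ._≤ ε) (cong ℚ.∣_∣ (sym (ℚ.+-inverseʳ q))) (ℚ.<⇒≤ 0<ε)

fromℕ : ℕ → ℝ
fromℕ k = fromℚ (ℤ.+ k ℚ./ 1)

0ℝ 1ℝ : ℝ
0ℝ = fromℚ 0ℚ
1ℝ = fromℚ 1ℚ

infix  8 -_
infixl 7 _*_
infixl 6 _+_ _-_

_+_ : ℝ → ℝ → ℝ
seq (x + y) n = seq x n ℚ.+ seq y n
cauchy (x + y) ε 0<ε = N ℕ.⊔ M , λ m n N≤m N≤n → begin
  ℚ.∣ (seq x m ℚ.+ seq y m) ℚ.- (seq x n ℚ.+ seq y n) ∣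
    ≡⟨ cong ℚ.∣_∣ (solve 4 (λ a b c d → (a :+ b) :- (c :+ d) := (a :- c) :+ (b :- d)) refl
         (seq x m) (seq y m) (seq x n) (seq y n)) ⟩
  ℚ.∣ (seq x m ℚ.- seq x n) ℚ.+ (seq y m ℚ.- seq y n) ∣
    ≤⟨ ℚ.∣p+q∣≤∣p∣+∣q∣ (seq x m ℚ.- seq x n) (seq y m ℚ.- seq y n) ⟩
  ℚ.∣ seq x m ℚ.- seq x n ∣ ℚ.+ ℚ.∣ seq y m ℚ.- seq y n ∣
    ≤⟨ ℚ.+-mono-≤ (proj₂ cx m n (ℕ.m⊔n≤o⇒m≤o N M N≤m) (ℕ.m⊔n≤o⇒m≤o N M N≤n))
                  (proj₂ cy m n (ℕ.m⊔n≤o⇒n≤o N M N≤m) (ℕ.m⊔n≤o⇒n≤o N M N≤n)) ⟩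
  ε ℚ.* ½ ℚ.+ ε ℚ.* ½
    ≡⟨ ½ε+½ε≡ε ε ⟩
  ε ∎
  where
  open ℚ.≤-Reasoning
  open ℚ-Solver
  cx = cauchy x (ε ℚ.* ½) (*-pos 0<ε 0<½)
  cy = cauchy y (ε ℚ.* ½) (*-pos 0<ε 0<½)
  N = proj₁ cx
  M = proj₁ cy

-_ : ℝ → ℝ
seq (- x) n = ℚ.- seq x n
cauchy (- x) ε 0<ε = proj₁ cx , λ m n N≤m N≤n → subst (ℚ._≤ ε)
  (cong ℚ.∣_∣ (solve 2 (λ a b → a :- b := :- b :- (:- a)) refl (seq x n) (seq x m)))
  (proj₂ cx n m N≤n N≤m)
  where
  open ℚ-Solver
  cx = cauchy x ε 0<ε

_-_ : ℝ → ℝ → ℝ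
x - y = x + (- y)

∣_∣ : ℝ → ℝ
seq ∣ x ∣ n = ℚ.∣ seq x n ∣
cauchy ∣ x ∣ ε 0<ε = proj₁ cx , λ m n N≤m N≤n →
  ≤+⇒∣p-q∣≤ (nonexpansive m n (proj₂ cx m n N≤m N≤n)) (nonexpansive n m (proj₂ cx n m N≤n N≤m))
  where
  open ℚ.≤-Reasoning
  open ℚ-Solver
  cx = cauchy x ε 0<ε
  nonexpansive : ∀ m n → ℚ.∣ seq x m ℚ.- seq x n ∣ ℚ.≤ ε → ℚ.∣ seq x m ∣ ℚ.≤ ℚ.∣ seq x n ∣ ℚ.+ ε
  nonexpansive m n h = begin
    ℚ.∣ seq x m ∣
      ≡⟨ cong ℚ.∣_∣ (solve 2 (λ a b → a := b :+ (a :- b)) refl (seq x m) (seq x n)) ⟩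
    ℚ.∣ seq x n ℚ.+ (seq x m ℚ.- seq x n) ∣
      ≤⟨ ℚ.∣p+q∣≤∣p∣+∣q∣ (seq x n) (seq x m ℚ.- seq x n) ⟩
    ℚ.∣ seq x n ∣ ℚ.+ ℚ.∣ seq x m ℚ.- seq x n ∣
      ≤⟨ ℚ.+-monoʳ-≤ ℚ.∣ seq x n ∣ h ⟩
    ℚ.∣ seq x n ∣ ℚ.+ ε ∎

bounded : ∀ x → ∃ λ B → 0ℚ ℚ.< B × Eventually λ n → ℚ.∣ seq x n ∣ ℚ.≤ B
bounded x = ℚ.∣ seq x N ∣ ℚ.+ 1ℚ ,
  ℚ.+-mono-≤-< (ℚ.0≤∣p∣ (seq x N)) 0<1 ,
  N , λ n N≤n → ∣p-q∣≤⇒p≤q+ {ℚ.∣ seq x n ∣} {ℚ.∣ seq x N ∣} (proj₂ cx n N N≤n ℕ.≤-refl)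
  where
  0<1 = ℚ.positive⁻¹ 1ℚ
  cx = cauchy ∣ x ∣ 1ℚ 0<1
  N = proj₁ cx

_*_ : ℝ → ℝ → ℝ
seq (x * y) n = seq x n ℚ.* seq y n
cauchy (x * y) ε 0<ε = N₁ ℕ.⊔ N₂ ℕ.⊔ (N₃ ℕ.⊔ N₄) , λ m n N≤m N≤n →
  let N₁₂≤m = ℕ.m⊔n≤o⇒m≤o (N₁ ℕ.⊔ N₂) (N₃ ℕ.⊔ N₄) N≤m
      N₁₂≤n = ℕ.m⊔n≤o⇒m≤o (N₁ ℕ.⊔ N₂) (N₃ ℕ.⊔ N₄) N≤n
      N₃₄≤m = ℕ.m⊔n≤o⇒n≤o (N₁ ℕ.⊔ N₂) (N₃ ℕ.⊔ N₄) N≤m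
      N₃₄≤n = ℕ.m⊔n≤o⇒n≤o (N₁ ℕ.⊔ N₂) (N₃ ℕ.⊔ N₄) N≤n
  in close (seq x m) (seq x n) (seq y m) (seq y n)
       (∣x∣≤B m (ℕ.m⊔n≤o⇒m≤o N₁ N₂ N₁₂≤m)) (∣y∣≤C n (ℕ.m⊔n≤o⇒n≤o N₁ N₂ N₁₂≤n))
       (proj₂ cx m n (ℕ.m⊔n≤o⇒n≤o N₃ N₄ N₃₄≤m) (ℕ.m⊔n≤o⇒n≤o N₃ N₄ N₃₄≤n))
       (proj₂ cy m n (ℕ.m⊔n≤o⇒m≤o N₃ N₄ N₃₄≤m) (ℕ.m⊔n≤o⇒m≤o N₃ N₄ N₃₄≤n))
  where
  open ℚ.≤-Reasoning
  open ℚ-Solver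
  B = proj₁ (bounded x)
  C = proj₁ (bounded y)
  0<B = proj₁ (proj₂ (bounded x))
  0<C = proj₁ (proj₂ (bounded y))
  N₁ = proj₁ (proj₂ (proj₂ (bounded x)))
  N₂ = proj₁ (proj₂ (proj₂ (bounded y)))
  ∣x∣≤B = proj₂ (proj₂ (proj₂ (bounded x)))
  ∣y∣≤C = proj₂ (proj₂ (proj₂ (bounded y)))
  cy = cauchy y (ε ℚ.* ½ ℚ.* reciprocal 0<B) (*-pos (*-pos 0<ε 0<½) (reciprocal-pos 0<B))
  cx = cauchy x (ε ℚ.* ½ ℚ.* reciprocal 0<C) (*-pos (*-pos 0<ε 0<½) (reciprocal-pos 0<C))
  N₃ = proj₁ cy
  N₄ = proj₁ cx
  product : ∀ {D s t} (0<D : 0ℚ ℚ.< D) → 0ℚ ℚ.≤ s → s ℚ.≤ D →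
            t ℚ.≤ ε ℚ.* ½ ℚ.* reciprocal 0<D → s ℚ.* t ℚ.≤ ε ℚ.* ½
  product {D} {s} {t} 0<D 0≤s s≤D t≤ = begin
    s ℚ.* t
      ≤⟨ *-mono-≤ 0≤s (ℚ.<⇒≤ (*-pos (*-pos 0<ε 0<½) (reciprocal-pos 0<D))) s≤D t≤ ⟩
    D ℚ.* (ε ℚ.* ½ ℚ.* reciprocal 0<D)
      ≡⟨ solve 3 (λ a b c → a :* (b :* c) := b :* (a :* c)) refl D (ε ℚ.* ½) (reciprocal 0<D) ⟩
    ε ℚ.* ½ ℚ.* (D ℚ.* reciprocal 0<D)
      ≡⟨ cong (ε ℚ.* ½ ℚ.*_) (p*reciprocal 0<D) ⟩
    ε ℚ.* ½ ℚ.* 1ℚ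
      ≡⟨ ℚ.*-identityʳ (ε ℚ.* ½) ⟩
    ε ℚ.* ½ ∎
  close : ∀ a b c d → ℚ.∣ a ∣ ℚ.≤ B → ℚ.∣ d ∣ ℚ.≤ C →
          ℚ.∣ a ℚ.- b ∣ ℚ.≤ ε ℚ.* ½ ℚ.* reciprocal 0<C →
          ℚ.∣ c ℚ.- d ∣ ℚ.≤ ε ℚ.* ½ ℚ.* reciprocal 0<B →
          ℚ.∣ a ℚ.* c ℚ.- b ℚ.* d ∣ ℚ.≤ ε
  close a b c d a≤B d≤C ab cd = begin
    ℚ.∣ a ℚ.* c ℚ.- b ℚ.* d ∣
      ≡⟨ cong ℚ.∣_∣ (solve 4 (λ a b c d → a :* c :- b :* d := a :* (c :- d) :+ d :* (a :- b)) refl a b c d) ⟩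
    ℚ.∣ a ℚ.* (c ℚ.- d) ℚ.+ d ℚ.* (a ℚ.- b) ∣
      ≤⟨ ℚ.∣p+q∣≤∣p∣+∣q∣ (a ℚ.* (c ℚ.- d)) (d ℚ.* (a ℚ.- b)) ⟩
    ℚ.∣ a ℚ.* (c ℚ.- d) ∣ ℚ.+ ℚ.∣ d ℚ.* (a ℚ.- b) ∣
      ≡⟨ cong₂ ℚ._+_ (ℚ.∣p*q∣≡∣p∣*∣q∣ a (c ℚ.- d)) (ℚ.∣p*q∣≡∣p∣*∣q∣ d (a ℚ.- b)) ⟩
    ℚ.∣ a ∣ ℚ.* ℚ.∣ c ℚ.- d ∣ ℚ.+ ℚ.∣ d ∣ ℚ.* ℚ.∣ a ℚ.- b ∣
      ≤⟨ ℚ.+-mono-≤ (product 0<B (ℚ.0≤∣p∣ a) a≤B cd) (product 0<C (ℚ.0≤∣p∣ d) d≤C ab) ⟩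
    ε ℚ.* ½ ℚ.+ ε ℚ.* ½
      ≡⟨ ½ε+½ε≡ε ε ⟩
    ε ∎

⊔-pos : ∀ p {c} → 0ℚ ℚ.< c → 0ℚ ℚ.< p ℚ.⊔ c
⊔-pos p {c} 0<c = ℚ.<-≤-trans 0<c (ℚ.p≤q⊔p p c)

⊔-nonexpansive : ∀ {p q ε} c → 0ℚ ℚ.≤ ε → ℚ.∣ p ℚ.- q ∣ ℚ.≤ ε → p ℚ.⊔ c ℚ.≤ (q ℚ.⊔ c) ℚ.+ ε
⊔-nonexpansive {p} {q} {ε} c 0≤ε h = ℚ.⊔-lub
  (ℚ.≤-trans (∣p-q∣≤⇒p≤q+ {p} h) (ℚ.+-monoˡ-≤ ε (ℚ.p≤p⊔q q c)))
  (ℚ.≤-trans (ℚ.≤-reflexive (sym (ℚ.+-identityʳ c))) (ℚ.+-mono-≤ (ℚ.p≤q⊔p q c) 0≤ε))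

reciprocal-close : ∀ {a b c ε} (0<a : 0ℚ ℚ.< a) (0<b : 0ℚ ℚ.< b) → 0ℚ ℚ.< c → 0ℚ ℚ.< ε →
                   c ℚ.≤ a → c ℚ.≤ b → b ℚ.≤ a ℚ.+ ε ℚ.* (c ℚ.* c) →
                   reciprocal 0<a ℚ.≤ reciprocal 0<b ℚ.+ ε
reciprocal-close {a} {b} {c} {ε} 0<a 0<b 0<c 0<ε c≤a c≤b h =
  ℚ.*-cancelʳ-≤-pos (a ℚ.* b) {{ℚ.positive (*-pos 0<a 0<b)}} (begin
    a⁻¹ ℚ.* (a ℚ.* b)
      ≡⟨ solve 3 (λ r a b → r :* (a :* b) := b :* (a :* r)) refl a⁻¹ a b ⟩
    b ℚ.* (a ℚ.* a⁻¹)
      ≡⟨ cong (b ℚ.*_) (p*reciprocal 0<a) ⟩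
    b ℚ.* 1ℚ
      ≡⟨ ℚ.*-identityʳ b ⟩
    b
      ≤⟨ h ⟩
    a ℚ.+ ε ℚ.* (c ℚ.* c)
      ≤⟨ ℚ.+-monoʳ-≤ a (ℚ.*-monoˡ-≤-nonNeg ε {{ℚ.nonNegative (ℚ.<⇒≤ 0<ε)}}
           (*-mono-≤ (ℚ.<⇒≤ 0<c) (ℚ.<⇒≤ 0<b) c≤a c≤b)) ⟩
    a ℚ.+ ε ℚ.* (a ℚ.* b)
      ≡⟨ cong (ℚ._+ ε ℚ.* (a ℚ.* b)) (sym (trans (cong (a ℚ.*_) (p*reciprocal 0<b)) (ℚ.*-identityʳ a))) ⟩
    a ℚ.* (b ℚ.* b⁻¹) ℚ.+ ε ℚ.* (a ℚ.* b)
      ≡⟨ solve 4 (λ r e a b → a :* (b :* r) :+ e :* (a :* b) := (r :+ e) :* (a :* b)) refl b⁻¹ ε a b ⟩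
    (b⁻¹ ℚ.+ ε) ℚ.* (a ℚ.* b) ∎)
  where
  open ℚ.≤-Reasoning
  open ℚ-Solver
  a⁻¹ = reciprocal 0<a
  b⁻¹ = reciprocal 0<b

-- The clamp at c only affects finitely many terms, since c eventually bounds
-- x from below.
_⁻¹[_] : (x : ℝ) → 0ℝ < x → ℝ
seq (x ⁻¹[ c , 0<c , _ ]) n = reciprocal (⊔-pos (seq x n) 0<c)
cauchy (x ⁻¹[ c , 0<c , _ ]) ε 0<ε = proj₁ cx , λ m n N≤m N≤n →
  ≤+⇒∣p-q∣≤ (close m n (proj₂ cx n m N≤n N≤m)) (close n m (proj₂ cx m n N≤m N≤n))
  where
  0<η = *-pos 0<ε (*-pos 0<c 0<c)
  cx = cauchy x (ε ℚ.* (c ℚ.* c)) 0<η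
  close : ∀ m n → ℚ.∣ seq x n ℚ.- seq x m ∣ ℚ.≤ ε ℚ.* (c ℚ.* c) →
          reciprocal (⊔-pos (seq x m) 0<c) ℚ.≤ reciprocal (⊔-pos (seq x n) 0<c) ℚ.+ ε
  close m n h = reciprocal-close (⊔-pos (seq x m) 0<c) (⊔-pos (seq x n) 0<c) 0<c 0<ε
    (ℚ.p≤q⊔p (seq x m) c) (ℚ.p≤q⊔p (seq x n) c)
    (⊔-nonexpansive {seq x n} {seq x m} c (ℚ.<⇒≤ 0<η) h)

2ℚ : ℚ
2ℚ = 1ℚ ℚ.+ 1ℚ

0<1 : 0ℚ ℚ.< 1ℚ
0<1 = ℚ.positive⁻¹ 1ℚ

0≤1 : 0ℚ ℚ.≤ 1ℚ
0≤1 = ℚ.<⇒≤ 0<1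

1<2 : 1ℚ ℚ.< 2ℚ
1<2 = ℚ.+-monoʳ-< 1ℚ 0<1

^-nonNeg : ∀ {p} → 0ℚ ℚ.≤ p → ∀ n → 0ℚ ℚ.≤ p ^ n
^-nonNeg 0≤p zero = 0≤1
^-nonNeg {p} 0≤p (suc n) = ℚ.nonNegative⁻¹ _
  {{ℚ.nonNeg*nonNeg⇒nonNeg p {{ℚ.nonNegative 0≤p}} (p ^ n) {{ℚ.nonNegative (^-nonNeg 0≤p n)}}}}

^-pos : ∀ {p} → 0ℚ ℚ.< p → ∀ n → 0ℚ ℚ.< p ^ n
^-pos 0<p zero = 0<1
^-pos 0<p (suc n) = *-pos 0<p (^-pos 0<p n)

^-monoˡ-≤ : ∀ {p q} → 0ℚ ℚ.≤ p → p ℚ.≤ q → ∀ n → p ^ n ℚ.≤ q ^ n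
^-monoˡ-≤ 0≤p p≤q zero = ℚ.≤-refl
^-monoˡ-≤ 0≤p p≤q (suc n) = *-mono-≤ 0≤p (^-nonNeg (ℚ.≤-trans 0≤p p≤q) n) p≤q (^-monoˡ-≤ 0≤p p≤q n)

1≤^ : ∀ {p} → 1ℚ ℚ.≤ p → ∀ n → 1ℚ ℚ.≤ p ^ n
1≤^ 1≤p zero = ℚ.≤-refl
1≤^ 1≤p (suc n) = *-mono-≤ 0≤1 (^-nonNeg (ℚ.≤-trans 0≤1 1≤p) n) 1≤p (1≤^ 1≤p n)

2^-mono-≤ : ∀ {m n} → m ℕ.≤ n → 2ℚ ^ m ℚ.≤ 2ℚ ^ n
2^-mono-≤ {n = n} z≤n = 1≤^ (ℚ.<⇒≤ 1<2) n
2^-mono-≤ (s≤s m≤n) = ℚ.*-monoˡ-≤-nonNeg 2ℚ (2^-mono-≤ m≤n)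

2^-cancel-≤ : ∀ m n → 2ℚ ^ m ℚ.≤ 2ℚ ^ n → m ℕ.≤ n
2^-cancel-≤ m n h = ℕ.≮⇒≥ λ n<m → ℚ.<-irrefl refl (begin-strict
  2ℚ ^ n          ≡⟨ sym (ℚ.*-identityˡ (2ℚ ^ n)) ⟩
  1ℚ ℚ.* 2ℚ ^ n   <⟨ ℚ.*-monoˡ-<-pos (2ℚ ^ n) {{ℚ.positive (^-pos (ℚ.<-trans 0<1 1<2) n)}} 1<2 ⟩
  2ℚ ℚ.* 2ℚ ^ n   ≤⟨ 2^-mono-≤ n<m ⟩
  2ℚ ^ m          ≤⟨ h ⟩
  2ℚ ^ n          ∎)
  where open ℚ.≤-Reasoning

/-mono-≤ : ∀ m d n e → m ℕ.* suc e ℕ.≤ n ℕ.* suc d → (ℤ.+ m ℚ./ suc d) ℚ.≤ (ℤ.+ n ℚ./ suc e)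
/-mono-≤ m d n e h = ℚ.toℚᵘ-cancel-≤ (begin
  ℚ.toℚᵘ (ℤ.+ m ℚ./ suc d)  ≃⟨ ℚ.toℚᵘ-fromℚᵘ (ℚᵘ.mkℚᵘ (ℤ.+ m) d) ⟩
  ℚᵘ.mkℚᵘ (ℤ.+ m) d         ≤⟨ ℚᵘ.*≤* (subst₂ ℤ._≤_ (ℤ.pos-* m (suc e)) (ℤ.pos-* n (suc d)) (ℤ.+≤+ h)) ⟩
  ℚᵘ.mkℚᵘ (ℤ.+ n) e         ≃⟨ ℚᵘ.≃-sym (ℚ.toℚᵘ-fromℚᵘ (ℚᵘ.mkℚᵘ (ℤ.+ n) e)) ⟩
  ℚ.toℚᵘ (ℤ.+ n ℚ./ suc e)  ∎)
  where open ℚᵘ.≤-Reasoning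

/-+ : ∀ m d n e → (ℤ.+ m ℚ./ suc d) ℚ.+ (ℤ.+ n ℚ./ suc e) ≡
                  ℤ.+ (m ℕ.* suc e ℕ.+ n ℕ.* suc d) ℚ./ (suc d ℕ.* suc e)
/-+ m d n e = ℚ.toℚᵘ-injective (begin-equality
  ℚ.toℚᵘ ((ℤ.+ m ℚ./ suc d) ℚ.+ (ℤ.+ n ℚ./ suc e))
    ≃⟨ ℚ.toℚᵘ-homo-+ (ℤ.+ m ℚ./ suc d) (ℤ.+ n ℚ./ suc e) ⟩
  ℚ.toℚᵘ (ℤ.+ m ℚ./ suc d) ℚᵘ.+ ℚ.toℚᵘ (ℤ.+ n ℚ./ suc e)
    ≃⟨ ℚᵘ.+-cong (ℚ.toℚᵘ-fromℚᵘ (ℚᵘ.mkℚᵘ (ℤ.+ m) d)) (ℚ.toℚᵘ-fromℚᵘ (ℚᵘ.mkℚᵘ (ℤ.+ n) e)) ⟩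
  ℚᵘ.mkℚᵘ (ℤ.+ m ℤ.* ℤ.+ suc e ℤ.+ ℤ.+ n ℤ.* ℤ.+ suc d) (e ℕ.+ d ℕ.* suc e)
    ≡⟨ cong (λ i → ℚᵘ.mkℚᵘ i (e ℕ.+ d ℕ.* suc e))
         (sym (cong₂ ℤ._+_ (ℤ.pos-* m (suc e)) (ℤ.pos-* n (suc d)))) ⟩
  ℚᵘ.mkℚᵘ (ℤ.+ (m ℕ.* suc e ℕ.+ n ℕ.* suc d)) (e ℕ.+ d ℕ.* suc e)
    ≃⟨ ℚᵘ.≃-sym (ℚ.toℚᵘ-fromℚᵘ _) ⟩
  ℚ.toℚᵘ (ℤ.+ (m ℕ.* suc e ℕ.+ n ℕ.* suc d) ℚ./ (suc d ℕ.* suc e)) ∎)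
  where open ℚᵘ.≤-Reasoning

ℕ⇒ℚ : ℕ → ℚ
ℕ⇒ℚ n = ℤ.+ n ℚ./ 1

ℕ⇒ℚ-mono-≤ : ∀ {m n} → m ℕ.≤ n → ℕ⇒ℚ m ℚ.≤ ℕ⇒ℚ n
ℕ⇒ℚ-mono-≤ {m} {n} m≤n = /-mono-≤ m 0 n 0 (ℕ.*-monoˡ-≤ 1 m≤n)

ℕ⇒ℚ-+ : ∀ m n → ℕ⇒ℚ (m ℕ.+ n) ≡ ℕ⇒ℚ m ℚ.+ ℕ⇒ℚ n
ℕ⇒ℚ-+ m n = sym (trans (/-+ m 0 n 0) (cong ℕ⇒ℚ (cong₂ ℕ._+_ (ℕ.*-identityʳ m) (ℕ.*-identityʳ n))))

ℕ⇒ℚ-2^ : ∀ n → ℕ⇒ℚ (2 ℕ.^ n) ≡ 2ℚ ^ n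
ℕ⇒ℚ-2^ zero = refl
ℕ⇒ℚ-2^ (suc n) = begin
  ℕ⇒ℚ (2^n ℕ.+ (2^n ℕ.+ 0))        ≡⟨ cong (λ k → ℕ⇒ℚ (2^n ℕ.+ k)) (ℕ.+-identityʳ 2^n) ⟩
  ℕ⇒ℚ (2^n ℕ.+ 2^n)                ≡⟨ ℕ⇒ℚ-+ 2^n 2^n ⟩
  ℕ⇒ℚ 2^n ℚ.+ ℕ⇒ℚ 2^n              ≡⟨ cong₂ ℚ._+_ (ℕ⇒ℚ-2^ n) (ℕ⇒ℚ-2^ n) ⟩
  2ℚ ^ n ℚ.+ 2ℚ ^ n                ≡⟨ cong₂ ℚ._+_ (sym (ℚ.*-identityˡ (2ℚ ^ n))) (sym (ℚ.*-identityˡ (2ℚ ^ n))) ⟩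
  1ℚ ℚ.* 2ℚ ^ n ℚ.+ 1ℚ ℚ.* 2ℚ ^ n  ≡⟨ sym (ℚ.*-distribʳ-+ (2ℚ ^ n) 1ℚ 1ℚ) ⟩
  2ℚ ℚ.* 2ℚ ^ n                    ∎
  where
  open ≡-Reasoning
  2^n = 2 ℕ.^ n

2^⌊log₂n⌋≤n : ∀ n → 1 ℕ.≤ n → 2 ℕ.^ ⌊log₂ n ⌋ ℕ.≤ n
2^⌊log₂n⌋≤n = <-rec _ step
  where
  open ℕ.≤-Reasoning
  step : ∀ n → (∀ {m} → m ℕ.< n → 1 ℕ.≤ m → 2 ℕ.^ ⌊log₂ m ⌋ ℕ.≤ m) →
         1 ℕ.≤ n → 2 ℕ.^ ⌊log₂ n ⌋ ℕ.≤ n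
  step 1 _ _ = ℕ.≤-refl
  step n@(suc (suc k)) rec _ = begin
    2 ℕ.^ ⌊log₂ n ⌋
      ≡⟨ cong (2 ℕ.^_) (sym (ℕ.m+[n∸m]≡n {1} (⌊log₂⌋-mono-≤ {2} {n} (s≤s (s≤s z≤n))))) ⟩
    2 ℕ.* 2 ℕ.^ (⌊log₂ n ⌋ ℕ.∸ 1)
      ≡⟨ cong (λ l → 2 ℕ.* 2 ℕ.^ l) (sym (⌊log₂⌊n/2⌋⌋≡⌊log₂n⌋∸1 n)) ⟩
    2 ℕ.* 2 ℕ.^ ⌊log₂ h ⌋
      ≤⟨ ℕ.*-monoʳ-≤ 2 (rec (ℕ.⌊n/2⌋<n (suc k)) (s≤s z≤n)) ⟩
    2 ℕ.* h
      ≡⟨ cong (h ℕ.+_) (ℕ.+-identityʳ h) ⟩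
    h ℕ.+ h
      ≤⟨ ℕ.+-monoʳ-≤ h (ℕ.⌊n/2⌋≤⌈n/2⌉ n) ⟩
    h ℕ.+ ℕ.⌈ n /2⌉
      ≡⟨ ℕ.⌊n/2⌋+⌈n/2⌉≡n n ⟩
    n ∎
    where h = ℕ.⌊ n /2⌋

n<2^[1+⌊log₂n⌋] : ∀ n → n ℕ.< 2 ℕ.^ suc ⌊log₂ n ⌋
n<2^[1+⌊log₂n⌋] n = ℕ.≰⇒> λ 2^≤n → ℕ.<-irrefl refl
  (subst (ℕ._≤ ⌊log₂ n ⌋) (⌊log₂[2^n]⌋≡n (suc ⌊log₂ n ⌋)) (⌊log₂⌋-mono-≤ 2^≤n))

natFloor : ℚ → ℕ
natFloor p = ℤ.∣ ℚ.floor p ∣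

natFloor-mkℚ : ∀ n d .(c : Coprime n (suc d)) → natFloor (mkℚ (ℤ.+ n) d c) ≡ n ℕ./ suc d
natFloor-mkℚ n d c = cong ℤ.∣_∣ (ℤ.div-pos-is-/ℕ (ℤ.+ n) (suc d))

natFloor-lower : ∀ p → 0ℚ ℚ.≤ p → ℕ⇒ℚ (natFloor p) ℚ.≤ p
natFloor-lower p@(mkℚ (ℤ.+ n) d c) _ = begin
  ℕ⇒ℚ (natFloor p)     ≡⟨ cong ℕ⇒ℚ (natFloor-mkℚ n d c) ⟩
  ℕ⇒ℚ (n ℕ./ suc d)    ≤⟨ /-mono-≤ (n ℕ./ suc d) 0 n d
                            (ℕ.≤-trans (m/n*n≤m n (suc d)) (ℕ.≤-reflexive (sym (ℕ.*-identityʳ n)))) ⟩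
  ℤ.+ n ℚ./ suc d      ≡⟨ ℚ.↥p/↧p≡p p ⟩
  p                    ∎
  where open ℚ.≤-Reasoning
natFloor-lower (mkℚ ℤ.-[1+ n ] d c) (ℚ.*≤* ())

natFloor-upper : ∀ p → 0ℚ ℚ.≤ p → p ℚ.≤ ℕ⇒ℚ (suc (natFloor p))
natFloor-upper p@(mkℚ (ℤ.+ n) d c) _ = begin
  p                         ≡⟨ sym (ℚ.↥p/↧p≡p p) ⟩
  ℤ.+ n ℚ./ suc d           ≤⟨ /-mono-≤ n d (suc (n ℕ./ suc d)) 0 n≤ ⟩
  ℕ⇒ℚ (suc (n ℕ./ suc d))   ≡⟨ cong (ℕ⇒ℚ ∘ suc) (sym (natFloor-mkℚ n d c)) ⟩
  ℕ⇒ℚ (suc (natFloor p))    ∎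
  where
  open ℚ.≤-Reasoning
  n≤ : n ℕ.* 1 ℕ.≤ suc (n ℕ./ suc d) ℕ.* suc d
  n≤ = ℕ.≤-trans (ℕ.≤-reflexive (trans (ℕ.*-identityʳ n) (m≡m%n+[m/n]*n n (suc d))))
                 (ℕ.+-monoˡ-≤ _ (ℕ.<⇒≤ (m%n<n n (suc d))))
natFloor-upper (mkℚ ℤ.-[1+ n ] d c) (ℚ.*≤* ())

1≤natFloor : ∀ p → 1ℚ ℚ.≤ p → 1 ℕ.≤ natFloor p
1≤natFloor (mkℚ (ℤ.+ n) d c) (ℚ.*≤* h) = subst (1 ℕ.≤_) (sym (natFloor-mkℚ n d c))
  (m≥n⇒m/n>0 (ℤ.drop‿+≤+ (subst₂ ℤ._≤_ (ℤ.*-identityˡ (ℤ.+ suc d)) (ℤ.*-identityʳ (ℤ.+ n)) h)))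
1≤natFloor (mkℚ ℤ.-[1+ n ] d c) (ℚ.*≤* ())

⌊log₂⌊_⌋⌋ : ℚ → ℕ
⌊log₂⌊ p ⌋⌋ = ⌊log₂ natFloor p ⌋

2^⌊log₂⌊p⌋⌋≤p : ∀ p → 1ℚ ℚ.≤ p → 2ℚ ^ ⌊log₂⌊ p ⌋⌋ ℚ.≤ p
2^⌊log₂⌊p⌋⌋≤p p 1≤p = begin
  2ℚ ^ ⌊log₂⌊ p ⌋⌋           ≡⟨ sym (ℕ⇒ℚ-2^ ⌊log₂⌊ p ⌋⌋) ⟩
  ℕ⇒ℚ (2 ℕ.^ ⌊log₂⌊ p ⌋⌋)    ≤⟨ ℕ⇒ℚ-mono-≤ (2^⌊log₂n⌋≤n (natFloor p) 1≤⌊p⌋) ⟩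
  ℕ⇒ℚ (natFloor p)           ≤⟨ natFloor-lower p 0≤p ⟩
  p                          ∎
  where
  open ℚ.≤-Reasoning
  0≤p = ℚ.≤-trans 0≤1 1≤p
  1≤⌊p⌋ = 1≤natFloor p 1≤p

p≤2^[1+⌊log₂⌊p⌋⌋] : ∀ p → 0ℚ ℚ.≤ p → p ℚ.≤ 2ℚ ^ suc ⌊log₂⌊ p ⌋⌋
p≤2^[1+⌊log₂⌊p⌋⌋] p 0≤p = begin
  p                              ≤⟨ natFloor-upper p 0≤p ⟩
  ℕ⇒ℚ (suc (natFloor p))         ≤⟨ ℕ⇒ℚ-mono-≤ (n<2^[1+⌊log₂n⌋] (natFloor p)) ⟩
  ℕ⇒ℚ (2 ℕ.^ suc ⌊log₂⌊ p ⌋⌋)    ≡⟨ ℕ⇒ℚ-2^ (suc ⌊log₂⌊ p ⌋⌋) ⟩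
  2ℚ ^ suc ⌊log₂⌊ p ⌋⌋           ∎
  where open ℚ.≤-Reasoning

log-comparison : ∀ {p q} j k M → 1ℚ ℚ.≤ p → 1ℚ ℚ.≤ q → p ^ M ℚ.≤ 2ℚ ℚ.* q ^ M →
                 ⌊log₂⌊ p ^ j ⌋⌋ ℕ.* (k ℕ.* M) ℕ.≤ j ℕ.* k ℕ.+ suc ⌊log₂⌊ q ^ k ⌋⌋ ℕ.* (M ℕ.* j)
log-comparison {p} {q} j k M 1≤p 1≤q p^M≤2q^M = 2^-cancel-≤ _ _ (begin
  2ℚ ^ (a ℕ.* (k ℕ.* M))
    ≡⟨ sym (^-assocʳ 2ℚ a (k ℕ.* M)) ⟩
  (2ℚ ^ a) ^ (k ℕ.* M)
    ≤⟨ ^-monoˡ-≤ (^-nonNeg 0≤2 a) (2^⌊log₂⌊p⌋⌋≤p (p ^ j) (1≤^ 1≤p j)) (k ℕ.* M) ⟩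
  (p ^ j) ^ (k ℕ.* M)
    ≡⟨ ^-assocʳ p j (k ℕ.* M) ⟩
  p ^ (j ℕ.* (k ℕ.* M))
    ≡⟨ cong (p ^_) (trans (sym (ℕ.*-assoc j k M)) (ℕ.*-comm (j ℕ.* k) M)) ⟩
  p ^ (M ℕ.* (j ℕ.* k))
    ≡⟨ sym (^-assocʳ p M (j ℕ.* k)) ⟩
  (p ^ M) ^ (j ℕ.* k)
    ≤⟨ ^-monoˡ-≤ (^-nonNeg 0≤p M) p^M≤2q^M (j ℕ.* k) ⟩
  (2ℚ ℚ.* q ^ M) ^ (j ℕ.* k)
    ≡⟨ ^-distrib-* 2ℚ (q ^ M) (j ℕ.* k) ⟩
  2ℚ ^ (j ℕ.* k) ℚ.* (q ^ M) ^ (j ℕ.* k)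
    ≡⟨ cong (2ℚ ^ (j ℕ.* k) ℚ.*_) (trans (^-assocʳ q M (j ℕ.* k))
         (trans (cong (q ^_) (rearrange M j k)) (sym (^-assocʳ q k (M ℕ.* j))))) ⟩
  2ℚ ^ (j ℕ.* k) ℚ.* (q ^ k) ^ (M ℕ.* j)
    ≤⟨ ℚ.*-monoˡ-≤-nonNeg (2ℚ ^ (j ℕ.* k)) {{ℚ.nonNegative (^-nonNeg 0≤2 (j ℕ.* k))}}
         (^-monoˡ-≤ (^-nonNeg 0≤q k) (p≤2^[1+⌊log₂⌊p⌋⌋] (q ^ k) (^-nonNeg 0≤q k)) (M ℕ.* j)) ⟩
  2ℚ ^ (j ℕ.* k) ℚ.* (2ℚ ^ suc b) ^ (M ℕ.* j)
    ≡⟨ cong (2ℚ ^ (j ℕ.* k) ℚ.*_) (^-assocʳ 2ℚ (suc b) (M ℕ.* j)) ⟩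
  2ℚ ^ (j ℕ.* k) ℚ.* 2ℚ ^ (suc b ℕ.* (M ℕ.* j))
    ≡⟨ sym (^-homo-* 2ℚ (j ℕ.* k) (suc b ℕ.* (M ℕ.* j))) ⟩
  2ℚ ^ (j ℕ.* k ℕ.+ suc b ℕ.* (M ℕ.* j)) ∎)
  where
  open ℚ.≤-Reasoning
  a = ⌊log₂⌊ p ^ j ⌋⌋
  b = ⌊log₂⌊ q ^ k ⌋⌋
  0≤2 = ℚ.≤-trans 0≤1 (ℚ.<⇒≤ 1<2)
  0≤p = ℚ.≤-trans 0≤1 1≤p
  0≤q = ℚ.≤-trans 0≤1 1≤q
  rearrange : ∀ x y z → x ℕ.* (y ℕ.* z) ≡ z ℕ.* (x ℕ.* y)
  rearrange x y z = trans (sym (ℕ.*-assoc x y z)) (ℕ.*-comm (x ℕ.* y) z)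

log₂-approx : ℚ → ℕ → ℚ
log₂-approx q k = ℤ.+ ⌊log₂⌊ q ^ suc k ⌋⌋ ℚ./ suc k

log₂-approx-close : ∀ {p q} j k d → 2 ℕ.* suc d ℕ.≤ suc k → 1ℚ ℚ.≤ p → 1ℚ ℚ.≤ q →
                    p ^ (2 ℕ.* suc d) ℚ.≤ 2ℚ ℚ.* q ^ (2 ℕ.* suc d) →
                    log₂-approx p j ℚ.≤ log₂-approx q k ℚ.+ (ℤ.1ℤ ℚ./ suc d)
log₂-approx-close {p} {q} j k d M≤k 1≤p 1≤q h = ℚ.≤-trans
  (/-mono-≤ a j (b ℕ.* suc d ℕ.+ 1 ℕ.* suc k) (d ℕ.+ k ℕ.* suc d) (ℕ.*-cancelˡ-≤ 2 (begin
    2 ℕ.* (a ℕ.* (suc k ℕ.* suc d))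
      ≡⟨ solve 3 (λ a k d → con 2 :* (a :* (k :* d)) := a :* (k :* (con 2 :* d))) refl a (suc k) (suc d) ⟩
    a ℕ.* (suc k ℕ.* (2 ℕ.* suc d))
      ≤⟨ log-comparison (suc j) (suc k) (2 ℕ.* suc d) 1≤p 1≤q h ⟩
    suc j ℕ.* suc k ℕ.+ (2 ℕ.* suc d ℕ.* suc j ℕ.+ b ℕ.* (2 ℕ.* suc d ℕ.* suc j))
      ≤⟨ ℕ.+-monoʳ-≤ (suc j ℕ.* suc k) (ℕ.+-monoˡ-≤ (b ℕ.* (2 ℕ.* suc d ℕ.* suc j)) (ℕ.*-monoˡ-≤ (suc j) M≤k)) ⟩
    suc j ℕ.* suc k ℕ.+ (suc k ℕ.* suc j ℕ.+ b ℕ.* (2 ℕ.* suc d ℕ.* suc j))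
      ≡⟨ solve 4 (λ j k d b → j :* k :+ (k :* j :+ b :* (con 2 :* d :* j)) :=
                              con 2 :* ((b :* d :+ con 1 :* k) :* j)) refl (suc j) (suc k) (suc d) b ⟩
    2 ℕ.* ((b ℕ.* suc d ℕ.+ 1 ℕ.* suc k) ℕ.* suc j) ∎)))
  (ℚ.≤-reflexive (sym (/-+ b k 1 d)))
  where
  open ℕ.≤-Reasoning
  open ℕ-Solver
  a = ⌊log₂⌊ p ^ suc j ⌋⌋
  b = ⌊log₂⌊ q ^ suc k ⌋⌋

p≤q⇒0≤q-p : ∀ {p q} → p ℚ.≤ q → 0ℚ ℚ.≤ q ℚ.- p
p≤q⇒0≤q-p {p} {q} p≤q = subst (ℚ._≤ q ℚ.- p) (ℚ.+-inverseʳ p) (ℚ.+-monoˡ-≤ (ℚ.- p) p≤q)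

⋆-nonNeg : ∀ {η} → 0ℚ ℚ.≤ η → ∀ n → 0ℚ ℚ.≤ n ⋆ η
⋆-nonNeg 0≤η zero = ℚ.≤-refl
⋆-nonNeg 0≤η (suc n) = ℚ.+-mono-≤ 0≤η (⋆-nonNeg 0≤η n)

bernoulli : ∀ {η} → 0ℚ ℚ.≤ η → η ℚ.≤ 1ℚ → ∀ n → 1ℚ ℚ.- n ⋆ η ℚ.≤ (1ℚ ℚ.- η) ^ n
bernoulli _ _ zero = ℚ.≤-reflexive (ℚ.+-identityʳ 1ℚ)
bernoulli {η} 0≤η η≤1 (suc n) = begin
  1ℚ ℚ.- (η ℚ.+ n ⋆ η)
    ≡⟨ sym (ℚ.+-identityʳ (1ℚ ℚ.- (η ℚ.+ n ⋆ η))) ⟩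
  1ℚ ℚ.- (η ℚ.+ n ⋆ η) ℚ.+ 0ℚ
    ≤⟨ ℚ.+-monoʳ-≤ (1ℚ ℚ.- (η ℚ.+ n ⋆ η)) (ℚ.nonNegative⁻¹ _
         {{ℚ.nonNeg*nonNeg⇒nonNeg η {{ℚ.nonNegative 0≤η}} (n ⋆ η) {{ℚ.nonNegative (⋆-nonNeg 0≤η n)}}}}) ⟩
  1ℚ ℚ.- (η ℚ.+ n ⋆ η) ℚ.+ η ℚ.* (n ⋆ η)
    ≡⟨ solve 2 (λ η m → con 1ℚ :- (η :+ m) :+ η :* m := (con 1ℚ :- η) :* (con 1ℚ :- m)) refl η (n ⋆ η) ⟩
  (1ℚ ℚ.- η) ℚ.* (1ℚ ℚ.- n ⋆ η)
    ≤⟨ ℚ.*-monoˡ-≤-nonNeg (1ℚ ℚ.- η) {{ℚ.nonNegative (p≤q⇒0≤q-p η≤1)}} (bernoulli 0≤η η≤1 n) ⟩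
  (1ℚ ℚ.- η) ℚ.* (1ℚ ℚ.- η) ^ n ∎
  where
  open ℚ.≤-Reasoning
  open ℚ-Solver

½^ : ℕ → ℚ
½^ n = ½ ^ suc n

½^≤½ : ∀ n → ½^ n ℚ.≤ ½
½^≤½ zero = ℚ.≤-refl
½^≤½ (suc n) = ℚ.≤-trans (*-mono-≤ (ℚ.<⇒≤ 0<½) 0≤1 ℚ.≤-refl (ℚ.≤-trans (½^≤½ n) ½≤1)) (ℚ.≤-reflexive (ℚ.*-identityʳ ½))
  where
  ½≤1 : ½ ℚ.≤ 1ℚ
  ½≤1 = ℚ.≤ᵇ⇒≤ _

n⋆½^n≤½ : ∀ n → n ⋆ ½^ n ℚ.≤ ½
n⋆½^n≤½ zero = ℚ.<⇒≤ 0<½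
n⋆½^n≤½ (suc n) = begin
  ½ ℚ.* ½^ n ℚ.+ n ⋆ (½ ℚ.* ½^ n)
    ≡⟨ cong (½ ℚ.* ½^ n ℚ.+_) (sym (×-comm-* n ½ (½^ n))) ⟩
  ½ ℚ.* ½^ n ℚ.+ ½ ℚ.* (n ⋆ ½^ n)
    ≤⟨ ℚ.+-mono-≤ (ℚ.*-monoˡ-≤-nonNeg ½ (½^≤½ n)) (ℚ.*-monoˡ-≤-nonNeg ½ (n⋆½^n≤½ n)) ⟩
  ½ ℚ.* ½ ℚ.+ ½ ℚ.* ½
    ≡⟨ ½ε+½ε≡ε ½ ⟩
  ½ ∎
  where open ℚ.≤-Reasoning

^-close : ∀ {p q} M → 1ℚ ℚ.≤ p → p ℚ.≤ q ℚ.+ ½^ M → p ^ M ℚ.≤ 2ℚ ℚ.* q ^ M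
^-close {p} {q} M 1≤p p≤q+η = begin
  p ^ M
    ≡⟨ sym (ℚ.*-identityˡ (p ^ M)) ⟩
  2ℚ ℚ.* ½ ℚ.* p ^ M
    ≡⟨ ℚ.*-assoc 2ℚ ½ (p ^ M) ⟩
  2ℚ ℚ.* (½ ℚ.* p ^ M)
    ≤⟨ ℚ.*-monoˡ-≤-nonNeg 2ℚ (ℚ.*-monoʳ-≤-nonNeg (p ^ M) {{ℚ.nonNegative (^-nonNeg 0≤p M)}} ½≤[1-η]^M) ⟩
  2ℚ ℚ.* ((1ℚ ℚ.- η) ^ M ℚ.* p ^ M)
    ≡⟨ cong (2ℚ ℚ.*_) (sym (^-distrib-* (1ℚ ℚ.- η) p M)) ⟩
  2ℚ ℚ.* ((1ℚ ℚ.- η) ℚ.* p) ^ M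
    ≤⟨ ℚ.*-monoˡ-≤-nonNeg 2ℚ (^-monoˡ-≤ 0≤[1-η]p [1-η]p≤q M) ⟩
  2ℚ ℚ.* q ^ M ∎
  where
  open ℚ.≤-Reasoning
  open ℚ-Solver
  η = ½^ M
  0≤p = ℚ.≤-trans 0≤1 1≤p
  0≤η = ^-nonNeg (ℚ.<⇒≤ 0<½) (suc M)
  η≤1 : η ℚ.≤ 1ℚ
  η≤1 = ℚ.≤-trans (½^≤½ M) (ℚ.≤ᵇ⇒≤ _)
  ½≤[1-η]^M : ½ ℚ.≤ (1ℚ ℚ.- η) ^ M
  ½≤[1-η]^M = ℚ.≤-trans (ℚ.+-monoʳ-≤ 1ℚ (ℚ.neg-antimono-≤ (n⋆½^n≤½ M))) (bernoulli 0≤η η≤1 M)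
  0≤[1-η]p : 0ℚ ℚ.≤ (1ℚ ℚ.- η) ℚ.* p
  0≤[1-η]p = ℚ.nonNegative⁻¹ _
    {{ℚ.nonNeg*nonNeg⇒nonNeg (1ℚ ℚ.- η) {{ℚ.nonNegative (p≤q⇒0≤q-p η≤1)}} p {{ℚ.nonNegative 0≤p}}}}
  [1-η]p≤q : (1ℚ ℚ.- η) ℚ.* p ℚ.≤ q
  [1-η]p≤q = begin
    (1ℚ ℚ.- η) ℚ.* p
      ≡⟨ solve 2 (λ η p → (con 1ℚ :- η) :* p := p :- η :* p) refl η p ⟩
    p ℚ.- η ℚ.* p
      ≤⟨ ℚ.+-monoʳ-≤ p (ℚ.neg-antimono-≤ (ℚ.≤-trans (ℚ.≤-reflexive (sym (ℚ.*-identityʳ η)))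
           (ℚ.*-monoˡ-≤-nonNeg η {{ℚ.nonNegative 0≤η}} 1≤p))) ⟩
    p ℚ.- η
      ≤⟨ p≤q+r⇒p-q≤r p η q (ℚ.≤-trans p≤q+η (ℚ.≤-reflexive (ℚ.+-comm q η))) ⟩
    q ∎

1/denominator≤ : ∀ ε → 0ℚ ℚ.< ε → ∃ λ d → (ℤ.1ℤ ℚ./ suc d) ℚ.≤ ε
1/denominator≤ ε@(mkℚ (ℤ.+ suc n) d c) _ = d , ℚ.≤-trans
  (/-mono-≤ 1 d (suc n) d (ℕ.*-monoˡ-≤ (suc d) {1} {suc n} (s≤s z≤n))) (ℚ.≤-reflexive (ℚ.↥p/↧p≡p ε))
1/denominator≤ (mkℚ (ℤ.+ zero) d c) (ℚ.*<* (ℤ.+<+ ()))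
1/denominator≤ (mkℚ ℤ.-[1+ n ] d c) (ℚ.*<* ())

-- log₂⁺ x = log₂ (max x 1).  For rational q ≥ 1 the number
-- ⌊log₂ (q ^ k)⌋ / k lies within 1/k of log₂ q.
log₂⁺ : ℝ → ℝ
seq (log₂⁺ x) k = log₂-approx (seq x k ℚ.⊔ 1ℚ) k
cauchy (log₂⁺ x) ε 0<ε = N , λ m n N≤m N≤n →
  ≤+⇒∣p-q∣≤ (close m n (ℕ.m⊔n≤o⇒n≤o (proj₁ cx) M N≤n)
                    (proj₂ cx m n (ℕ.m⊔n≤o⇒m≤o (proj₁ cx) M N≤m) (ℕ.m⊔n≤o⇒m≤o (proj₁ cx) M N≤n)))
            (close n m (ℕ.m⊔n≤o⇒n≤o (proj₁ cx) M N≤m)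
                    (proj₂ cx n m (ℕ.m⊔n≤o⇒m≤o (proj₁ cx) M N≤n) (ℕ.m⊔n≤o⇒m≤o (proj₁ cx) M N≤m)))
  where
  d = proj₁ (1/denominator≤ ε 0<ε)
  M = 2 ℕ.* suc d
  0<η = ^-pos 0<½ (suc M)
  cx = cauchy x (½^ M) 0<η
  N = proj₁ cx ℕ.⊔ M
  close : ∀ j k → M ℕ.≤ k → ℚ.∣ seq x j ℚ.- seq x k ∣ ℚ.≤ ½^ M →
          log₂-approx (seq x j ℚ.⊔ 1ℚ) j ℚ.≤ log₂-approx (seq x k ℚ.⊔ 1ℚ) k ℚ.+ ε
  close j k M≤k h = ℚ.≤-trans
    (log₂-approx-close j k d (ℕ.m≤n⇒m≤1+n M≤k) (ℚ.p≤q⊔p (seq x j) 1ℚ) (ℚ.p≤q⊔p (seq x k) 1ℚ)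
      (^-close {q = seq x k ℚ.⊔ 1ℚ} M (ℚ.p≤q⊔p (seq x j) 1ℚ) (⊔-nonexpansive {seq x j} {seq x k} 1ℚ (ℚ.<⇒≤ 0<η) h)))
    (ℚ.+-monoʳ-≤ (log₂-approx (seq x k ℚ.⊔ 1ℚ) k) (proj₂ (1/denominator≤ ε 0<ε)))

+-0-rawMonoid : RawMonoid 0ℓ 0ℓ
+-0-rawMonoid = record { Carrier = ℝ ; _≈_ = _≃_ ; _∙_ = _+_ ; ε = 0ℝ }

open RawMonoidDefinitions +-0-rawMonoid using (sum) public

-- Polynomials in k real variables: Poly (suc k) is the list of coefficients,
-- constant term first, of powers of the first variable.
Poly : ℕ → Set
Poly zero = ℝ
Poly (suc k) = List (Poly k)

eval : ∀ {k} → Poly k → Vec ℝ k → ℝ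
eval {zero} c [] = c
eval {suc k} [] (x ∷ xs) = 0ℝ
eval {suc k} (c ∷ cs) (x ∷ xs) = eval c xs + x * eval {suc k} cs (x ∷ xs)

record Distribution (n : ℕ) : Set where
  field
    prob         : Fin n → ℝ
    nonNegative  : ∀ i → 0ℝ ≤ prob i
    total        : sum prob ≃ 1ℝ

open Distribution public

mass : ∀ {n} → Distribution n → Subset n → ℝ
mass μ A = sum λ i → if Vec.lookup A i then prob μ i else 0ℝ

variationDistance : ∀ {n} → Distribution n → Distribution n → ℝ
variationDistance μ μ′ = fromℚ ½ * sum λ i → ∣ prob μ i - prob μ′ i ∣

Property : Set₁
Property = ∀ {n} → Distribution n → Set

Far : ∀ {n} → ℝ → Distribution n → Property → Set
Far ε μ 𝒫 = ∀ μ′ → 𝒫 μ′ → ε ≤ variationDistance μ μ′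

IsUniform : Property
IsUniform {n} μ = ∀ (i : Fin n) → prob μ i ≃ fromℚ (ℚ._/_ ℤ.1ℤ n {{nonZeroIndex i}})

card-nonZero : ∀ {n} {A : Subset n} → Nonempty A → ℕ.NonZero (card A)
card-nonZero (_ , x∈A) = ℕ.>-nonZero (ℕ.≤-<-trans z≤n (x∈p⇒∣p-x∣<∣p∣ x∈A))

Query : ℕ → Set
Query n = ∃ λ (A : Subset n) → Nonempty A

-- Positivity of a real number is not decidable, so the law of the samples is
-- specified by its values in the two cases rather than defined by cases.
record ConditionalOracle {n} (μ : Distribution n) : Set where
  field
    law           : Query n → Distribution n
    conditional   : ∀ ((A , A≠∅) : Query n) (μA>0 : 0ℝ < mass μ A) {j} → j ∈ A →
                    prob (law (A , A≠∅)) j ≃ prob μ j * (mass μ A ⁻¹[ μA>0 ])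
    uniformOnNull : ∀ ((A , A≠∅) : Query n) → mass μ A ≃ 0ℝ → ∀ {j} → j ∈ A →
                    prob (law (A , A≠∅)) j ≃ fromℚ (ℚ._/_ ℤ.1ℤ (card A) {{card-nonZero A≠∅}})
    supported     : ∀ ((A , A≠∅) : Query n) {j} → j ∉ A → prob (law (A , A≠∅)) j ≃ 0ℝ

open ConditionalOracle public

-- The coin tosses ω are shared by both phases; the queries depend on ω only,
-- the verdict on ω and the samples received.
record NonAdaptiveAlgorithm (n : ℕ) : Set where
  field
    coins   : ℕ
    queries : Vec Bool coins → List (Query n)
    verdict : (ω : Vec Bool coins) → Vec (Fin n) (length (queries ω)) → Bool

open NonAdaptiveAlgorithm public

𝔼-coins : ∀ r → (Vec Bool r → ℝ) → ℝ
𝔼-coins zero f = f []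
𝔼-coins (suc r) f =
  fromℚ ½ * (𝔼-coins r (λ ω → f (true ∷ ω)) + 𝔼-coins r (λ ω → f (false ∷ ω)))

𝔼-samples : ∀ {n} {μ : Distribution n} → ConditionalOracle μ →
            (As : List (Query n)) → (Vec (Fin n) (length As) → ℝ) → ℝ
𝔼-samples O [] f = f []
𝔼-samples O (A ∷ As) f = sum λ j → prob (law O A) j * 𝔼-samples O As (λ js → f (j ∷ js))

indicator : Bool → ℝ
indicator b = if b then 1ℝ else 0ℝ

Pr[_accepts_] Pr[_rejects_] : ∀ {n} {μ : Distribution n} → NonAdaptiveAlgorithm n → ConditionalOracle μ → ℝ
Pr[ T accepts O ] =
  𝔼-coins (coins T) λ ω → 𝔼-samples O (queries T ω) λ js → indicator (verdict T ω js)
Pr[ T rejects O ] =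
  𝔼-coins (coins T) λ ω → 𝔼-samples O (queries T ω) λ js → indicator (not (verdict T ω js))

record NonAdaptiveTester (𝒫 : Property) : Set where
  field
    algorithm : ∀ n .{{_ : ℕ.NonZero n}} ε δ → 0ℝ < ε → 0ℝ < δ → NonAdaptiveAlgorithm n
    complete  : ∀ n .{{_ : ℕ.NonZero n}} ε δ (0<ε : 0ℝ < ε) (0<δ : 0ℝ < δ)
                (μ : Distribution n) (O : ConditionalOracle μ) → 𝒫 μ →
                1ℝ - δ ≤ Pr[ algorithm n ε δ 0<ε 0<δ accepts O ]
    sound     : ∀ n .{{_ : ℕ.NonZero n}} ε δ (0<ε : 0ℝ < ε) (0<δ : 0ℝ < δ)
                (μ : Distribution n) (O : ConditionalOracle μ) → Far ε μ 𝒫 →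
                1ℝ - δ ≤ Pr[ algorithm n ε δ 0<ε 0<δ rejects O ]

open NonAdaptiveTester public

MakesAtMost : ∀ {n} → NonAdaptiveAlgorithm n → ℝ → Set
MakesAtMost T b = ∀ ω → fromℕ (length (queries T ω)) ≤ b

{-# OPTIONS --safe #-}
module Submission where

-- A round of the tester picks a random set A and draws two samples from the
-- conditional law q of A.  They coincide with probability Σ q², and by
-- Lagrange's identity (gap≈pairGaps) the excess of this probability over
-- 1 / |A|, called the gap of A, equals Σ (q i - q j)² / (2 |A|), summed over
-- i and j in A.  So gaps are never negative, and if μ is uniform then all of
-- them vanish (uniform⇒gap≈0).
--
-- The set A is the intersection of k uniformly random subsets, hence has
-- density 2 ^ - k, where k is itself uniformly random below 2 ^ κ, and
-- 2 ^ κ is of order log n.  If μ is ε-far from uniform, then the expected gap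
-- is at least ε² / (2000 · 2 ^ κ) (gap-bound).  Indeed, let u = 1 / n, let h be
-- heavy and l be light, that is, μ h ≥ u ≥ μ l, and take the k with
-- 2 ^ - k ≤ μ h ≤ 2 · 2 ^ - k.  Given that A contains h and l, the expectation
-- of z = μ(A) + u |A| is at most 10 · 2 ^ - k.  The ratio (q h - q l)² / |A|
-- equals (μ h - μ l)² / (μ(A)² |A|), so it is at least (μ h - μ l)² u / z³, and
-- the tangent of the convex function z ↦ 1 / z³ (inverse-cube) bounds its
-- expectation from below (level-bound).  The resulting contribution of the
-- pair is of order (μ h - u) (u - μ l).  Summed over all pairs this gives the
-- product of the total excess of μ over u and its total deficit, both of which
-- equal the distance of μ from uniform.
--
-- The verdict comes from a betting game.  A gambler starts with capital 1, and
-- a round multiplies the capital by 1 + t Z, where Z is the indicator of a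
-- collision minus 1 / |A|.  The tester accepts when the final capital is at
-- most 2 ^ b.  Under the uniform distribution the game is fair, so by Markov's
-- inequality the capital exceeds 2 ^ b with probability at most 2 ^ - b
-- (rejects-rarely).  The inverse of the capital is at most the product of the
-- factors 1 - t Z + 2 t², whose expectation is 1 + 2 t² - t g if g is the
-- expected gap.  With t = g / 4 this is 1 - g² / 8, so by Markov's inequality
-- again a number of rounds of order b / g² makes a capital of at most 2 ^ b
-- have probability at most 2 ^ - b (accepts-rarely, decay).  Here b is of order
-- log (1 / δ), so this number is polynomial in log n, 1 / ε and log (1 / δ)
-- (few-samples).
--
-- Inequalities of real numbers are stable under double negation, so classical
-- case distinctions are available in proving them (≤-cases).  Whether μ(A) is
-- positive need not be decided: besides being a distribution supported on A, the
-- law q of A enters only through the equation q j * μ(A) = μ j for j in A, which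
-- holds in either case (law-inside).  The probabilistic argument is carried out
-- over an abstract ordered ring, whose operations do not compute, and is then
-- transferred to the real numbers.

import Defs
open import Defs using (Query; card-nonZero; ℕ⇒ℚ; 2ℚ)
open import Algebra.Bundles using (CommutativeRing)
import Algebra.Properties.CommutativeSemiring.Exp
import Algebra.Properties.Semiring.Exp
import Algebra.Properties.Semiring.Sum
import Algebra.Solver.Ring
open import Algebra.Solver.Ring.AlmostCommutativeRing
  using (fromCommutativeRing; _-Raw-AlmostCommutative⟶_)
open import Data.Bool.Base using (Bool; true; false; not; if_then_else_; _∧_)
open import Data.Fin.Base using (Fin; zero; suc; fromℕ<)
import Data.Fin.Properties as Fin
open import Data.Fin.Subset using (Subset; ⊤; ⊥; ⁅_⁆; _∩_; _∪_; _∈_; _∉_) renaming (∣_∣ to card)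
open import Data.Fin.Subset.Properties
  using (∈⊤; nonempty?; ∪-identityˡ; x∈⁅y⁆⇒x≡y; x∈p∪q⁻; ∣⁅x⁆∣≡1)
import Data.Integer.Base as ℤ
open import Data.List.Base using (List; []; _∷_; length; map)
open import Data.Maybe.Base using (Maybe) renaming (map to mapMaybe)
open import Data.Nat.Base as ℕ using (ℕ; zero; suc; z≤n; s≤s; NonZero)
open import Data.Nat.Logarithm using (⌊log₂_⌋)
import Data.Nat.Properties as ℕ
open import Data.Nat.Solver using () renaming (module +-*-Solver to ℕ-Solver)
open import Data.Product.Base using (Σ; ∃; _×_; _,_; proj₁; proj₂)
open import Data.Rational.Base as ℚ using (ℚ; 0ℚ; 1ℚ; ½)
import Data.Rational.Properties as ℚ
open import Data.Rational.Solver using () renaming (module +-*-Solver to ℚ-Solver)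
import Data.Rational.Unnormalised.Base as ℚᵘ
import Data.Rational.Unnormalised.Properties as ℚᵘ
open import Data.Sum.Base using (_⊎_; inj₁; inj₂; [_,_]′)
open import Data.Vec.Base using (Vec; []; _∷_; take; drop; lookup; here; there)
open import Data.Vec.Properties using (lookup⇒[]=; []=⇒lookup)
open import Level using (0ℓ)
open import Relation.Binary.Bundles using (Poset)
open import Relation.Binary.PropositionalEquality as ≡ using (_≡_; _≢_)
import Relation.Binary.Reasoning.PartialOrder
open import Relation.Nullary using (¬_; Dec; yes; no; does; contradiction)
open import Relation.Nullary.Decidable using (dec⇒maybe)

open Algebra.Properties.Semiring.Exp (CommutativeRing.semiring ℚ.+-*-commutativeRing)
  using () renaming (_^_ to _^ℚ_; ^-assocʳ to ^ℚ-assocʳ; ^-homo-* to ^ℚ-homo-*)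
open Algebra.Properties.CommutativeSemiring.Exp (CommutativeRing.commutativeSemiring ℚ.+-*-commutativeRing)
  using () renaming (^-distrib-* to ^ℚ-distrib-*)

-- Ordered rings

-- A commutative ring over ℚ, with an absolute value and an order that is
-- stable under double negation.  The order is total in the classical sense
-- only: the failure of x ≤ y yields y ≤ x, but neither need be decidable.
record OrderedRing : Set₁ where
  infix 4 _≤_
  field
    commutativeRing : CommutativeRing 0ℓ 0ℓ
  open CommutativeRing commutativeRing public hiding (zero)
  field
    _≤_           : Carrier → Carrier → Set
    ≤-reflexive   : ∀ {x y} → x ≈ y → x ≤ y
    ≤-trans       : ∀ {x y z} → x ≤ y → y ≤ z → x ≤ z
    ≤-antisym     : ∀ {x y} → x ≤ y → y ≤ x → x ≈ y
    ≤-stable      : ∀ {x y} → ¬ ¬ x ≤ y → x ≤ y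
    ≰⇒≥           : ∀ {x y} → ¬ x ≤ y → y ≤ x
    +-mono-≤      : ∀ {x y u v} → x ≤ y → u ≤ v → x + u ≤ y + v
    *-nonNeg      : ∀ {x y} → 0# ≤ x → 0# ≤ y → 0# ≤ x * y
    ∣_∣           : Carrier → Carrier
    0≤x⇒∣x∣≈x     : ∀ {x} → 0# ≤ x → ∣ x ∣ ≈ x
    x≤0⇒∣x∣≈-x    : ∀ {x} → x ≤ 0# → ∣ x ∣ ≈ - x
    -- The embedding of the rational numbers
    ι             : ℚ → Carrier
    ι-+           : ∀ p q → ι (p ℚ.+ q) ≈ ι p + ι q
    ι-*           : ∀ p q → ι (p ℚ.* q) ≈ ι p * ι q
    ι-neg         : ∀ p → ι (ℚ.- p) ≈ - ι p
    ι-0           : ι 0ℚ ≈ 0#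
    ι-1           : ι 1ℚ ≈ 1#
    ι-mono        : ∀ {p q} → p ℚ.≤ q → ι p ≤ ι q

module OrderedRingProperties (R : OrderedRing) where
  open OrderedRing R public
  open Algebra.Properties.Semiring.Sum semiring public
    using (sum; sum-cong-≋; ∑-distrib-+; *-distribˡ-sum; *-distribʳ-sum)

  poset : Poset 0ℓ 0ℓ 0ℓ
  poset = record { isPartialOrder = record
    { isPreorder = record { isEquivalence = isEquivalence ; reflexive = ≤-reflexive ; trans = ≤-trans }
    ; antisym = ≤-antisym } }

  module ≤-Reasoning = Relation.Binary.Reasoning.PartialOrder poset

  ι-morphism : ℚ.+-*-rawRing -Raw-AlmostCommutative⟶ fromCommutativeRing commutativeRing
  ι-morphism = record
    { ⟦_⟧ = ι ; +-homo = ι-+ ; *-homo = ι-* ; -‿homo = ι-neg ; 0-homo = ι-0 ; 1-homo = ι-1 }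

  ι-≟ : ∀ p q → Maybe (ι p ≈ ι q)
  ι-≟ p q = mapMaybe (λ p≡q → reflexive (≡.cong ι p≡q)) (dec⇒maybe (p ℚ.≟ q))

  module Solver = Algebra.Solver.Ring ℚ.+-*-rawRing (fromCommutativeRing commutativeRing) ι-morphism ι-≟

  -- As inequalities are stable, a proof of x ≤ y may distinguish the cases u ≤ v
  -- and v ≤ u.
  ≤-cases : ∀ {x y} u v → (u ≤ v → x ≤ y) → (v ≤ u → x ≤ y) → x ≤ y
  ≤-cases u v f g = ≤-stable λ ¬x≤y → ¬x≤y (g (≰⇒≥ λ u≤v → ¬x≤y (f u≤v)))

  ≤-refl : ∀ {x} → x ≤ x
  ≤-refl = ≤-reflexive refl

  ≤-respˡ : ∀ {x y z} → x ≈ y → x ≤ z → y ≤ z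
  ≤-respˡ x≈y = ≤-trans (≤-reflexive (sym x≈y))

  ≤-respʳ : ∀ {x y z} → x ≈ y → z ≤ x → z ≤ y
  ≤-respʳ x≈y z≤x = ≤-trans z≤x (≤-reflexive x≈y)

  0≤y-x⇒x≤y : ∀ {x y} → 0# ≤ y - x → x ≤ y
  0≤y-x⇒x≤y {x} {y} h = begin
    x            ≈⟨ +-identityˡ x ⟨
    0# + x       ≤⟨ +-mono-≤ h ≤-refl ⟩
    y - x + x    ≈⟨ solve 2 (λ x y → y :- x :+ x := y) refl x y ⟩
    y            ∎
    where open ≤-Reasoning
          open Solver

  x≤y⇒0≤y-x : ∀ {x y} → x ≤ y → 0# ≤ y - x
  x≤y⇒0≤y-x {x} {y} h = begin
    0#           ≈⟨ -‿inverseʳ x ⟨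
    x - x        ≤⟨ +-mono-≤ h ≤-refl ⟩
    y - x        ∎
    where open ≤-Reasoning

  -‿mono-≤ : ∀ {x y} → x ≤ y → - y ≤ - x
  -‿mono-≤ {x} {y} h = 0≤y-x⇒x≤y (≤-respʳ (solve 2 (λ x y → y :- x := :- x :- :- y) refl x y) (x≤y⇒0≤y-x h))
    where open Solver

  *-monoˡ-≤ : ∀ {x y z} → 0# ≤ z → x ≤ y → z * x ≤ z * y
  *-monoˡ-≤ {x} {y} {z} 0≤z h = 0≤y-x⇒x≤y
    (≤-respʳ (solve 3 (λ x y z → z :* (y :- x) := z :* y :- z :* x) refl x y z) (*-nonNeg 0≤z (x≤y⇒0≤y-x h)))
    where open Solver

  *-monoʳ-≤ : ∀ {x y z} → 0# ≤ z → x ≤ y → x * z ≤ y * z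
  *-monoʳ-≤ {x} {y} {z} 0≤z h = ≤-respˡ (*-comm z x) (≤-respʳ (*-comm z y) (*-monoˡ-≤ 0≤z h))

  *-mono-≤ : ∀ {x y u v} → 0# ≤ x → 0# ≤ v → x ≤ y → u ≤ v → x * u ≤ y * v
  *-mono-≤ 0≤x 0≤v x≤y u≤v = ≤-trans (*-monoˡ-≤ 0≤x u≤v) (*-monoʳ-≤ 0≤v x≤y)

  +-nonNeg : ∀ {x y} → 0# ≤ x → 0# ≤ y → 0# ≤ x + y
  +-nonNeg 0≤x 0≤y = ≤-respˡ (+-identityˡ 0#) (+-mono-≤ 0≤x 0≤y)

  x*x-nonNeg : ∀ x → 0# ≤ x * x
  x*x-nonNeg x = ≤-cases 0# x (λ 0≤x → *-nonNeg 0≤x 0≤x) λ x≤0 →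
    let 0≤-x = ≤-respʳ (+-identityˡ (- x)) (x≤y⇒0≤y-x x≤0) in
    ≤-respʳ (solve 1 (λ x → :- x :* :- x := x :* x) refl x) (*-nonNeg 0≤-x 0≤-x)
    where open Solver

  ι-nonNeg : ∀ {p} → 0ℚ ℚ.≤ p → 0# ≤ ι p
  ι-nonNeg 0≤p = ≤-respˡ ι-0 (ι-mono 0≤p)

  0≤1# : 0# ≤ 1#
  0≤1# = ≤-respʳ ι-1 (ι-nonNeg (ℚ.nonNegative⁻¹ 1ℚ))

  sum-mono : ∀ {n} {f g : Fin n → Carrier} → (∀ i → f i ≤ g i) → sum f ≤ sum g
  sum-mono {zero} h = ≤-refl
  sum-mono {suc n} h = +-mono-≤ (h zero) (sum-mono λ i → h (suc i))

  sum-cong : ∀ {n} {f g : Fin n → Carrier} → (∀ i → f i ≈ g i) → sum f ≈ sum g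
  sum-cong = sum-cong-≋

  sum-nonNeg : ∀ {n} {f : Fin n → Carrier} → (∀ i → 0# ≤ f i) → 0# ≤ sum f
  sum-nonNeg {zero} h = ≤-refl
  sum-nonNeg {suc n} h = +-nonNeg (h zero) (sum-nonNeg λ i → h (suc i))

  f≤sum : ∀ {n} {f : Fin n → Carrier} → (∀ i → 0# ≤ f i) → ∀ i → f i ≤ sum f
  f≤sum {suc n} {f} h zero = ≤-respˡ (+-identityʳ (f zero)) (+-mono-≤ ≤-refl (sum-nonNeg λ i → h (suc i)))
  f≤sum {suc n} {f} h (suc i) = ≤-respˡ (+-identityˡ (f (suc i))) (+-mono-≤ (h zero) (f≤sum (λ i → h (suc i)) i))

  sum-neg : ∀ {n} (f : Fin n → Carrier) → sum (λ i → - f i) ≈ - sum f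
  sum-neg f = begin-equality
    sum (λ i → - f i)         ≈⟨ sum-cong (λ i → solve 1 (λ x → :- x := :- con 1ℚ :* x) refl (f i)) ⟩
    sum (λ i → - ι 1ℚ * f i)  ≈⟨ *-distribˡ-sum (- ι 1ℚ) f ⟨
    - ι 1ℚ * sum f            ≈⟨ solve 1 (λ x → :- con 1ℚ :* x := :- x) refl (sum f) ⟩
    - sum f                   ∎
    where open ≤-Reasoning
          open Solver

  -- The indicator of a truth value
  ind : Bool → Carrier
  ind b = if b then 1# else 0#

  ind-nonNeg : ∀ b → 0# ≤ ind b
  ind-nonNeg true = 0≤1#
  ind-nonNeg false = ≤-refl

  ind≤1 : ∀ b → ind b ≤ 1#
  ind≤1 true = ≤-refl
  ind≤1 false = 0≤1#

  sum-0 : ∀ n → sum {n} (λ _ → 0#) ≈ 0#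
  sum-0 zero = refl
  sum-0 (suc n) = trans (+-identityˡ _) (sum-0 n)

  sum-pick : ∀ {n} (i : Fin n) (f : Fin n → Carrier) → sum (λ j → ind (does (i Fin.≟ j)) * f j) ≈ f i
  sum-pick {suc n} zero f = begin-equality
    1# * f zero + sum (λ j → 0# * f (suc j))  ≈⟨ +-cong (*-identityˡ _) (sum-cong λ j → zeroˡ (f (suc j))) ⟩
    f zero + sum {n} (λ j → 0#)               ≈⟨ +-congˡ (sum-0 n) ⟩
    f zero + 0#                               ≈⟨ +-identityʳ _ ⟩
    f zero                                    ∎
    where open ≤-Reasoning
  sum-pick (suc i) f = begin-equality
    0# * f zero + sum (λ j → ind (does (i Fin.≟ j)) * f (suc j)) ≈⟨ +-cong (zeroˡ _) (sum-pick i λ j → f (suc j)) ⟩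
    0# + f (suc i)                                     ≈⟨ +-identityˡ _ ⟩
    f (suc i)                                          ∎
    where open ≤-Reasoning

-- Expectations over coins and samples

module Expectation (R : OrderedRing) where
  open OrderedRingProperties R

  0≤½ : 0# ≤ ι ½
  0≤½ = ι-nonNeg (ℚ.nonNegative⁻¹ ½)

  -- The average of f over all outcomes of r fair coins
  𝔼-coins : ∀ r → (Vec Bool r → Carrier) → Carrier
  𝔼-coins zero f = f []
  𝔼-coins (suc r) f = ι ½ * (𝔼-coins r (λ ω → f (true ∷ ω)) + 𝔼-coins r (λ ω → f (false ∷ ω)))

  𝔼-coins-cong : ∀ r {f g : Vec Bool r → Carrier} → (∀ ω → f ω ≈ g ω) → 𝔼-coins r f ≈ 𝔼-coins r g
  𝔼-coins-cong zero h = h []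
  𝔼-coins-cong (suc r) h = *-congˡ (+-cong (𝔼-coins-cong r λ ω → h (true ∷ ω)) (𝔼-coins-cong r λ ω → h (false ∷ ω)))

  𝔼-coins-mono : ∀ r {f g : Vec Bool r → Carrier} → (∀ ω → f ω ≤ g ω) → 𝔼-coins r f ≤ 𝔼-coins r g
  𝔼-coins-mono zero h = h []
  𝔼-coins-mono (suc r) h = *-monoˡ-≤ 0≤½
    (+-mono-≤ (𝔼-coins-mono r λ ω → h (true ∷ ω)) (𝔼-coins-mono r λ ω → h (false ∷ ω)))

  𝔼-coins-const : ∀ r x → 𝔼-coins r (λ _ → x) ≈ x
  𝔼-coins-const zero x = refl
  𝔼-coins-const (suc r) x = trans (*-congˡ (+-cong (𝔼-coins-const r x) (𝔼-coins-const r x)))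
    (solve 1 (λ x → con ½ :* (x :+ x) := x) refl x)
    where open Solver

  𝔼-coins-+ : ∀ r (f g : Vec Bool r → Carrier) → 𝔼-coins r (λ ω → f ω + g ω) ≈ 𝔼-coins r f + 𝔼-coins r g
  𝔼-coins-+ zero f g = refl
  𝔼-coins-+ (suc r) f g = trans
    (*-congˡ (+-cong (𝔼-coins-+ r (λ ω → f (true ∷ ω)) λ ω → g (true ∷ ω))
                     (𝔼-coins-+ r (λ ω → f (false ∷ ω)) λ ω → g (false ∷ ω))))
    (solve 5 (λ h a b c d → h :* ((a :+ b) :+ (c :+ d)) := h :* (a :+ c) :+ h :* (b :+ d)) refl (ι ½) _ _ _ _)
    where open Solver

  𝔼-coins-* : ∀ r x (f : Vec Bool r → Carrier) → 𝔼-coins r (λ ω → x * f ω) ≈ x * 𝔼-coins r f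
  𝔼-coins-* zero x f = refl
  𝔼-coins-* (suc r) x f = trans
    (*-congˡ (+-cong (𝔼-coins-* r x λ ω → f (true ∷ ω)) (𝔼-coins-* r x λ ω → f (false ∷ ω))))
    (solve 4 (λ h x a b → h :* (x :* a :+ x :* b) := x :* (h :* (a :+ b))) refl (ι ½) x _ _)
    where open Solver

  𝔼-coins-*ʳ : ∀ r x (f : Vec Bool r → Carrier) → 𝔼-coins r (λ ω → f ω * x) ≈ 𝔼-coins r f * x
  𝔼-coins-*ʳ r x f = trans (𝔼-coins-cong r λ ω → *-comm (f ω) x) (trans (𝔼-coins-* r x f) (*-comm x _))

  𝔼-coins-sum : ∀ r {n} (f : Vec Bool r → Fin n → Carrier) →
                𝔼-coins r (λ ω → sum (f ω)) ≈ sum (λ i → 𝔼-coins r (λ ω → f ω i))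
  𝔼-coins-sum r {zero} f = 𝔼-coins-const r 0#
  𝔼-coins-sum r {suc n} f = trans (𝔼-coins-+ r (λ ω → f ω zero) λ ω → sum λ i → f ω (suc i))
    (+-congˡ (𝔼-coins-sum r λ ω i → f ω (suc i)))

  𝔼-coins-nonNeg : ∀ r {f : Vec Bool r → Carrier} → (∀ ω → 0# ≤ f ω) → 0# ≤ 𝔼-coins r f
  𝔼-coins-nonNeg r h = ≤-respˡ (𝔼-coins-const r 0#) (𝔼-coins-mono r h)

  -- Disjoint blocks of coins are independent.
  𝔼-coins-split : ∀ r {m} (f : Vec Bool r → Vec Bool m → Carrier) →
    𝔼-coins (r ℕ.+ m) (λ ω → f (take r ω) (drop r ω)) ≈ 𝔼-coins r (λ ω → 𝔼-coins m (f ω))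
  𝔼-coins-split zero f = refl
  𝔼-coins-split (suc r) f = *-congˡ (+-cong (𝔼-coins-split r λ ω → f (true ∷ ω)) (𝔼-coins-split r λ ω → f (false ∷ ω)))

  -- Every outcome of r coins has probability 2 ^ - r.
  𝔼-coins-atom : ∀ r {f : Vec Bool r → Carrier} → (∀ ω → 0# ≤ f ω) → ∀ ω → ι (½ ^ℚ r) * f ω ≤ 𝔼-coins r f
  𝔼-coins-atom zero h [] = ≤-reflexive (trans (*-congʳ ι-1) (*-identityˡ _))
  𝔼-coins-atom (suc r) {f} h (b ∷ ω) = begin
    ι (½ ℚ.* ½ ^ℚ r) * f (b ∷ ω)              ≈⟨ *-congʳ (ι-* ½ (½ ^ℚ r)) ⟩
    ι ½ * ι (½ ^ℚ r) * f (b ∷ ω)              ≈⟨ *-assoc _ _ _ ⟩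
    ι ½ * (ι (½ ^ℚ r) * f (b ∷ ω))            ≤⟨ *-monoˡ-≤ 0≤½ (≤-trans (𝔼-coins-atom r (λ ω → h (b ∷ ω)) ω) (part b)) ⟩
    ι ½ * (𝔼-coins r (λ ω → f (true ∷ ω)) + 𝔼-coins r (λ ω → f (false ∷ ω)))  ∎
    where
    open ≤-Reasoning
    part : ∀ b → 𝔼-coins r (λ ω → f (b ∷ ω)) ≤ 𝔼-coins r (λ ω → f (true ∷ ω)) + 𝔼-coins r (λ ω → f (false ∷ ω))
    part true = ≤-respˡ (+-identityʳ _) (+-mono-≤ ≤-refl (𝔼-coins-nonNeg r λ ω → h (false ∷ ω)))
    part false = ≤-respˡ (+-identityˡ _) (+-mono-≤ (𝔼-coins-nonNeg r λ ω → h (true ∷ ω)) ≤-refl)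

  module Samples {X : Set} {n : ℕ} (q : X → Fin n → Carrier) where

    -- The expectation of f over independent samples from the laws q A of the
    -- members A of As
    𝔼-samples : (As : List X) → (Vec (Fin n) (length As) → Carrier) → Carrier
    𝔼-samples [] f = f []
    𝔼-samples (A ∷ As) f = sum λ j → q A j * 𝔼-samples As (λ js → f (j ∷ js))

    𝔼-samples-cong : ∀ As {f g} → (∀ js → f js ≈ g js) → 𝔼-samples As f ≈ 𝔼-samples As g
    𝔼-samples-cong [] h = h []
    𝔼-samples-cong (A ∷ As) h = sum-cong λ j → *-congˡ (𝔼-samples-cong As λ js → h (j ∷ js))

    𝔼-samples-* : ∀ As x f → 𝔼-samples As (λ js → x * f js) ≈ x * 𝔼-samples As f
    𝔼-samples-* [] x f = refl
    𝔼-samples-* (A ∷ As) x f = trans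
      (sum-cong λ j → trans (*-congˡ (𝔼-samples-* As x λ js → f (j ∷ js)))
        (solve 3 (λ a x b → a :* (x :* b) := x :* (a :* b)) refl (q A j) x (𝔼-samples As λ js → f (j ∷ js))))
      (sym (*-distribˡ-sum x λ j → q A j * 𝔼-samples As (λ js → f (j ∷ js))))
      where open Solver

    𝔼-samples-+ : ∀ As f g → 𝔼-samples As (λ js → f js + g js) ≈ 𝔼-samples As f + 𝔼-samples As g
    𝔼-samples-+ [] f g = refl
    𝔼-samples-+ (A ∷ As) f g = trans
      (sum-cong λ j → trans (*-congˡ (𝔼-samples-+ As (λ js → f (j ∷ js)) λ js → g (j ∷ js))) (distribˡ _ _ _))
      (∑-distrib-+ (λ j → q A j * 𝔼-samples As (λ js → f (j ∷ js))) λ j → q A j * 𝔼-samples As (λ js → g (j ∷ js)))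

    module _ (q-nonNeg : ∀ A j → 0# ≤ q A j) (q-total : ∀ A → sum (q A) ≈ 1#) where

      𝔼-samples-mono : ∀ As {f g} → (∀ js → f js ≤ g js) → 𝔼-samples As f ≤ 𝔼-samples As g
      𝔼-samples-mono [] h = h []
      𝔼-samples-mono (A ∷ As) h = sum-mono λ j → *-monoˡ-≤ (q-nonNeg A j) (𝔼-samples-mono As λ js → h (j ∷ js))

      𝔼-samples-const : ∀ As x → 𝔼-samples As (λ _ → x) ≈ x
      𝔼-samples-const [] x = refl
      𝔼-samples-const (A ∷ As) x = begin-equality
        sum (λ j → q A j * 𝔼-samples As (λ _ → x))  ≈⟨ sum-cong (λ j → *-congˡ {q A j} (𝔼-samples-const As x)) ⟩
        sum (λ j → q A j * x)                       ≈⟨ *-distribʳ-sum x (q A) ⟨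
        sum (q A) * x                               ≈⟨ *-congʳ (q-total A) ⟩
        1# * x                                      ≈⟨ *-identityˡ x ⟩
        x                                           ∎
        where open ≤-Reasoning

-- Independent rounds

-- M rounds, each with r fresh coins that determine a query asked twice
module Rounds {X : Set} {r : ℕ} (query : Vec Bool r → X) where

  roundQueries : ∀ M → Vec Bool (M ℕ.* r) → List X
  roundQueries zero ω = []
  roundQueries (suc M) ω = query (take r ω) ∷ query (take r ω) ∷ roundQueries M (drop r ω)

  length-roundQueries : ∀ M ω → length (roundQueries M ω) ≡ M ℕ.* 2
  length-roundQueries zero ω = ≡.refl
  length-roundQueries (suc M) ω = ≡.cong (λ k → suc (suc k)) (length-roundQueries M (drop r ω))

  -- The product of the values of f over the rounds, each evaluated at the query
  -- and at the two samples of its round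
  payoff : ∀ {n} → (X → Fin n → Fin n → ℚ) → ∀ M ω → Vec (Fin n) (length (roundQueries M ω)) → ℚ
  payoff f zero ω [] = 1ℚ
  payoff f (suc M) ω (i ∷ j ∷ js) = f (query (take r ω)) i j ℚ.* payoff f M (drop r ω) js

module RoundsExpectation (R : OrderedRing) {X : Set} {r n : ℕ} (query : Vec Bool r → X) (q : X → Fin n → OrderedRing.Carrier R) where
  open OrderedRingProperties R
  open Expectation R
  open Samples q
  open Rounds query
  open Algebra.Properties.Semiring.Exp semiring using (_^_)

  -- The expectation of f A over two samples from q A
  𝔼-pair : (X → Fin n → Fin n → ℚ) → X → Carrier
  𝔼-pair f A = sum λ i → q A i * sum λ j → q A j * ι (f A i j)

  -- The expectation of f over the coins and the samples of one round
  𝔼-round : (X → Fin n → Fin n → ℚ) → Carrier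
  𝔼-round f = 𝔼-coins r λ ω → 𝔼-pair f (query ω)

  𝔼-samples-payoff : ∀ f M ω →
    𝔼-samples (roundQueries (suc M) ω) (λ js → ι (payoff f (suc M) ω js)) ≈
    𝔼-pair f (query (take r ω)) * 𝔼-samples (roundQueries M (drop r ω)) (λ js → ι (payoff f M (drop r ω) js))
  𝔼-samples-payoff f M ω = begin-equality
    sum (λ i → q A i * sum λ j → q A j * 𝔼-samples As (λ js → ι (f A i j ℚ.* payoff f M ω′ js)))
      ≈⟨ sum-cong (λ i → *-congˡ (sum-cong λ j → *-congˡ (trans
           (𝔼-samples-cong As λ js → ι-* (f A i j) (payoff f M ω′ js))
           (𝔼-samples-* As (ι (f A i j)) λ js → ι (payoff f M ω′ js))))) ⟩
    sum (λ i → q A i * sum λ j → q A j * (ι (f A i j) * Y))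
      ≈⟨ sum-cong (λ i → *-congˡ (trans (sum-cong λ j → sym (*-assoc (q A j) (ι (f A i j)) Y))
                                   (sym (*-distribʳ-sum Y λ j → q A j * ι (f A i j))))) ⟩
    sum (λ i → q A i * (sum (λ j → q A j * ι (f A i j)) * Y))
      ≈⟨ sum-cong (λ i → sym (*-assoc (q A i) _ Y)) ⟩
    sum (λ i → q A i * sum (λ j → q A j * ι (f A i j)) * Y)
      ≈⟨ *-distribʳ-sum Y (λ i → q A i * sum (λ j → q A j * ι (f A i j))) ⟨
    𝔼-pair f A * Y ∎
    where
    open ≤-Reasoning
    A = query (take r ω)
    ω′ = drop r ω
    As = roundQueries M ω′
    Y = 𝔼-samples As (λ js → ι (payoff f M ω′ js))

  -- Independence of the rounds
  𝔼-payoff : ∀ f M →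
    𝔼-coins (M ℕ.* r) (λ ω → 𝔼-samples (roundQueries M ω) λ js → ι (payoff f M ω js)) ≈ 𝔼-round f ^ M
  𝔼-payoff f zero = trans (𝔼-coins-const 0 _) ι-1
  𝔼-payoff f (suc M) = begin-equality
    𝔼-coins (r ℕ.+ M ℕ.* r) (λ ω → 𝔼-samples (roundQueries (suc M) ω) λ js → ι (payoff f (suc M) ω js))
      ≈⟨ 𝔼-coins-cong (r ℕ.+ M ℕ.* r) (𝔼-samples-payoff f M) ⟩
    𝔼-coins (r ℕ.+ M ℕ.* r) (λ ω → 𝔼-pair f (query (take r ω)) * Y (drop r ω))
      ≈⟨ 𝔼-coins-split r (λ a b → 𝔼-pair f (query a) * Y b) ⟩
    𝔼-coins r (λ a → 𝔼-coins (M ℕ.* r) λ b → 𝔼-pair f (query a) * Y b)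
      ≈⟨ 𝔼-coins-cong r (λ a → trans (𝔼-coins-* (M ℕ.* r) (𝔼-pair f (query a)) Y) (*-congˡ (𝔼-payoff f M))) ⟩
    𝔼-coins r (λ a → 𝔼-pair f (query a) * 𝔼-round f ^ M)
      ≈⟨ 𝔼-coins-*ʳ r (𝔼-round f ^ M) (λ a → 𝔼-pair f (query a)) ⟩
    𝔼-round f * 𝔼-round f ^ M ∎
    where
    open ≤-Reasoning
    Y : Vec Bool (M ℕ.* r) → Carrier
    Y ω = 𝔼-samples (roundQueries M ω) λ js → ι (payoff f M ω js)

-- The betting game

indℚ : Bool → ℚ
indℚ b = if b then 1ℚ else 0ℚ

ℚ-+-nonNeg : ∀ {p q} → 0ℚ ℚ.≤ p → 0ℚ ℚ.≤ q → 0ℚ ℚ.≤ p ℚ.+ q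
ℚ-+-nonNeg = ℚ.+-mono-≤

ℚ-*-nonNeg : ∀ {p q} → 0ℚ ℚ.≤ p → 0ℚ ℚ.≤ q → 0ℚ ℚ.≤ p ℚ.* q
ℚ-*-nonNeg {p} 0≤p 0≤q = ≡.subst (ℚ._≤ p ℚ.* _) (ℚ.*-zeroʳ p) (Defs.*-mono-≤ 0≤p 0≤q ℚ.≤-refl 0≤q)

0≤q-p⇒p≤q : ∀ {p q} → 0ℚ ℚ.≤ q ℚ.- p → p ℚ.≤ q
0≤q-p⇒p≤q {p} {q} h = ≡.subst (ℚ._≤ q) (ℚ.+-identityʳ p)
  (≡.subst (p ℚ.+ 0ℚ ℚ.≤_) (solve 2 (λ p q → p :+ (q :- p) := q) ≡.refl p q) (ℚ.+-monoʳ-≤ p h))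
  where open ℚ-Solver

module Collisions (R : OrderedRing) {X : Set} {n : ℕ} (q : X → Fin n → OrderedRing.Carrier R) (w : X → ℚ) where
  open OrderedRingProperties R

  -- The excess over w A of the probability that two samples drawn from q A
  -- coincide
  gap : X → Carrier
  gap A = sum (λ i → q A i * q A i) - ι (w A)

-- In a round with query A the stake is the fraction t of the capital.
module Betting {X : Set} {r : ℕ} (query : Vec Bool r → X) (w : X → ℚ) (t : ℚ) (n : ℕ) where
  open Rounds query

  -- The indicator of a collision minus w A.  The number w A is the collision
  -- probability that makes the game fair.
  surplus : X → Fin n → Fin n → ℚ
  surplus A i j = indℚ (does (i Fin.≟ j)) ℚ.- w A

  -- The factor c + s Z, where Z is the surplus
  bet : ℚ → ℚ → X → Fin n → Fin n → ℚ
  bet c s A i j = c ℚ.+ s ℚ.* surplus A i j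

  -- A round multiplies the capital by win.  The factor lose bounds the inverse
  -- of win from above.
  win lose : X → Fin n → Fin n → ℚ
  win = bet 1ℚ t
  lose = bet (1ℚ ℚ.+ 2ℚ ℚ.* (t ℚ.* t)) (ℚ.- t)

  -- The verdict: the capital after M rounds is at most B.
  accepts : ℚ → ∀ M ω → Vec (Fin n) (length (roundQueries M ω)) → Bool
  accepts B M ω js = does (payoff win M ω js ℚ.≤? B)

  module _ (0≤w : ∀ A → 0ℚ ℚ.≤ w A) (w≤1 : ∀ A → w A ℚ.≤ 1ℚ) (0≤t : 0ℚ ℚ.≤ t) (t≤½ : t ℚ.≤ ½) where

    private
      0≤1-2t : 0ℚ ℚ.≤ 1ℚ ℚ.- 2ℚ ℚ.* t
      0≤1-2t = Defs.p≤q⇒0≤q-p (ℚ.*-monoˡ-≤-nonNeg 2ℚ t≤½)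
      0≤1-t : 0ℚ ℚ.≤ 1ℚ ℚ.- t
      0≤1-t = Defs.p≤q⇒0≤q-p {t} {1ℚ} (ℚ.≤-trans t≤½ (ℚ.≤ᵇ⇒≤ _))
      0≤t*t = ℚ-*-nonNeg 0≤t 0≤t

    surplus-lower : ∀ A i j → 0ℚ ℚ.≤ 1ℚ ℚ.+ surplus A i j
    surplus-lower A i j with does (i Fin.≟ j)
    ... | true = ℚ-+-nonNeg Defs.0≤1 (Defs.p≤q⇒0≤q-p (w≤1 A))
    ... | false = ≡.subst (0ℚ ℚ.≤_) (≡.cong (1ℚ ℚ.+_) (≡.sym (ℚ.+-identityˡ (ℚ.- w A)))) (Defs.p≤q⇒0≤q-p (w≤1 A))

    surplus-upper : ∀ A i j → 0ℚ ℚ.≤ 1ℚ ℚ.- surplus A i j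
    surplus-upper A i j with does (i Fin.≟ j)
    ... | true = ≡.subst (0ℚ ℚ.≤_) (solve 1 (λ w → w := con 1ℚ :- (con 1ℚ :- w)) ≡.refl (w A)) (0≤w A)
      where open ℚ-Solver
    ... | false = ≡.subst (0ℚ ℚ.≤_) (solve 1 (λ w → con 1ℚ :+ w := con 1ℚ :- (con 0ℚ :- w)) ≡.refl (w A))
                    (ℚ-+-nonNeg Defs.0≤1 (0≤w A))
      where open ℚ-Solver

    win-nonNeg : ∀ A i j → 0ℚ ℚ.≤ win A i j
    win-nonNeg A i j = ≡.subst (0ℚ ℚ.≤_)
      (solve 2 (λ t z → (con 1ℚ :- t) :+ t :* (con 1ℚ :+ z) := con 1ℚ :+ t :* z) ≡.refl t (surplus A i j))
      (ℚ-+-nonNeg 0≤1-t (ℚ-*-nonNeg 0≤t (surplus-lower A i j)))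
      where open ℚ-Solver

    lose-nonNeg : ∀ A i j → 0ℚ ℚ.≤ lose A i j
    lose-nonNeg A i j = ≡.subst (0ℚ ℚ.≤_)
      (solve 2 (λ t z → (con 1ℚ :- t) :+ t :* (con 1ℚ :- z) :+ con 2ℚ :* (t :* t) :=
                        con 1ℚ :+ con 2ℚ :* (t :* t) :+ (:- t) :* z) ≡.refl t (surplus A i j))
      (ℚ-+-nonNeg (ℚ-+-nonNeg 0≤1-t (ℚ-*-nonNeg 0≤t (surplus-upper A i j)))
                  (ℚ-*-nonNeg (ℚ.<⇒≤ (ℚ.<-trans Defs.0<1 Defs.1<2)) 0≤t*t))
      where open ℚ-Solver

    -- With Z the surplus, win * lose - 1 = t² (1 - Z² + 1 + 2 t Z), where
    -- 1 - Z² = (1 - Z) (1 + Z) and 1 + 2 t Z = (1 - 2 t) + 2 t (1 + Z).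
    1≤win*lose : ∀ A i j → 1ℚ ℚ.≤ win A i j ℚ.* lose A i j
    1≤win*lose A i j = 0≤q-p⇒p≤q (≡.subst (0ℚ ℚ.≤_)
      (solve 2 (λ t z →
          (t :* t) :* ((con 1ℚ :- z) :* (con 1ℚ :+ z) :+ ((con 1ℚ :- con 2ℚ :* t) :+ con 2ℚ :* t :* (con 1ℚ :+ z)))
          := (con 1ℚ :+ t :* z) :* (con 1ℚ :+ con 2ℚ :* (t :* t) :+ (:- t) :* z) :- con 1ℚ)
        ≡.refl t (surplus A i j))
      (ℚ-*-nonNeg 0≤t*t (ℚ-+-nonNeg (ℚ-*-nonNeg (surplus-upper A i j) (surplus-lower A i j))
        (ℚ-+-nonNeg 0≤1-2t (ℚ-*-nonNeg (ℚ-*-nonNeg (ℚ.<⇒≤ (ℚ.<-trans Defs.0<1 Defs.1<2)) 0≤t) (surplus-lower A i j))))))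
      where open ℚ-Solver

    payoff-nonNeg : (f : X → Fin n → Fin n → ℚ) → (∀ A i j → 0ℚ ℚ.≤ f A i j) → ∀ M ω js → 0ℚ ℚ.≤ payoff f M ω js
    payoff-nonNeg f h zero ω [] = Defs.0≤1
    payoff-nonNeg f h (suc M) ω (i ∷ j ∷ js) = ℚ-*-nonNeg (h _ i j) (payoff-nonNeg f h M (drop r ω) js)

    1≤payoff*payoff : ∀ M ω js → 1ℚ ℚ.≤ payoff win M ω js ℚ.* payoff lose M ω js
    1≤payoff*payoff zero ω [] = ℚ.≤-refl
    1≤payoff*payoff (suc M) ω (i ∷ j ∷ js) = ≡.subst (1ℚ ℚ.≤_)
      (solve 4 (λ a b c d → (a :* b) :* (c :* d) := (a :* c) :* (b :* d)) ≡.refl (win A i j) (lose A i j)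
        (payoff win M (drop r ω) js) (payoff lose M (drop r ω) js))
      (Defs.*-mono-≤ Defs.0≤1
        (ℚ-*-nonNeg (payoff-nonNeg win win-nonNeg M (drop r ω) js) (payoff-nonNeg lose lose-nonNeg M (drop r ω) js))
        (1≤win*lose A i j) (1≤payoff*payoff M (drop r ω) js))
      where
      open ℚ-Solver
      A = query (take r ω)

    module _ (R : OrderedRing) (q : X → Fin n → OrderedRing.Carrier R) where
      open OrderedRingProperties R
      open Expectation R
      open Samples q
      open RoundsExpectation R query q
      open Algebra.Properties.Semiring.Exp semiring using (_^_)

      open Collisions R q w

      -- The probability that the verdict v is positive after M rounds
      Pr : ∀ M → (∀ ω → Vec (Fin n) (length (roundQueries M ω)) → Bool) → Carrier
      Pr M v = 𝔼-coins (M ℕ.* r) λ ω → 𝔼-samples (roundQueries M ω) λ js → ind (v ω js)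

      ι-indℚ : ∀ b → ι (indℚ b) ≈ ind b
      ι-indℚ true = ι-1
      ι-indℚ false = ι-0

      ^-mono : ∀ {x y} → 0# ≤ x → x ≤ y → ∀ k → x ^ k ≤ y ^ k
      ^-nonNeg : ∀ {x} → 0# ≤ x → ∀ k → 0# ≤ x ^ k
      ^-nonNeg 0≤x zero = 0≤1#
      ^-nonNeg 0≤x (suc k) = *-nonNeg 0≤x (^-nonNeg 0≤x k)
      ^-mono 0≤x x≤y zero = ≤-refl
      ^-mono 0≤x x≤y (suc k) = *-mono-≤ 0≤x (^-nonNeg (≤-trans 0≤x x≤y) k) x≤y (^-mono 0≤x x≤y k)

      ι-^ : ∀ p k → ι (p ^ℚ k) ≈ ι p ^ k
      ι-^ p zero = ι-1
      ι-^ p (suc k) = trans (ι-* p (p ^ℚ k)) (*-congˡ (ι-^ p k))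

      module _ (q-nonNeg : ∀ A j → 0# ≤ q A j) (q-total : ∀ A → sum (q A) ≈ 1#) where

        private
          weighted : ∀ A (f : Fin n → Carrier) x → sum (λ i → q A i * (x + f i)) ≈ x + sum (λ i → q A i * f i)
          weighted A f x = begin-equality
            sum (λ i → q A i * (x + f i))
              ≈⟨ sum-cong (λ i → distribˡ (q A i) x (f i)) ⟩
            sum (λ i → q A i * x + q A i * f i)
              ≈⟨ ∑-distrib-+ (λ i → q A i * x) (λ i → q A i * f i) ⟩
            sum (λ i → q A i * x) + sum (λ i → q A i * f i)
              ≈⟨ +-congʳ (sym (*-distribʳ-sum x (q A))) ⟩
            sum (q A) * x + sum (λ i → q A i * f i)
              ≈⟨ +-congʳ (trans (*-congʳ (q-total A)) (*-identityˡ x)) ⟩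
            x + sum (λ i → q A i * f i) ∎
            where open ≤-Reasoning

          scaled : ∀ A (f : Fin n → Carrier) x → sum (λ i → q A i * (x * f i)) ≈ x * sum (λ i → q A i * f i)
          scaled A f x = trans (sum-cong λ i → solve 3 (λ a x b → a :* (x :* b) := x :* (a :* b)) refl (q A i) x (f i))
            (sym (*-distribˡ-sum x λ i → q A i * f i))
            where open Solver

        𝔼-pair-bet : ∀ c s A → 𝔼-pair (bet c s) A ≈ ι c + ι s * gap A
        𝔼-pair-bet c s A = begin-equality
          sum (λ i → q A i * sum λ j → q A j * ι (c ℚ.+ s ℚ.* (indℚ (does (i Fin.≟ j)) ℚ.- w A)))
            ≈⟨ sum-cong (λ i → *-congˡ {q A i} (trans (sum-cong λ j → *-congˡ {q A j} (ι-bet (does (i Fin.≟ j))))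
                 (trans (weighted A (λ j → ι s * ind (does (i Fin.≟ j))) k) (+-congˡ
                   (trans (scaled A (λ j → ind (does (i Fin.≟ j))) (ι s)) (*-congˡ
                     (trans (sum-cong λ j → *-comm (q A j) _) (sum-pick i (q A))))))))) ⟩
          sum (λ i → q A i * (k + ι s * q A i))
            ≈⟨ trans (weighted A (λ i → ι s * q A i) k) (+-congˡ (scaled A (q A) (ι s))) ⟩
          k + ι s * sum (λ i → q A i * q A i)
            ≈⟨ solve 4 (λ c s w x → (c :- s :* w) :+ s :* x := c :+ s :* (x :- w)) refl (ι c) (ι s) (ι (w A)) _ ⟩
          ι c + ι s * gap A ∎
          where
          open ≤-Reasoning
          open Solver
          k = ι c - ι s * ι (w A)
          ι-bet : ∀ b → ι (c ℚ.+ s ℚ.* (indℚ b ℚ.- w A)) ≈ k + ι s * ind b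
          ι-bet b = begin-equality
            ι (c ℚ.+ s ℚ.* (indℚ b ℚ.- w A))
              ≈⟨ trans (ι-+ c _) (+-congˡ (trans (ι-* s _) (*-congˡ
                   (trans (ι-+ (indℚ b) _) (+-cong (ι-indℚ b) (ι-neg (w A))))))) ⟩
            ι c + ι s * (ind b - ι (w A))
              ≈⟨ solve 4 (λ c s w x → c :+ s :* (x :- w) := (c :- s :* w) :+ s :* x) refl (ι c) (ι s) (ι (w A)) (ind b) ⟩
            k + ι s * ind b ∎

        -- The expected gap of a random query
        𝔼-gap : Carrier
        𝔼-gap = 𝔼-coins r λ ω → gap (query ω)

        𝔼-round-bet : ∀ c s → 𝔼-round (bet c s) ≈ ι c + ι s * 𝔼-gap
        𝔼-round-bet c s = begin-equality
          𝔼-coins r (λ ω → 𝔼-pair (bet c s) (query ω))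
            ≈⟨ 𝔼-coins-cong r (λ ω → 𝔼-pair-bet c s (query ω)) ⟩
          𝔼-coins r (λ ω → ι c + ι s * gap (query ω))
            ≈⟨ 𝔼-coins-+ r (λ ω → ι c) (λ ω → ι s * gap (query ω)) ⟩
          𝔼-coins r (λ ω → ι c) + 𝔼-coins r (λ ω → ι s * gap (query ω))
            ≈⟨ +-cong (𝔼-coins-const r (ι c)) (𝔼-coins-* r (ι s) λ ω → gap (query ω)) ⟩
          ι c + ι s * 𝔼-gap ∎
          where open ≤-Reasoning

        -- Markov's inequality
        markov : ∀ M v f c → (∀ ω js → ind (v ω js) ≤ ι c * ι (payoff f M ω js)) →
                 Pr M v ≤ ι c * 𝔼-round f ^ M
        markov M v f c h = begin
          Pr M v
            ≤⟨ 𝔼-coins-mono (M ℕ.* r) (λ ω → 𝔼-samples-mono q-nonNeg q-total (roundQueries M ω) (h ω)) ⟩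
          𝔼-coins (M ℕ.* r) (λ ω → 𝔼-samples (roundQueries M ω) λ js → ι c * ι (payoff f M ω js))
            ≈⟨ trans (𝔼-coins-cong (M ℕ.* r) λ ω → 𝔼-samples-* (roundQueries M ω) (ι c) λ js → ι (payoff f M ω js))
                     (𝔼-coins-* (M ℕ.* r) (ι c) λ ω → 𝔼-samples (roundQueries M ω) λ js → ι (payoff f M ω js)) ⟩
          ι c * 𝔼-coins (M ℕ.* r) (λ ω → 𝔼-samples (roundQueries M ω) λ js → ι (payoff f M ω js))
            ≈⟨ *-congˡ (𝔼-payoff f M) ⟩
          ι c * 𝔼-round f ^ M ∎
          where open ≤-Reasoning

        Pr-total : ∀ M v → Pr M v + Pr M (λ ω js → not (v ω js)) ≈ 1#
        Pr-total M v = begin-equality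
          Pr M v + Pr M v′
            ≈⟨ 𝔼-coins-+ (M ℕ.* r) (λ ω → 𝔼-samples (roundQueries M ω) λ js → ind (v ω js)) _ ⟨
          𝔼-coins (M ℕ.* r) (λ ω → 𝔼-samples (roundQueries M ω) (λ js → ind (v ω js)) +
                                   𝔼-samples (roundQueries M ω) (λ js → ind (v′ ω js)))
            ≈⟨ 𝔼-coins-cong (M ℕ.* r) (λ ω → trans
                 (sym (𝔼-samples-+ (roundQueries M ω) (λ js → ind (v ω js)) λ js → ind (v′ ω js)))
                 (trans (𝔼-samples-cong (roundQueries M ω) λ js → ind-not (v ω js))
                        (𝔼-samples-const q-nonNeg q-total (roundQueries M ω) 1#))) ⟩
          𝔼-coins (M ℕ.* r) (λ ω → 1#)
            ≈⟨ 𝔼-coins-const (M ℕ.* r) 1# ⟩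
          1# ∎
          where
          open ≤-Reasoning
          v′ = λ ω js → not (v ω js)
          ind-not : ∀ b → ind b + ind (not b) ≈ 1#
          ind-not true = +-identityʳ 1#
          ind-not false = +-identityˡ 1#

        module _ (B β : ℚ) (0≤B : 0ℚ ℚ.≤ B) (0≤β : 0ℚ ℚ.≤ β) (βB≡1 : β ℚ.* B ≡ 1ℚ) (M : ℕ) where

          rejects-rarely : 𝔼-gap ≈ 0# → Pr M (λ ω js → not (accepts B M ω js)) ≤ ι β
          rejects-rarely gap≈0 = begin
            Pr M (λ ω js → not (accepts B M ω js))  ≤⟨ markov M _ win β bound ⟩
            ι β * 𝔼-round win ^ M                   ≤⟨ *-monoˡ-≤ (ι-nonNeg 0≤β) (≤-respʳ (1^ M) (^-mono 0≤ (≤-reflexive fair) M)) ⟩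
            ι β * 1#                                ≈⟨ *-identityʳ (ι β) ⟩
            ι β                                     ∎
            where
            open ≤-Reasoning
            1^ : ∀ k → 1# ^ k ≈ 1#
            1^ zero = refl
            1^ (suc k) = trans (*-identityˡ _) (1^ k)
            fair : 𝔼-round win ≈ 1#
            fair = trans (𝔼-round-bet 1ℚ t) (trans (+-cong ι-1 (trans (*-congˡ gap≈0) (zeroʳ (ι t)))) (+-identityʳ 1#))
            0≤ : 0# ≤ 𝔼-round win
            0≤ = ≤-respʳ (sym fair) 0≤1#
            bound : ∀ ω js → ind (not (accepts B M ω js)) ≤ ι β * ι (payoff win M ω js)
            bound ω js = decide (payoff win M ω js ℚ.≤? B)
              where
              W = payoff win M ω js
              0≤W = payoff-nonNeg win win-nonNeg M ω js
              decide : (d : Dec (W ℚ.≤ B)) → ind (not (does d)) ≤ ι β * ι W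
              decide (yes _) = *-nonNeg (ι-nonNeg 0≤β) (ι-nonNeg 0≤W)
              decide (no W≰B) = ≤-respˡ ι-1 (≤-respʳ (ι-* β W) (ι-mono (≡.subst (ℚ._≤ _) βB≡1
                (Defs.*-mono-≤ 0≤β 0≤W ℚ.≤-refl (ℚ.<⇒≤ (ℚ.≰⇒> W≰B))))))

          accepts-rarely : ∀ {g} → ι g ≤ 𝔼-gap → B ℚ.* (1ℚ ℚ.+ 2ℚ ℚ.* (t ℚ.* t) ℚ.- t ℚ.* g) ^ℚ M ℚ.≤ β →
                           Pr M (accepts B M) ≤ ι β
          accepts-rarely {g} g≤gap h = begin
            Pr M (accepts B M)      ≤⟨ markov M _ lose B bound ⟩
            ι B * 𝔼-round lose ^ M  ≤⟨ *-monoˡ-≤ (ι-nonNeg 0≤B) (^-mono 0≤ upper M) ⟩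
            ι B * ι ρ ^ M           ≈⟨ trans (ι-* B (ρ ^ℚ M)) (*-congˡ (ι-^ ρ M)) ⟨
            ι (B ℚ.* ρ ^ℚ M)        ≤⟨ ι-mono h ⟩
            ι β                     ∎
            where
            open ≤-Reasoning
            open Solver
            c = 1ℚ ℚ.+ 2ℚ ℚ.* (t ℚ.* t)
            ρ = c ℚ.- t ℚ.* g
            0≤ : 0# ≤ 𝔼-round lose
            0≤ = 𝔼-coins-nonNeg r λ ω → sum-nonNeg λ i → *-nonNeg (q-nonNeg (query ω) i) (sum-nonNeg λ j →
                   *-nonNeg (q-nonNeg (query ω) j) (ι-nonNeg (lose-nonNeg (query ω) i j)))
            upper : 𝔼-round lose ≤ ι ρ
            upper = begin
              𝔼-round lose           ≈⟨ 𝔼-round-bet c (ℚ.- t) ⟩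
              ι c + ι (ℚ.- t) * 𝔼-gap  ≈⟨ +-congˡ (trans (*-congʳ (ι-neg t)) (solve 2 (λ t x → :- t :* x := :- (t :* x)) refl (ι t) 𝔼-gap)) ⟩
              ι c - ι t * 𝔼-gap      ≤⟨ +-mono-≤ ≤-refl (-‿mono-≤ (*-monoˡ-≤ (ι-nonNeg 0≤t) g≤gap)) ⟩
              ι c - ι t * ι g        ≈⟨ trans (ι-+ c _) (+-congˡ (trans (ι-neg _) (-‿cong (ι-* t g)))) ⟨
              ι ρ                    ∎
            bound : ∀ ω js → ind (accepts B M ω js) ≤ ι B * ι (payoff lose M ω js)
            bound ω js = decide (payoff win M ω js ℚ.≤? B)
              where
              W = payoff win M ω js
              V = payoff lose M ω js
              0≤V = payoff-nonNeg lose lose-nonNeg M ω js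
              decide : (d : Dec (W ℚ.≤ B)) → ind (does d) ≤ ι B * ι V
              decide (no _) = *-nonNeg (ι-nonNeg 0≤B) (ι-nonNeg 0≤V)
              decide (yes W≤B) = ≤-respˡ ι-1 (≤-respʳ (ι-* B V) (ι-mono (ℚ.≤-trans (1≤payoff*payoff M ω js)
                (ℚ.*-monoʳ-≤-nonNeg V {{ℚ.nonNegative 0≤V}} W≤B))))

-- Random subsets

-- The number written in binary by a sequence of coins
value : ∀ {κ} → Vec Bool κ → ℕ
value [] = 0
value {suc κ} (b ∷ ω) = (if b then 2 ℕ.^ κ else 0) ℕ.+ value ω

value-surjective : ∀ κ k → k ℕ.< 2 ℕ.^ κ → ∃ λ (ω : Vec Bool κ) → value ω ≡ k
value-surjective zero zero _ = [] , ≡.refl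
value-surjective zero (suc k) (s≤s ())
value-surjective (suc κ) k k<2^[1+κ] with k ℕ.<? 2 ℕ.^ κ
... | yes k<2^κ = let ω , eq = value-surjective κ k k<2^κ in false ∷ ω , eq
... | no k≮2^κ =
  let 2^κ≤k = ℕ.≮⇒≥ k≮2^κ
      ω , eq = value-surjective κ (k ℕ.∸ 2 ℕ.^ κ)
        (ℕ.+-cancelˡ-< (2 ℕ.^ κ) _ _ (≡.subst₂ ℕ._<_ (≡.sym (ℕ.m+[n∸m]≡n 2^κ≤k))
          (≡.cong (2 ℕ.^ κ ℕ.+_) (ℕ.+-identityʳ (2 ℕ.^ κ))) k<2^[1+κ]))
  in true ∷ ω , ≡.trans (≡.cong (2 ℕ.^ κ ℕ.+_) eq) (ℕ.m+[n∸m]≡n 2^κ≤k)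

-- The intersection of the first k of L subsets
intersect : ∀ {n} → ℕ → ∀ L → Vec Bool (L ℕ.* n) → Subset n
intersect zero L ω = ⊤
intersect (suc k) zero ω = ⊤
intersect {n} (suc k) (suc L) ω = take n ω ∩ intersect k L (drop n ω)

∣⁅x⁆∪p∣≡1+∣p∣ : ∀ {n} (x : Fin n) (p : Subset n) → x ∉ p → card (⁅ x ⁆ ∪ p) ≡ suc (card p)
∣⁅x⁆∪p∣≡1+∣p∣ zero (true ∷ p) x∉p = contradiction here x∉p
∣⁅x⁆∪p∣≡1+∣p∣ zero (false ∷ p) x∉p = ≡.cong (λ p → suc (card p)) (∪-identityˡ p)
∣⁅x⁆∪p∣≡1+∣p∣ (suc x) (true ∷ p) x∉p = ≡.cong suc (∣⁅x⁆∪p∣≡1+∣p∣ x p λ x∈p → x∉p (there x∈p))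
∣⁅x⁆∪p∣≡1+∣p∣ (suc x) (false ∷ p) x∉p = ∣⁅x⁆∪p∣≡1+∣p∣ x p λ x∈p → x∉p (there x∈p)

module RandomSubsets (R : OrderedRing) where
  open OrderedRingProperties R
  open Expectation R

  -- The indicator of T ⊆ S.  For fixed S it turns unions of T into products.
  covers : ∀ {n} → Subset n → Subset n → Carrier
  covers [] [] = 1#
  covers (true ∷ T) (b ∷ S) = ind b * covers T S
  covers (false ∷ T) (_ ∷ S) = covers T S

  ind-∧ : ∀ a b → ind (a ∧ b) ≈ ind a * ind b
  ind-∧ true b = sym (*-identityˡ (ind b))
  ind-∧ false b = sym (zeroˡ (ind b))

  covers-∩ : ∀ {n} (T U V : Subset n) → covers T (U ∩ V) ≈ covers T U * covers T V
  covers-∩ [] [] [] = sym (*-identityˡ 1#)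
  covers-∩ (false ∷ T) (_ ∷ U) (_ ∷ V) = covers-∩ T U V
  covers-∩ (true ∷ T) (a ∷ U) (b ∷ V) = trans (*-cong (ind-∧ a b) (covers-∩ T U V))
    (solve 4 (λ a b u v → (a :* b) :* (u :* v) := (a :* u) :* (b :* v)) refl (ind a) (ind b) (covers T U) (covers T V))
    where open Solver

  covers-∪ : ∀ {n} (T T′ S : Subset n) → covers (T ∪ T′) S ≈ covers T S * covers T′ S
  covers-∪ [] [] [] = sym (*-identityˡ 1#)
  covers-∪ (false ∷ T) (false ∷ T′) (_ ∷ S) = covers-∪ T T′ S
  covers-∪ (false ∷ T) (true ∷ T′) (b ∷ S) = trans (*-congˡ (covers-∪ T T′ S))
    (solve 3 (λ b x y → b :* (x :* y) := x :* (b :* y)) refl (ind b) (covers T S) (covers T′ S))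
    where open Solver
  covers-∪ (true ∷ T) (false ∷ T′) (b ∷ S) = trans (*-congˡ (covers-∪ T T′ S)) (sym (*-assoc _ _ _))
  covers-∪ (true ∷ T) (true ∷ T′) (b ∷ S) = trans (*-cong (idem b) (covers-∪ T T′ S))
    (solve 3 (λ b x y → (b :* b) :* (x :* y) := (b :* x) :* (b :* y)) refl (ind b) (covers T S) (covers T′ S))
    where
    open Solver
    idem : ∀ b → ind b ≈ ind b * ind b
    idem true = sym (*-identityˡ 1#)
    idem false = sym (zeroˡ 0#)

  covers-⊥ : ∀ {n} (S : Subset n) → covers ⊥ S ≈ 1#
  covers-⊥ [] = refl
  covers-⊥ (_ ∷ S) = covers-⊥ S

  covers-⊤ : ∀ {n} (T : Subset n) → covers T ⊤ ≈ 1#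
  covers-⊤ [] = refl
  covers-⊤ (false ∷ T) = covers-⊤ T
  covers-⊤ (true ∷ T) = trans (*-identityˡ _) (covers-⊤ T)

  covers-⁅⁆ : ∀ {n} (i : Fin n) (S : Subset n) → covers ⁅ i ⁆ S ≈ ind (lookup S i)
  covers-⁅⁆ zero (b ∷ S) = trans (*-congˡ (covers-⊥ S)) (*-identityʳ (ind b))
  covers-⁅⁆ (suc i) (_ ∷ S) = covers-⁅⁆ i S

  𝔼-covers : ∀ {n} (T : Subset n) → 𝔼-coins n (covers T) ≈ ι (½ ^ℚ card T)
  𝔼-covers [] = sym ι-1
  𝔼-covers {suc n} (false ∷ T) = trans (solve 1 (λ x → con ½ :* (x :+ x) := x) refl _) (𝔼-covers T)
    where open Solver
  𝔼-covers {suc n} (true ∷ T) = begin-equality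
    ι ½ * (𝔼-coins n (λ S → 1# * covers T S) + 𝔼-coins n (λ S → 0# * covers T S))
      ≈⟨ *-congˡ (+-cong (𝔼-coins-* n 1# (covers T)) (𝔼-coins-* n 0# (covers T))) ⟩
    ι ½ * (1# * 𝔼-coins n (covers T) + 0# * 𝔼-coins n (covers T))
      ≈⟨ *-congˡ (trans (+-cong (*-identityˡ _) (zeroˡ _)) (+-identityʳ _)) ⟩
    ι ½ * 𝔼-coins n (covers T)
      ≈⟨ *-congˡ (𝔼-covers T) ⟩
    ι ½ * ι (½ ^ℚ card T)
      ≈⟨ ι-* ½ (½ ^ℚ card T) ⟨
    ι (½ ℚ.* ½ ^ℚ card T) ∎
    where open ≤-Reasoning

  𝔼-intersect : ∀ {n} (T : Subset n) k L → k ℕ.≤ L →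
                𝔼-coins (L ℕ.* n) (λ ω → covers T (intersect k L ω)) ≈ ι ((½ ^ℚ card T) ^ℚ k)
  𝔼-intersect {n} T zero L _ = trans (𝔼-coins-cong (L ℕ.* n) λ ω → covers-⊤ T) (trans (𝔼-coins-const (L ℕ.* n) 1#) (sym ι-1))
  𝔼-intersect {n} T (suc k) (suc L) (s≤s k≤L) = begin-equality
    𝔼-coins (n ℕ.+ L ℕ.* n) (λ ω → covers T (take n ω ∩ intersect k L (drop n ω)))
      ≈⟨ 𝔼-coins-split n (λ U ω → covers T (U ∩ intersect k L ω)) ⟩
    𝔼-coins n (λ U → 𝔼-coins (L ℕ.* n) λ ω → covers T (U ∩ intersect k L ω))
      ≈⟨ 𝔼-coins-cong n (λ U → trans
           (𝔼-coins-cong (L ℕ.* n) λ ω → covers-∩ T U (intersect k L ω))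
           (trans (𝔼-coins-* (L ℕ.* n) (covers T U) λ ω → covers T (intersect k L ω))
                  (*-congˡ (𝔼-intersect T k L k≤L)))) ⟩
    𝔼-coins n (λ U → covers T U * ι ((½ ^ℚ card T) ^ℚ k))
      ≈⟨ 𝔼-coins-*ʳ n _ (covers T) ⟩
    𝔼-coins n (covers T) * ι ((½ ^ℚ card T) ^ℚ k)
      ≈⟨ *-congʳ (𝔼-covers T) ⟩
    ι (½ ^ℚ card T) * ι ((½ ^ℚ card T) ^ℚ k)
      ≈⟨ ι-* _ _ ⟨
    ι (½ ^ℚ card T ℚ.* (½ ^ℚ card T) ^ℚ k) ∎
    where open ≤-Reasoning

  -- The previous lemma in terms of the density 2 ^ - k of the intersection
  𝔼-intersect′ : ∀ {n} (T : Subset n) k L → k ℕ.≤ L → ∀ {c} → card T ≡ c →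
                 𝔼-coins (L ℕ.* n) (λ ω → covers T (intersect k L ω)) ≈ ι ((½ ^ℚ k) ^ℚ c)
  𝔼-intersect′ T k L k≤L {c} ≡.refl = trans (𝔼-intersect T k L k≤L) (reflexive (≡.cong ι
    (≡.trans (^ℚ-assocʳ ½ c k) (≡.trans (≡.cong (½ ^ℚ_) (ℕ.*-comm c k)) (≡.sym (^ℚ-assocʳ ½ k c))))))

  -- Distinct elements lie in the intersection of k random subsets with
  -- independent probabilities 2 ^ - k.
  module _ {n : ℕ} (k L : ℕ) (k≤L : k ℕ.≤ L) where

    -- The indicator of membership in the random intersection
    χ : Vec Bool (L ℕ.* n) → Fin n → Carrier
    χ ω i = ind (lookup (intersect k L ω) i)

    ∣pair∣ : ∀ {i j : Fin n} → i ≢ j → card (⁅ i ⁆ ∪ ⁅ j ⁆) ≡ 2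
    ∣pair∣ {i} {j} i≢j = ≡.trans (∣⁅x⁆∪p∣≡1+∣p∣ i ⁅ j ⁆ (λ i∈ → i≢j (x∈⁅y⁆⇒x≡y j i∈))) (≡.cong suc (∣⁅x⁆∣≡1 j))

    𝔼-χχ : ∀ {i j} → i ≢ j → 𝔼-coins (L ℕ.* n) (λ ω → χ ω i * χ ω j) ≈ ι ((½ ^ℚ k) ^ℚ 2)
    𝔼-χχ {i} {j} i≢j = begin-equality
      𝔼-coins (L ℕ.* n) (λ ω → χ ω i * χ ω j)
        ≈⟨ 𝔼-coins-cong (L ℕ.* n) (λ ω → trans (covers-∪ ⁅ i ⁆ ⁅ j ⁆ (S ω)) (*-cong (covers-⁅⁆ i (S ω)) (covers-⁅⁆ j (S ω)))) ⟨
      𝔼-coins (L ℕ.* n) (λ ω → covers (⁅ i ⁆ ∪ ⁅ j ⁆) (S ω))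
        ≈⟨ 𝔼-intersect′ (⁅ i ⁆ ∪ ⁅ j ⁆) k L k≤L (∣pair∣ i≢j) ⟩
      ι ((½ ^ℚ k) ^ℚ 2) ∎
      where
      open ≤-Reasoning
      S = intersect {n} k L

    𝔼-χχχ : ∀ {i j l} → i ≢ j → l ≢ i → l ≢ j →
            𝔼-coins (L ℕ.* n) (λ ω → χ ω l * (χ ω i * χ ω j)) ≈ ι ((½ ^ℚ k) ^ℚ 3)
    𝔼-χχχ {i} {j} {l} i≢j l≢i l≢j = begin-equality
      𝔼-coins (L ℕ.* n) (λ ω → χ ω l * (χ ω i * χ ω j))
        ≈⟨ 𝔼-coins-cong (L ℕ.* n) (λ ω → trans (covers-∪ ⁅ l ⁆ (⁅ i ⁆ ∪ ⁅ j ⁆) (S ω)) (*-cong (covers-⁅⁆ l (S ω))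
             (trans (covers-∪ ⁅ i ⁆ ⁅ j ⁆ (S ω)) (*-cong (covers-⁅⁆ i (S ω)) (covers-⁅⁆ j (S ω)))))) ⟨
      𝔼-coins (L ℕ.* n) (λ ω → covers (⁅ l ⁆ ∪ (⁅ i ⁆ ∪ ⁅ j ⁆)) (S ω))
        ≈⟨ 𝔼-intersect′ (⁅ l ⁆ ∪ (⁅ i ⁆ ∪ ⁅ j ⁆)) k L k≤L
             (≡.trans (∣⁅x⁆∪p∣≡1+∣p∣ l (⁅ i ⁆ ∪ ⁅ j ⁆) l∉) (≡.cong suc (∣pair∣ i≢j))) ⟩
      ι ((½ ^ℚ k) ^ℚ 3) ∎
      where
      open ≤-Reasoning
      S = intersect {n} k L
      l∉ : l ∉ ⁅ i ⁆ ∪ ⁅ j ⁆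
      l∉ l∈ with x∈p∪q⁻ ⁅ i ⁆ ⁅ j ⁆ l∈
      ... | inj₁ l∈⁅i⁆ = l≢i (x∈⁅y⁆⇒x≡y i l∈⁅i⁆)
      ... | inj₂ l∈⁅j⁆ = l≢j (x∈⁅y⁆⇒x≡y j l∈⁅j⁆)

-- Queries: the full set stands in for an empty random set.
module _ (n : ℕ) .{{_ : ℕ.NonZero n}} where

  everything : Query n
  everything = ⊤ , fromℕ< (ℕ.>-nonZero⁻¹ n) , ∈⊤

  toQuery : Subset n → Query n
  toQuery S with nonempty? S
  ... | yes S≠∅ = S , S≠∅
  ... | no _ = everything

  toQuery-nonempty : ∀ {S i} → i ∈ S → proj₁ (toQuery S) ≡ S
  toQuery-nonempty {S} {i} i∈S with nonempty? S
  ... | yes _ = ≡.refl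
  ... | no S=∅ = contradiction (i , i∈S) S=∅

  -- The first κ coins choose the level k below 2 ^ κ.  The other coins are
  -- 2 ^ κ random subsets, the first k of which are intersected.
  randomQuery : ∀ κ → Vec Bool (κ ℕ.+ 2 ℕ.^ κ ℕ.* n) → Query n
  randomQuery κ ω = toQuery (intersect (value (take κ ω)) (2 ℕ.^ κ) (drop κ ω))

-- The probability that two uniform samples from a query coincide
weight : ∀ {n} → Query n → ℚ
weight (A , A≠∅) = ℚ._/_ ℤ.1ℤ (card A) {{card-nonZero A≠∅}}

-- Conditional laws and their gaps

3ℚ 4ℚ 1/10 1/2000 : ℚ
3ℚ = ℕ⇒ℚ 3
4ℚ = ℕ⇒ℚ 4
1/10 = ℤ.+ 1 ℚ./ 10
1/2000 = ℤ.+ 1 ℚ./ 2000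

ℕ⇒ℚ*1/n≡1 : ∀ n .{{_ : ℕ.NonZero n}} → ℕ⇒ℚ n ℚ.* (ℤ.+ 1 ℚ./ n) ≡ 1ℚ
ℕ⇒ℚ*1/n≡1 (suc n) = ℚ.toℚᵘ-injective (begin-equality
  ℚ.toℚᵘ (ℕ⇒ℚ (suc n) ℚ.* (ℤ.+ 1 ℚ./ suc n))
    ≃⟨ ℚ.toℚᵘ-homo-* (ℕ⇒ℚ (suc n)) (ℤ.+ 1 ℚ./ suc n) ⟩
  ℚ.toℚᵘ (ℕ⇒ℚ (suc n)) ℚᵘ.* ℚ.toℚᵘ (ℤ.+ 1 ℚ./ suc n)
    ≃⟨ ℚᵘ.*-cong (ℚ.toℚᵘ-fromℚᵘ (ℚᵘ.mkℚᵘ (ℤ.+ suc n) 0)) (ℚ.toℚᵘ-fromℚᵘ (ℚᵘ.mkℚᵘ (ℤ.+ 1) n)) ⟩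
  ℚᵘ.mkℚᵘ (ℤ.+ suc n) 0 ℚᵘ.* ℚᵘ.mkℚᵘ (ℤ.+ 1) n
    ≃⟨ ℚᵘ.*≡* (≡.cong (λ k → ℤ.+ suc k) (≡.trans
         (≡.trans (ℕ.*-identityʳ (n ℕ.* 1)) (ℕ.*-identityʳ n))
         (≡.sym (≡.trans (ℕ.+-identityʳ (n ℕ.+ 0)) (ℕ.+-identityʳ n))))) ⟩
  ℚᵘ.1ℚᵘ ∎)
  where
  open ℚᵘ.≤-Reasoning

0≤1/n : ∀ n .{{_ : ℕ.NonZero n}} → 0ℚ ℚ.≤ ℤ.+ 1 ℚ./ n
0≤1/n n = ℚ.nonNegative⁻¹ (ℤ.+ 1 ℚ./ n) {{ℚ.normalize-nonNeg 1 n}}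

1/n≤1 : ∀ n .{{_ : ℕ.NonZero n}} → ℤ.+ 1 ℚ./ n ℚ.≤ 1ℚ
1/n≤1 (suc n) = Defs./-mono-≤ 1 n 1 0 (s≤s z≤n)

2^k*½^k≡1 : ∀ k → 2ℚ ^ℚ k ℚ.* ½ ^ℚ k ≡ 1ℚ
2^k*½^k≡1 zero = ≡.refl
2^k*½^k≡1 (suc k) = ≡.trans
  (solve 2 (λ a b → (con 2ℚ :* a) :* (con ½ :* b) := a :* b) ≡.refl (2ℚ ^ℚ k) (½ ^ℚ k)) (2^k*½^k≡1 k)
  where open ℚ-Solver

0≤2^ : ∀ k → 0ℚ ℚ.≤ 2ℚ ^ℚ k
0≤2^ = Defs.^-nonNeg (ℚ.<⇒≤ (ℚ.<-trans Defs.0<1 Defs.1<2))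

0≤½^ : ∀ k → 0ℚ ℚ.≤ ½ ^ℚ k
0≤½^ = Defs.^-nonNeg (ℚ.<⇒≤ Defs.0<½)

module ConditionalLaws (R : OrderedRing) (n : ℕ) .{{_ : ℕ.NonZero n}} where
  open OrderedRingProperties R
  open Expectation R

  -- The probability of a set
  mass : (Fin n → Carrier) → Subset n → Carrier
  mass p A = sum λ i → ind (lookup A i) * p i

  -- The law q A is the distribution p conditioned on A.  The division-free
  -- equation q-inside leaves q A unconstrained inside A when A has mass zero.
  record IsConditional (p : Fin n → Carrier) (q : Query n → Fin n → Carrier) : Set where
    field
      p-nonNeg  : ∀ i → 0# ≤ p i
      p-total   : sum p ≈ 1#
      q-nonNeg  : ∀ A i → 0# ≤ q A i
      q-total   : ∀ A → sum (q A) ≈ 1#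
      q-outside : ∀ A i → lookup (proj₁ A) i ≡ false → q A i ≈ 0#
      q-inside  : ∀ A i → lookup (proj₁ A) i ≡ true → q A i * mass p (proj₁ A) ≈ p i

  sum-ind : ∀ {m} (A : Subset m) → sum (λ i → ind (lookup A i)) ≈ ι (ℕ⇒ℚ (card A))
  sum-ind [] = sym ι-0
  sum-ind (false ∷ A) = trans (+-identityˡ _) (sum-ind A)
  sum-ind (true ∷ A) = trans (+-cong (sym ι-1) (sum-ind A))
    (trans (sym (ι-+ 1ℚ _)) (reflexive (≡.cong ι (≡.sym (Defs.ℕ⇒ℚ-+ 1 (card A))))))

  sum-product : ∀ {m} (a b : Fin m → Carrier) → sum (λ i → sum λ j → a i * b j) ≈ sum a * sum b
  sum-product a b = trans (sum-cong λ i → sym (*-distribˡ-sum (a i) b)) (sym (*-distribʳ-sum (sum b) a))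

  card*weight : ∀ (A : Query n) → ι (ℕ⇒ℚ (card (proj₁ A))) * ι (weight A) ≈ 1#
  card*weight (A , A≠∅) = trans (sym (ι-* _ _)) (trans (reflexive (≡.cong ι
    (ℕ⇒ℚ*1/n≡1 (card A) {{card-nonZero A≠∅}}))) ι-1)

  weight-nonNeg : ∀ (A : Query n) → 0ℚ ℚ.≤ weight A
  weight-nonNeg (A , A≠∅) = 0≤1/n (card A) {{card-nonZero A≠∅}}

  weight≤1 : ∀ (A : Query n) → weight A ℚ.≤ 1ℚ
  weight≤1 (A , A≠∅) = 1/n≤1 (card A) {{card-nonZero A≠∅}}

  module Gap {p q} (conditional : IsConditional p q) where
    open IsConditional conditional

    open Collisions R q weight public

    square : Carrier → Carrier
    square x = x * x

    -- The contribution of the pair i, j to the gap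
    pairGap : Query n → Fin n → Fin n → Carrier
    pairGap A i j = ι (½ ℚ.* weight A) * (ind (lookup (proj₁ A) i) * ind (lookup (proj₁ A) j) * square (q A i - q A j))

    pairGap-nonNeg : ∀ A i j → 0# ≤ pairGap A i j
    pairGap-nonNeg A i j = *-nonNeg (ι-nonNeg (ℚ-*-nonNeg (ℚ.<⇒≤ Defs.0<½) (weight-nonNeg A)))
      (*-nonNeg (*-nonNeg (ind-nonNeg _) (ind-nonNeg _)) (x*x-nonNeg (q A i - q A j)))

    -- Lagrange's identity
    gap≈pairGaps : ∀ A → gap A ≈ sum (λ i → sum λ j → pairGap A i j)
    gap≈pairGaps A = sym (begin-equality
      sum (λ i → sum λ j → c * (χ i * χ j * square (q A i - q A j)))
        ≈⟨ sum-cong (λ i → sum-cong λ j → solve 5 (λ c x y a b →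
             c :* (x :* y :* ((a :- b) :* (a :- b))) :=
             (c :* (x :* (a :* a))) :* y :+ (c :* x) :* (y :* (b :* b)) :+ (:- con 2ℚ :* (c :* (x :* a))) :* (y :* b))
             refl c (χ i) (χ j) (q A i) (q A j)) ⟩
      sum (λ i → sum λ j → f i * χ j + g i * s j + h i * t j)
        ≈⟨ trans (sum-cong λ i → trans (∑-distrib-+ (λ j → f i * χ j + g i * s j) (λ j → h i * t j))
                                       (+-congʳ (∑-distrib-+ (λ j → f i * χ j) (λ j → g i * s j))))
          (trans (∑-distrib-+ (λ i → sum (λ j → f i * χ j) + sum (λ j → g i * s j)) (λ i → sum λ j → h i * t j))
                 (+-congʳ (∑-distrib-+ (λ i → sum λ j → f i * χ j) (λ i → sum λ j → g i * s j)))) ⟩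
      sum (λ i → sum λ j → f i * χ j) + sum (λ i → sum λ j → g i * s j) + sum (λ i → sum λ j → h i * t j)
        ≈⟨ +-cong (+-cong (sum-product f χ) (sum-product g s)) (sum-product h t) ⟩
      sum f * sum χ + sum g * sum s + sum h * sum t
        ≈⟨ +-cong (+-cong (*-congʳ (sym (*-distribˡ-sum c s))) (*-congʳ (sym (*-distribˡ-sum c χ))))
                  (*-congʳ (trans (sym (*-distribˡ-sum (- ι 2ℚ) λ i → c * t i)) (*-congˡ (sym (*-distribˡ-sum c t))))) ⟩
      (c * sum s) * sum χ + (c * sum χ) * sum s + (- ι 2ℚ * (c * sum t)) * sum t
        ≈⟨ +-cong (+-cong (*-cong (*-cong ι-c sum-s) (sum-ind (proj₁ A))) (*-cong (*-cong ι-c (sum-ind (proj₁ A))) sum-s))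
                  (*-cong (*-congˡ (*-cong ι-c (trans sum-t (sym ι-1)))) (trans sum-t (sym ι-1))) ⟩
      (ι ½ * w * x) * C + (ι ½ * w * C) * x + (- ι 2ℚ * (ι ½ * w * ι 1ℚ)) * ι 1ℚ
        ≈⟨ solve 3 (λ w x C → (con ½ :* w :* x) :* C :+ (con ½ :* w :* C) :* x :+ (:- con 2ℚ :* (con ½ :* w :* con 1ℚ)) :* con 1ℚ
                     := x :* (C :* w) :- w) refl w x C ⟩
      x * (C * w) - w
        ≈⟨ +-congʳ (trans (*-congˡ (card*weight A)) (*-identityʳ x)) ⟩
      x - w ∎)
      where
      open ≤-Reasoning
      open Solver
      c = ι (½ ℚ.* weight A)
      w = ι (weight A)
      C = ι (ℕ⇒ℚ (card (proj₁ A)))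
      x = sum λ i → q A i * q A i
      χ s t f g h : Fin n → Carrier
      χ i = ind (lookup (proj₁ A) i)
      s i = χ i * (q A i * q A i)
      t i = χ i * q A i
      f i = c * s i
      g i = c * χ i
      h i = - ι 2ℚ * (c * t i)
      ι-c : c ≈ ι ½ * w
      ι-c = ι-* ½ (weight A)
      χq≈q : ∀ i → t i ≈ q A i
      χq≈q i with lookup (proj₁ A) i in eq
      ... | true = *-identityˡ _
      ... | false = trans (zeroˡ _) (sym (q-outside A i eq))
      sum-t : sum t ≈ 1#
      sum-t = trans (sum-cong χq≈q) (q-total A)
      sum-s : sum s ≈ x
      sum-s = sum-cong λ i → trans (sym (*-assoc _ _ _)) (*-congʳ (χq≈q i))

-- The expected gap of a random query

module ExpectedGap (R : OrderedRing) (n : ℕ) .{{_ : ℕ.NonZero n}} where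
  open OrderedRingProperties R
  open Expectation R
  open RandomSubsets R
  open ConditionalLaws R n

  -- In the application d is a difference q h - q l, x is the mass of a query of
  -- size C with C w = 1, and D = p h - p l.  For Z = 1 / ζ the left side is
  -- D² u times (4 Z - 3 z) / Z⁴, the tangent at Z of 1 / z³.  The tangent lies below
  -- the function because, for y = ζ z,
  -- 1 - y³ (4 - 3 y) = (1 - y)² (1 + 2 y + 3 y²).  On the other hand D² u / z³ is
  -- at most w d² because x ≤ z and u ≤ z w.
  inverse-cube : ∀ {d D x z w C u ζ} → d * x ≈ D → 0# ≤ x → x ≤ z → 0# ≤ w → 0# ≤ u → C * w ≈ 1# → C * u ≤ z →
                 0# ≤ ζ → D * D * u * (ζ * ζ * ζ) * (ι 4ℚ - ι 3ℚ * (ζ * z)) ≤ w * (d * d)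
  inverse-cube {d} {D} {x} {z} {w} {C} {u} {ζ} dx≈D 0≤x x≤z 0≤w 0≤u Cw≈1 Cu≤z 0≤ζ = begin
    D * D * u * (ζ * ζ * ζ) * s
      ≈⟨ *-congʳ (*-congʳ (*-congʳ (*-cong dx≈D dx≈D))) ⟨
    d * x * (d * x) * u * (ζ * ζ * ζ) * s
      ≈⟨ solve 5 (λ d x u y s → d :* x :* (d :* x) :* u :* y :* s := x :* x :* u :* (y :* s) :* (d :* d)) refl d x u (ζ * ζ * ζ) s ⟩
    x * x * u * (ζ * ζ * ζ * s) * (d * d)
      ≤⟨ *-monoʳ-≤ (x*x-nonNeg d) (≤-cases 0# s positive negative) ⟩
    w * (d * d) ∎
    where
    open ≤-Reasoning
    open Solver
    s = ι 4ℚ - ι 3ℚ * (ζ * z)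
    0≤z = ≤-trans 0≤x x≤z
    0≤ζ³ = *-nonNeg (*-nonNeg 0≤ζ 0≤ζ) 0≤ζ
    0≤y = *-nonNeg 0≤ζ 0≤z
    u≤zw : u ≤ z * w
    u≤zw = begin
      u            ≈⟨ trans (sym (*-identityʳ u)) (*-congˡ (sym Cw≈1)) ⟩
      u * (C * w)  ≈⟨ solve 3 (λ u C w → u :* (C :* w) := C :* u :* w) refl u C w ⟩
      C * u * w    ≤⟨ *-monoʳ-≤ 0≤w Cu≤z ⟩
      z * w        ∎
    positive : 0# ≤ s → x * x * u * (ζ * ζ * ζ * s) ≤ w
    positive 0≤s = begin
      x * x * u * (ζ * ζ * ζ * s)
        ≤⟨ *-monoʳ-≤ (*-nonNeg 0≤ζ³ 0≤s) (*-mono-≤ (x*x-nonNeg x) (*-nonNeg 0≤z 0≤w) (*-mono-≤ 0≤x 0≤z x≤z x≤z) u≤zw) ⟩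
      z * z * (z * w) * (ζ * ζ * ζ * s)
        ≤⟨ 0≤y-x⇒x≤y (≤-respʳ
             (solve 3 (λ z w ζ → let y = ζ :* z in
                w :* ((con 1ℚ :- y) :* (con 1ℚ :- y) :* (con 1ℚ :+ con 2ℚ :* y :+ con 3ℚ :* (y :* y))) :=
                w :- z :* z :* (z :* w) :* (ζ :* ζ :* ζ :* (con 4ℚ :- con 3ℚ :* (ζ :* z)))) refl z w ζ)
             (*-nonNeg 0≤w (*-nonNeg (x*x-nonNeg (ι 1ℚ - ζ * z)) (+-nonNeg (+-nonNeg (ι-nonNeg Defs.0≤1)
                (*-nonNeg (ι-nonNeg (ℚ.nonNegative⁻¹ 2ℚ)) 0≤y)) (*-nonNeg (ι-nonNeg (ℚ.nonNegative⁻¹ 3ℚ)) (x*x-nonNeg (ζ * z))))))) ⟩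
      w ∎
    negative : s ≤ 0# → x * x * u * (ζ * ζ * ζ * s) ≤ w
    negative s≤0 = begin
      x * x * u * (ζ * ζ * ζ * s)
        ≤⟨ *-monoˡ-≤ (*-nonNeg (x*x-nonNeg x) 0≤u) (*-monoˡ-≤ 0≤ζ³ s≤0) ⟩
      x * x * u * (ζ * ζ * ζ * 0#)
        ≈⟨ trans (*-congˡ (zeroʳ _)) (zeroʳ _) ⟩
      0#  ≤⟨ 0≤w ⟩
      w   ∎

  module _ {p q} (conditional : IsConditional p q) (u : Carrier) (0≤u : 0# ≤ u) (nu≈1 : sum {n} (λ _ → u) ≈ 1#) where
    open IsConditional conditional
    open Gap conditional

    -- The mass of ν dominates both the mass of p and u times the size.
    ν : Fin n → Carrier
    ν i = p i + u

    ν-nonNeg : ∀ i → 0# ≤ ν i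
    ν-nonNeg i = +-nonNeg (p-nonNeg i) 0≤u

    ν-total : sum ν ≈ ι 2ℚ
    ν-total = trans (∑-distrib-+ p (λ _ → u)) (trans (+-cong (trans p-total (sym ι-1)) (trans nu≈1 (sym ι-1))) (sym (ι-+ 1ℚ 1ℚ)))

    mass-mono : ∀ {f g : Fin n → Carrier} A → (∀ i → f i ≤ g i) → mass f A ≤ mass g A
    mass-mono A h = sum-mono λ i → *-monoˡ-≤ (ind-nonNeg (lookup A i)) (h i)

    -- The inverse of ζ is the typical value of ν(S) at which the tangent is taken.
    module _ (h l : Fin n) (ζ : Carrier) (0≤ζ : 0# ≤ ζ) where

      D K : Carrier
      D = p h - p l
      K = D * D * u * (ζ * ζ * ζ)

      K-nonNeg : 0# ≤ K
      K-nonNeg = *-nonNeg (*-nonNeg (x*x-nonNeg D) 0≤u) (*-nonNeg (*-nonNeg 0≤ζ 0≤ζ) 0≤ζ)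

      -- The indicator that S contains h and l
      both : Subset n → Carrier
      both S = ind (lookup S h) * ind (lookup S l)

      -- A lower bound for the contribution of h and l, linear in products of at
      -- most three indicators, so that its expectation depends only on the
      -- probabilities that S contains given pairs and triples
      lower : Subset n → Carrier
      lower S = ι ½ * K * (both S * (ι 4ℚ - ι 3ℚ * (ζ * mass ν S)))

      inside : ∀ A → lookup (proj₁ A) h ≡ true → lookup (proj₁ A) l ≡ true →
               ι ½ * K * (ι 4ℚ - ι 3ℚ * (ζ * mass ν (proj₁ A))) ≤ ι (½ ℚ.* weight A) * square (q A h - q A l)
      inside A h∈A l∈A = begin
        ι ½ * K * (ι 4ℚ - ι 3ℚ * (ζ * mass ν (proj₁ A)))
          ≈⟨ *-assoc _ _ _ ⟩
        ι ½ * (K * (ι 4ℚ - ι 3ℚ * (ζ * mass ν (proj₁ A))))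
          ≤⟨ *-monoˡ-≤ 0≤½ (inverse-cube dx≈D (sum-nonNeg λ i → *-nonNeg (ind-nonNeg _) (p-nonNeg i))
               (mass-mono (proj₁ A) λ i → ≤-respˡ (+-identityʳ (p i)) (+-mono-≤ ≤-refl 0≤u))
               (ι-nonNeg (weight-nonNeg A)) 0≤u (card*weight A) Cu≤z 0≤ζ) ⟩
        ι ½ * (ι (weight A) * square (q A h - q A l))
          ≈⟨ *-assoc _ _ _ ⟨
        ι ½ * ι (weight A) * square (q A h - q A l)
          ≈⟨ *-congʳ (ι-* ½ (weight A)) ⟨
        ι (½ ℚ.* weight A) * square (q A h - q A l) ∎
        where
        open ≤-Reasoning
        dx≈D : (q A h - q A l) * mass p (proj₁ A) ≈ D
        dx≈D = trans (solve 3 (λ a b x → (a :- b) :* x := a :* x :- b :* x) refl (q A h) (q A l) (mass p (proj₁ A)))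
          (+-cong (q-inside A h h∈A) (-‿cong (q-inside A l l∈A)))
          where open Solver
        Cu≤z : ι (ℕ⇒ℚ (card (proj₁ A))) * u ≤ mass ν (proj₁ A)
        Cu≤z = begin
          ι (ℕ⇒ℚ (card (proj₁ A))) * u                ≈⟨ *-congʳ (sum-ind (proj₁ A)) ⟨
          sum (λ i → ind (lookup (proj₁ A) i)) * u    ≈⟨ *-distribʳ-sum u (λ i → ind (lookup (proj₁ A) i)) ⟩
          mass (λ _ → u) (proj₁ A)                    ≤⟨ mass-mono (proj₁ A) (λ i → ≤-respˡ (+-identityˡ u) (+-mono-≤ (p-nonNeg i) ≤-refl)) ⟩
          mass ν (proj₁ A)                            ∎

      lower-false : ∀ S → both S ≈ 0# → lower S ≈ 0#
      lower-false S eq = trans (*-congˡ (trans (*-congʳ eq) (zeroˡ _))) (zeroʳ _)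

      lower≤pairGap : ∀ S → lower S ≤ pairGap (toQuery n S) h l
      lower≤pairGap S = cases (lookup S h) (lookup S l) ≡.refl ≡.refl
        where
        trivial : both S ≈ 0# → lower S ≤ pairGap (toQuery n S) h l
        trivial eq = ≤-respˡ (sym (lower-false S eq)) (pairGap-nonNeg (toQuery n S) h l)
        cases : ∀ a b → lookup S h ≡ a → lookup S l ≡ b → lower S ≤ pairGap (toQuery n S) h l
        cases false _ eq _ = trivial (trans (*-congʳ (reflexive (≡.cong ind eq))) (zeroˡ _))
        cases true false _ eq = trivial (trans (*-congˡ (reflexive (≡.cong ind eq))) (zeroʳ _))
        cases true true h∈S l∈S = begin
          lower S
            ≈⟨ *-congˡ (trans (*-congʳ (one S h∈S l∈S)) (*-identityˡ _)) ⟩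
          ι ½ * K * (ι 4ℚ - ι 3ℚ * (ζ * mass ν S))
            ≡⟨ ≡.cong (λ S → ι ½ * K * (ι 4ℚ - ι 3ℚ * (ζ * mass ν S))) A≡S ⟨
          ι ½ * K * (ι 4ℚ - ι 3ℚ * (ζ * mass ν (proj₁ A)))
            ≤⟨ inside A h∈A l∈A ⟩
          ι (½ ℚ.* weight A) * square (q A h - q A l)
            ≈⟨ *-congˡ (trans (*-congʳ (one (proj₁ A) h∈A l∈A)) (*-identityˡ _)) ⟨
          pairGap A h l ∎
          where
          open ≤-Reasoning
          A = toQuery n S
          A≡S = toQuery-nonempty n (lookup⇒[]= h S h∈S)
          h∈A = ≡.trans (≡.cong (λ S → lookup S h) A≡S) h∈S
          l∈A = ≡.trans (≡.cong (λ S → lookup S l) A≡S) l∈S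
          one : ∀ S → lookup S h ≡ true → lookup S l ≡ true → both S ≈ 1#
          one S h∈S l∈S = trans (*-cong (reflexive (≡.cong ind h∈S)) (reflexive (≡.cong ind l∈S))) (*-identityˡ 1#)

      module _ (h≢l : h ≢ l) (k L : ℕ) (k≤L : k ℕ.≤ L) where
        -- The density of the random set
        ρ : ℚ
        ρ = ½ ^ℚ k

        S : Vec Bool (L ℕ.* n) → Subset n
        S = intersect k L

        𝔼 : (Vec Bool (L ℕ.* n) → Carrier) → Carrier
        𝔼 = 𝔼-coins (L ℕ.* n)

        0≤ρ = 0≤½^ k
        0≤ρ² = ι-nonNeg (Defs.^-nonNeg 0≤ρ 2)
        0≤ρ³ = ι-nonNeg (Defs.^-nonNeg 0≤ρ 3)

        coarse : ∀ i → 𝔼 (λ ω → ind (lookup (S ω) i) * both (S ω)) ≤ ι (ρ ^ℚ 2)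
        coarse i = begin
          𝔼 (λ ω → ind (lookup (S ω) i) * both (S ω))
            ≤⟨ 𝔼-coins-mono (L ℕ.* n) (λ ω → ≤-respʳ (*-identityˡ _)
                 (*-monoʳ-≤ (*-nonNeg (ind-nonNeg _) (ind-nonNeg _)) (ind≤1 (lookup (S ω) i)))) ⟩
          𝔼 (λ ω → both (S ω))
            ≈⟨ 𝔼-χχ k L k≤L h≢l ⟩
          ι (ρ ^ℚ 2) ∎
          where open ≤-Reasoning

        -- Three distinct elements lie in the random set with probability ρ³.  For
        -- i equal to h or l the probability is at most ρ².
        triple : ∀ i → 𝔼 (λ ω → ind (lookup (S ω) i) * both (S ω)) ≤
                 ι (ρ ^ℚ 3) + (ind (does (h Fin.≟ i)) * ι (ρ ^ℚ 2) + ind (does (l Fin.≟ i)) * ι (ρ ^ℚ 2))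
        triple i with h Fin.≟ i | l Fin.≟ i
        ... | no h≢i | no l≢i = ≤-reflexive (trans
          (𝔼-χχχ k L k≤L h≢l (λ e → h≢i (≡.sym e)) (λ e → l≢i (≡.sym e)))
          (sym (trans (+-congˡ (trans (+-cong (zeroˡ _) (zeroˡ _)) (+-identityʳ 0#))) (+-identityʳ _))))
        ... | yes _ | d = ≤-trans (coarse i) (≤-respˡ (trans (+-identityˡ _) (trans (+-identityʳ _) (*-identityˡ _)))
          (+-mono-≤ 0≤ρ³ (+-mono-≤ ≤-refl (*-nonNeg (ind-nonNeg (does d)) 0≤ρ²))))
        ... | no _ | yes _ = ≤-trans (coarse i) (≤-respˡ (trans (+-identityˡ _) (trans (+-identityˡ _) (*-identityˡ _)))
          (+-mono-≤ 0≤ρ³ (+-mono-≤ (*-nonNeg (ind-nonNeg false) 0≤ρ²) ≤-refl)))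

        𝔼-mass-both : 𝔼 (λ ω → mass ν (S ω) * both (S ω)) ≤ ι (ρ ^ℚ 2) * (ι 2ℚ * ι ρ + ν h + ν l)
        𝔼-mass-both = begin
          𝔼 (λ ω → mass ν (S ω) * both (S ω))
            ≈⟨ 𝔼-coins-cong (L ℕ.* n) (λ ω → trans (*-distribʳ-sum (both (S ω)) λ i → ind (lookup (S ω) i) * ν i)
                 (sum-cong λ i → solve 3 (λ x v b → x :* v :* b := v :* (x :* b)) refl _ (ν i) _)) ⟩
          𝔼 (λ ω → sum λ i → ν i * (ind (lookup (S ω) i) * both (S ω)))
            ≈⟨ trans (𝔼-coins-sum (L ℕ.* n) λ ω i → ν i * (ind (lookup (S ω) i) * both (S ω)))
                     (sum-cong λ i → 𝔼-coins-* (L ℕ.* n) (ν i) λ ω → ind (lookup (S ω) i) * both (S ω)) ⟩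
          sum (λ i → ν i * 𝔼 (λ ω → ind (lookup (S ω) i) * both (S ω)))
            ≤⟨ sum-mono (λ i → *-monoˡ-≤ (ν-nonNeg i) (triple i)) ⟩
          sum (λ i → ν i * (r³ + (δ h i * r² + δ l i * r²)))
            ≈⟨ sum-cong (λ i → solve 5 (λ v a b c d → v :* (c :+ (a :* d :+ b :* d)) := v :* c :+ (a :* v :* d :+ b :* v :* d))
                 refl (ν i) (δ h i) (δ l i) r³ r²) ⟩
          sum (λ i → ν i * r³ + (δ h i * ν i * r² + δ l i * ν i * r²))
            ≈⟨ trans (∑-distrib-+ (λ i → ν i * r³) (λ i → δ h i * ν i * r² + δ l i * ν i * r²))
                     (+-congˡ (∑-distrib-+ (λ i → δ h i * ν i * r²) (λ i → δ l i * ν i * r²))) ⟩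
          sum (λ i → ν i * r³) + (sum (λ i → δ h i * ν i * r²) + sum (λ i → δ l i * ν i * r²))
            ≈⟨ +-cong (trans (sym (*-distribʳ-sum r³ ν)) (*-congʳ ν-total)) (+-cong (pick h) (pick l)) ⟩
          ι 2ℚ * r³ + (ν h * r² + ν l * r²)
            ≈⟨ +-congʳ (*-congˡ (ι-* ρ (ρ ^ℚ 2))) ⟩
          ι 2ℚ * (ι ρ * r²) + (ν h * r² + ν l * r²)
            ≈⟨ solve 5 (λ t r s x y → t :* (r :* s) :+ (x :* s :+ y :* s) := s :* (t :* r :+ x :+ y)) refl (ι 2ℚ) (ι ρ) r² (ν h) (ν l) ⟩
          r² * (ι 2ℚ * ι ρ + ν h + ν l) ∎
          where
          open ≤-Reasoning
          open Solver
          r³ = ι (ρ ^ℚ 3)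
          r² = ι (ρ ^ℚ 2)
          δ : Fin n → Fin n → Carrier
          δ i j = ind (does (i Fin.≟ j))
          pick : ∀ j → sum (λ i → δ j i * ν i * r²) ≈ ν j * r²
          pick j = trans (sym (*-distribʳ-sum r² λ i → δ j i * ν i)) (*-congʳ (sum-pick j ν))

        𝔼-lower : ζ * (ι 2ℚ * ι ρ + ν h + ν l) ≤ 1# → ι ½ * K * ι (ρ ^ℚ 2) ≤ 𝔼 (λ ω → lower (S ω))
        𝔼-lower small = begin
          ι ½ * K * r²
            ≈⟨ *-congˡ (solve 1 (λ r → r := con 4ℚ :* r :- con 3ℚ :* (r :* con 1ℚ)) refl r²) ⟩
          ι ½ * K * (ι 4ℚ * r² - ι 3ℚ * (r² * ι 1ℚ))
            ≤⟨ *-monoˡ-≤ (*-nonNeg 0≤½ K-nonNeg) (+-mono-≤ ≤-refl (-‿mono-≤ (*-monoˡ-≤ (ι-nonNeg (ℚ.nonNegative⁻¹ 3ℚ))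
                 (*-monoˡ-≤ 0≤ρ² (≤-respʳ (sym ι-1) small))))) ⟩
          ι ½ * K * (ι 4ℚ * r² - ι 3ℚ * (r² * (ζ * m)))
            ≤⟨ *-monoˡ-≤ (*-nonNeg 0≤½ K-nonNeg) (+-mono-≤ ≤-refl (-‿mono-≤ (*-monoˡ-≤ (ι-nonNeg (ℚ.nonNegative⁻¹ 3ℚ))
                 (≤-respʳ (solve 3 (λ a b c → a :* (b :* c) := b :* (a :* c)) refl ζ r² m) (*-monoˡ-≤ 0≤ζ 𝔼-mass-both))))) ⟩
          ι ½ * K * (ι 4ℚ * r² - ι 3ℚ * (ζ * 𝔼 massBoth))
            ≈⟨ *-congˡ (+-congʳ (*-congˡ (𝔼-χχ k L k≤L h≢l))) ⟨
          ι ½ * K * (ι 4ℚ * 𝔼 both′ - ι 3ℚ * (ζ * 𝔼 massBoth))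
            ≈⟨ *-congˡ (solve 3 (λ a ζ b → con 4ℚ :* a :- con 3ℚ :* (ζ :* b) := con 4ℚ :* a :+ (:- con 3ℚ :* ζ) :* b) refl (𝔼 both′) ζ (𝔼 massBoth)) ⟩
          ι ½ * K * (ι 4ℚ * 𝔼 both′ + (- ι 3ℚ * ζ) * 𝔼 massBoth)
            ≈⟨ *-congˡ (trans (𝔼-coins-+ (L ℕ.* n) (λ ω → ι 4ℚ * both′ ω) (λ ω → (- ι 3ℚ * ζ) * massBoth ω))
                 (+-cong (𝔼-coins-* (L ℕ.* n) (ι 4ℚ) both′) (𝔼-coins-* (L ℕ.* n) (- ι 3ℚ * ζ) massBoth))) ⟨
          ι ½ * K * 𝔼 (λ ω → ι 4ℚ * both′ ω + (- ι 3ℚ * ζ) * massBoth ω)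
            ≈⟨ 𝔼-coins-* (L ℕ.* n) (ι ½ * K) (λ ω → ι 4ℚ * both′ ω + (- ι 3ℚ * ζ) * massBoth ω) ⟨
          𝔼 (λ ω → ι ½ * K * (ι 4ℚ * both′ ω + (- ι 3ℚ * ζ) * massBoth ω))
            ≈⟨ 𝔼-coins-cong (L ℕ.* n) (λ ω → *-congˡ (solve 3 (λ ζ b m →
                 con 4ℚ :* b :+ (:- con 3ℚ :* ζ) :* (m :* b) := b :* (con 4ℚ :- con 3ℚ :* (ζ :* m))) refl ζ (both′ ω) (mass ν (S ω)))) ⟩
          𝔼 (λ ω → lower (S ω)) ∎
          where
          open ≤-Reasoning
          open Solver
          r² = ι (ρ ^ℚ 2)
          m = ι 2ℚ * ι ρ + ν h + ν l
          both′ massBoth : Vec Bool (L ℕ.* n) → Carrier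
          both′ ω = both (S ω)
          massBoth ω = mass ν (S ω) * both (S ω)

    -- At a level k with 2 ^ - k ≤ p h ≤ 2 · 2 ^ - k the expectation of
    -- ν(S) is at most 10 · 2 ^ - k, given that S contains h and l.
    module _ (h l : Fin n) (h≢l : h ≢ l) (u≤ph : u ≤ p h) (pl≤u : p l ≤ u) (k L : ℕ) (k≤L : k ℕ.≤ L)
             (½^k≤ph : ι (½ ^ℚ k) ≤ p h) (ph≤2½^k : p h ≤ ι 2ℚ * ι (½ ^ℚ k)) where

      private
        r N : ℚ
        r = ½ ^ℚ k
        N = 2ℚ ^ℚ k
        ζ = ι (N ℚ.* 1/10)
        0≤ζ = ι-nonNeg (ℚ-*-nonNeg (0≤2^ k) (ℚ.nonNegative⁻¹ 1/10))
        a = p h - u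
        b = u - p l
        0≤a = x≤y⇒0≤y-x u≤ph
        0≤b = x≤y⇒0≤y-x pl≤u
        0≤ab = *-nonNeg 0≤a 0≤b

        small : ζ * (ι 2ℚ * ι r + ν h + ν l) ≤ 1#
        small = begin
          ζ * (ι 2ℚ * ι r + ν h + ν l)
            ≤⟨ *-monoˡ-≤ 0≤ζ (+-mono-≤ (+-mono-≤ ≤-refl (+-mono-≤ ph≤2½^k u≤)) (+-mono-≤ (≤-trans pl≤u u≤) u≤)) ⟩
          ζ * (ι 2ℚ * ι r + (ι 2ℚ * ι r + ι 2ℚ * ι r) + (ι 2ℚ * ι r + ι 2ℚ * ι r))
            ≈⟨ *-congʳ (ι-* N 1/10) ⟩
          ι N * ι 1/10 * (ι 2ℚ * ι r + (ι 2ℚ * ι r + ι 2ℚ * ι r) + (ι 2ℚ * ι r + ι 2ℚ * ι r))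
            ≈⟨ solve 2 (λ N r → let 2r = con 2ℚ :* r in N :* con 1/10 :* (2r :+ (2r :+ 2r) :+ (2r :+ 2r)) := N :* r) refl (ι N) (ι r) ⟩
          ι N * ι r
            ≈⟨ ι-* N r ⟨
          ι (N ℚ.* r)
            ≡⟨ ≡.cong ι (2^k*½^k≡1 k) ⟩
          ι 1ℚ
            ≈⟨ ι-1 ⟩
          1# ∎
          where
          open ≤-Reasoning
          open Solver
          u≤ = ≤-trans u≤ph ph≤2½^k

        1≤N*ph : 1# ≤ ι N * p h
        1≤N*ph = begin
          1#            ≈⟨ ι-1 ⟨
          ι 1ℚ          ≡⟨ ≡.cong ι (2^k*½^k≡1 k) ⟨
          ι (N ℚ.* r)   ≈⟨ ι-* N r ⟩
          ι N * ι r     ≤⟨ *-monoˡ-≤ (ι-nonNeg (0≤2^ k)) ½^k≤ph ⟩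
          ι N * p h     ∎
          where open ≤-Reasoning

        -- In terms of a = p h - u and b = u - p l this says that (a + u) a b is
        -- at most (a + b)² u, which holds since b ≤ u.
        contribution : p h * (a * b) ≤ (p h - p l) * (p h - p l) * u
        contribution = 0≤y-x⇒x≤y (≤-respʳ
          (solve 3 (λ h l u → (h :- u) :* (h :- u) :* l :+ (h :- u) :* (u :- l) :* u :+ (u :- l) :* (u :- l) :* u :=
                              (h :- l) :* (h :- l) :* u :- h :* ((h :- u) :* (u :- l))) refl (p h) (p l) u)
          (+-nonNeg (+-nonNeg (*-nonNeg (x*x-nonNeg a) (p-nonNeg l)) (*-nonNeg 0≤ab 0≤u)) (*-nonNeg (x*x-nonNeg b) 0≤u)))
          where open Solver

        constant : ½ ℚ.* ((N ℚ.* 1/10) ℚ.* (N ℚ.* 1/10) ℚ.* (N ℚ.* 1/10)) ℚ.* r ^ℚ 2 ≡ 1/2000 ℚ.* N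
        constant = ≡.trans
          (solve 2 (λ N r → con ½ :* ((N :* con 1/10) :* (N :* con 1/10) :* (N :* con 1/10)) :* (r :* (r :* con 1ℚ)) :=
                            con 1/2000 :* N :* ((N :* r) :* (N :* r))) ≡.refl N r)
          (≡.trans (≡.cong (λ x → 1/2000 ℚ.* N ℚ.* (x ℚ.* x)) (2^k*½^k≡1 k)) (ℚ.*-identityʳ _))
          where open ℚ-Solver

      level-bound : ι 1/2000 * (a * b) ≤ 𝔼-coins (L ℕ.* n) (λ ω → pairGap (toQuery n (intersect k L ω)) h l)
      level-bound = begin
        ι 1/2000 * (a * b)
          ≈⟨ *-congˡ (*-identityˡ (a * b)) ⟨
        ι 1/2000 * (1# * (a * b))
          ≤⟨ *-monoˡ-≤ 0≤c (*-monoʳ-≤ 0≤ab 1≤N*ph) ⟩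
        ι 1/2000 * (ι N * p h * (a * b))
          ≈⟨ *-congˡ (*-assoc _ _ _) ⟩
        ι 1/2000 * (ι N * (p h * (a * b)))
          ≤⟨ *-monoˡ-≤ 0≤c (*-monoˡ-≤ (ι-nonNeg (0≤2^ k)) contribution) ⟩
        ι 1/2000 * (ι N * (D h l ζ 0≤ζ * D h l ζ 0≤ζ * u))
          ≈⟨ trans (sym (*-assoc _ _ _)) (*-congʳ (sym (ι-* 1/2000 N))) ⟩
        ι (1/2000 ℚ.* N) * (D h l ζ 0≤ζ * D h l ζ 0≤ζ * u)
          ≡⟨ ≡.cong (λ c → ι c * (D h l ζ 0≤ζ * D h l ζ 0≤ζ * u)) constant ⟨
        ι (½ ℚ.* (Z ℚ.* Z ℚ.* Z) ℚ.* r ^ℚ 2) * (D h l ζ 0≤ζ * D h l ζ 0≤ζ * u)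
          ≈⟨ *-congʳ (trans (ι-* _ _) (*-congʳ (trans (ι-* _ _) (*-congˡ (trans (ι-* _ _) (*-congʳ (ι-* _ _))))))) ⟩
        ι ½ * (ζ * ζ * ζ) * ι (r ^ℚ 2) * (D h l ζ 0≤ζ * D h l ζ 0≤ζ * u)
          ≈⟨ solve 4 (λ c z s x → c :* z :* s :* x := c :* (x :* z) :* s) refl (ι ½) (ζ * ζ * ζ) (ι (r ^ℚ 2)) _ ⟩
        ι ½ * K h l ζ 0≤ζ * ι (r ^ℚ 2)
          ≤⟨ 𝔼-lower h l ζ 0≤ζ h≢l k L k≤L small ⟩
        𝔼-coins (L ℕ.* n) (λ ω → lower h l ζ 0≤ζ (intersect k L ω))
          ≤⟨ 𝔼-coins-mono (L ℕ.* n) (λ ω → lower≤pairGap h l ζ 0≤ζ (intersect k L ω)) ⟩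
        𝔼-coins (L ℕ.* n) (λ ω → pairGap (toQuery n (intersect k L ω)) h l) ∎
        where
        open ≤-Reasoning
        open Solver
        Z = N ℚ.* 1/10
        0≤c = ι-nonNeg (ℚ.nonNegative⁻¹ 1/2000)

    -- Such a level exists classically for every x between 2 ^ - K and 1.
    level : ∀ K {x} → ι (½ ^ℚ K) ≤ x → x ≤ 1# →
            ¬ ¬ ∃ λ k → k ℕ.≤ K × ι (½ ^ℚ k) ≤ x × x ≤ ι 2ℚ * ι (½ ^ℚ k)
    level zero ½^0≤x x≤1 none = none (0 , z≤n , ½^0≤x , ≤-trans x≤1
      (≤-respˡ ι-1 (≤-respʳ (ι-* 2ℚ 1ℚ) (ι-mono (ℚ.<⇒≤ Defs.1<2)))))
    level (suc K) {x} ½^[1+K]≤x x≤1 none = none (suc K , ℕ.≤-refl , ½^[1+K]≤x ,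
      ≤-respʳ double (≰⇒≥ λ ½^K≤x → level K ½^K≤x x≤1 λ (k , k≤K , bounds) → none (k , ℕ.m≤n⇒m≤1+n k≤K , bounds)))
      where
      double : ι (½ ^ℚ K) ≈ ι 2ℚ * ι (½ ^ℚ suc K)
      double = trans (solve 1 (λ x → x := con 2ℚ :* (con ½ :* x)) refl (ι (½ ^ℚ K))) (*-congˡ (sym (ι-* ½ (½ ^ℚ K))))
        where open Solver

    module _ (κ K : ℕ) (K<2^κ : K ℕ.< 2 ℕ.^ κ) (½^K≤u : ι (½ ^ℚ K) ≤ u) where

      private
        L = 2 ℕ.^ κ
        r = κ ℕ.+ L ℕ.* n

        -- The positive and negative parts of p i - u
        excess deficit : Fin n → Carrier
        excess i = ι ½ * (∣ p i - u ∣ + (p i - u))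
        deficit i = ι ½ * (∣ p i - u ∣ - (p i - u))

        p≤u⇒excess≈0 : ∀ {i} → p i ≤ u → excess i ≈ 0#
        p≤u⇒excess≈0 {i} pi≤u = trans (*-congˡ (trans (+-congʳ (x≤0⇒∣x∣≈-x p-u≤0)) (-‿inverseˡ _))) (zeroʳ _)
          where p-u≤0 = ≤-respʳ (-‿inverseʳ u) (+-mono-≤ pi≤u ≤-refl)

        u≤p⇒deficit≈0 : ∀ {i} → u ≤ p i → deficit i ≈ 0#
        u≤p⇒deficit≈0 {i} u≤pi = trans (*-congˡ (trans (+-congʳ (0≤x⇒∣x∣≈x (x≤y⇒0≤y-x u≤pi))) (-‿inverseʳ _))) (zeroʳ _)

        u≤p⇒excess≈p-u : ∀ {i} → u ≤ p i → excess i ≈ p i - u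
        u≤p⇒excess≈p-u {i} u≤pi = trans (*-congˡ (+-congʳ (0≤x⇒∣x∣≈x (x≤y⇒0≤y-x u≤pi))))
          (solve 1 (λ x → con ½ :* (x :+ x) := x) refl (p i - u))
          where open Solver

        p≤u⇒deficit≈u-p : ∀ {i} → p i ≤ u → deficit i ≈ u - p i
        p≤u⇒deficit≈u-p {i} pi≤u = trans (*-congˡ (+-congʳ (x≤0⇒∣x∣≈-x p-u≤0)))
          (solve 2 (λ p u → con ½ :* (:- (p :- u) :- (p :- u)) := u :- p) refl (p i) u)
          where open Solver
                p-u≤0 = ≤-respʳ (-‿inverseʳ u) (+-mono-≤ pi≤u ≤-refl)

        p≤1 : ∀ i → p i ≤ 1#
        p≤1 i = ≤-respʳ p-total (f≤sum p-nonNeg i)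

      -- The expected contribution of a pair to the gap of a random query
      𝔼-pairGap : Fin n → Fin n → Carrier
      𝔼-pairGap h l = 𝔼-coins r λ ω → pairGap (randomQuery n κ ω) h l

      𝔼-pairGap-nonNeg : ∀ h l → 0# ≤ 𝔼-pairGap h l
      𝔼-pairGap-nonNeg h l = 𝔼-coins-nonNeg r λ ω → pairGap-nonNeg (randomQuery n κ ω) h l

      c : ℚ
      c = ½ ^ℚ κ ℚ.* 1/2000

      -- The factor 2 ^ - κ in c is the probability of the right level.
      pair-bound : ∀ h l → ι c * (excess h * deficit l) ≤ 𝔼-pairGap h l
      pair-bound h l = ≤-cases (p h) u
        (λ ph≤u → trivial (trans (*-congʳ (p≤u⇒excess≈0 ph≤u)) (zeroˡ _)))
        λ u≤ph → ≤-cases u (p l)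
          (λ u≤pl → trivial (trans (*-congˡ (u≤p⇒deficit≈0 u≤pl)) (zeroʳ _)))
          λ pl≤u → main u≤ph pl≤u (h Fin.≟ l)
        where
        trivial : excess h * deficit l ≈ 0# → ι c * (excess h * deficit l) ≤ 𝔼-pairGap h l
        trivial eq = ≤-respˡ (sym (trans (*-congˡ eq) (zeroʳ _))) (𝔼-pairGap-nonNeg h l)
        main : u ≤ p h → p l ≤ u → Dec (h ≡ l) → ι c * (excess h * deficit l) ≤ 𝔼-pairGap h l
        main u≤ph pl≤u (yes ≡.refl) = trivial (trans (*-congʳ (p≤u⇒excess≈0 pl≤u)) (zeroˡ _))
        main u≤ph pl≤u (no h≢l) = ≤-stable λ ¬bound → level K (≤-trans ½^K≤u u≤ph) (p≤1 h)
          λ (k , k≤K , ½^k≤ph , ph≤2½^k) → ¬bound (at k (ℕ.≤-<-trans k≤K K<2^κ) ½^k≤ph ph≤2½^k)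
          where
          at : ∀ k → k ℕ.< L → ι (½ ^ℚ k) ≤ p h → p h ≤ ι 2ℚ * ι (½ ^ℚ k) →
               ι c * (excess h * deficit l) ≤ 𝔼-pairGap h l
          at k k<L ½^k≤ph ph≤2½^k = begin
            ι c * (excess h * deficit l)
              ≈⟨ *-cong (ι-* (½ ^ℚ κ) 1/2000) (*-cong (u≤p⇒excess≈p-u u≤ph) (p≤u⇒deficit≈u-p pl≤u)) ⟩
            ι (½ ^ℚ κ) * ι 1/2000 * ((p h - u) * (u - p l))
              ≈⟨ *-assoc _ _ _ ⟩
            ι (½ ^ℚ κ) * (ι 1/2000 * ((p h - u) * (u - p l)))
              ≤⟨ *-monoˡ-≤ (ι-nonNeg (0≤½^ κ)) (level-bound h l h≢l u≤ph pl≤u k L (ℕ.<⇒≤ k<L) ½^k≤ph ph≤2½^k) ⟩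
            ι (½ ^ℚ κ) * 𝔼-level k
              ≡⟨ ≡.cong (λ k → ι (½ ^ℚ κ) * 𝔼-level k) (proj₂ (value-surjective κ k k<L)) ⟨
            ι (½ ^ℚ κ) * 𝔼-level (value ω₀)
              ≤⟨ 𝔼-coins-atom κ (λ ω → 𝔼-coins-nonNeg (L ℕ.* n) λ ω′ →
                   pairGap-nonNeg (toQuery n (intersect (value ω) L ω′)) h l) ω₀ ⟩
            𝔼-coins κ (λ ω → 𝔼-level (value ω))
              ≈⟨ 𝔼-coins-split κ (λ ω ω′ → pairGap (toQuery n (intersect (value ω) L ω′)) h l) ⟨
            𝔼-pairGap h l ∎
            where
            open ≤-Reasoning
            ω₀ = proj₁ (value-surjective κ k k<L)
            𝔼-level : ℕ → Carrier
            𝔼-level k = 𝔼-coins (L ℕ.* n) λ ω → pairGap (toQuery n (intersect k L ω)) h l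

      gap-bound : ∀ {e} → 0ℚ ℚ.≤ e → ι e ≤ ι ½ * sum (λ i → ∣ p i - u ∣) →
                  ι (c ℚ.* (e ℚ.* e)) ≤ 𝔼-coins r (λ ω → gap (randomQuery n κ ω))
      gap-bound {e} 0≤e far = begin
        ι (c ℚ.* (e ℚ.* e))
          ≈⟨ trans (ι-* c _) (*-congˡ (ι-* e e)) ⟩
        ι c * (ι e * ι e)
          ≤⟨ *-monoˡ-≤ 0≤c (*-mono-≤ (ι-nonNeg 0≤e) (≤-trans (ι-nonNeg 0≤e) far) far far) ⟩
        ι c * (d * d)
          ≈⟨ *-congˡ (*-cong Σexcess Σdeficit) ⟨
        ι c * (sum excess * sum deficit)
          ≈⟨ *-congˡ (sum-product excess deficit) ⟨
        ι c * sum (λ h → sum λ l → excess h * deficit l)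
          ≈⟨ trans (*-distribˡ-sum (ι c) λ h → sum λ l → excess h * deficit l)
                   (sum-cong λ h → *-distribˡ-sum (ι c) λ l → excess h * deficit l) ⟩
        sum (λ h → sum λ l → ι c * (excess h * deficit l))
          ≤⟨ sum-mono (λ h → sum-mono λ l → pair-bound h l) ⟩
        sum (λ h → sum λ l → 𝔼-pairGap h l)
          ≈⟨ sum-cong (λ h → 𝔼-coins-sum r λ ω l → pairGap (randomQuery n κ ω) h l) ⟨
        sum (λ h → 𝔼-coins r λ ω → sum λ l → pairGap (randomQuery n κ ω) h l)
          ≈⟨ 𝔼-coins-sum r (λ ω h → sum λ l → pairGap (randomQuery n κ ω) h l) ⟨
        𝔼-coins r (λ ω → sum λ h → sum λ l → pairGap (randomQuery n κ ω) h l)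
          ≈⟨ 𝔼-coins-cong r (λ ω → gap≈pairGaps (randomQuery n κ ω)) ⟨
        𝔼-coins r (λ ω → gap (randomQuery n κ ω)) ∎
        where
        open ≤-Reasoning
        0≤c = ι-nonNeg (ℚ-*-nonNeg (0≤½^ κ) (ℚ.nonNegative⁻¹ 1/2000))
        d = ι ½ * sum λ i → ∣ p i - u ∣
        -- As p - u has sum zero, the excesses and the deficits have the same sum.
        Σ[p-u]≈0 : sum (λ i → p i - u) ≈ 0#
        Σ[p-u]≈0 = trans (∑-distrib-+ p (λ _ → - u)) (trans (+-cong p-total (trans (sum-neg {n} (λ _ → u)) (-‿cong nu≈1))) (-‿inverseʳ 1#))
        Σexcess : sum excess ≈ d
        Σexcess = trans (sym (*-distribˡ-sum (ι ½) λ i → ∣ p i - u ∣ + (p i - u))) (*-congˡ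
          (trans (∑-distrib-+ (λ i → ∣ p i - u ∣) λ i → p i - u) (trans (+-congˡ Σ[p-u]≈0) (+-identityʳ _))))
        Σdeficit : sum deficit ≈ d
        Σdeficit = trans (sym (*-distribˡ-sum (ι ½) λ i → ∣ p i - u ∣ - (p i - u))) (*-congˡ
          (trans (∑-distrib-+ (λ i → ∣ p i - u ∣) λ i → - (p i - u)) (trans (+-congˡ
            (trans (sum-neg λ i → p i - u) (trans (-‿cong Σ[p-u]≈0) (trans (sym (+-identityˡ _)) (-‿inverseʳ 0#))))) (+-identityʳ _))))

    -- Under the uniform distribution every law is uniform on its query.
    uniform⇒gap≈0 : (∀ i → p i ≈ u) → ∀ A → gap A ≈ 0#
    uniform⇒gap≈0 p≈u A = begin-equality
      sum (λ i → q A i * q A i) - w  ≈⟨ +-congʳ (trans (sum-cong q*q≈w*q) (sym (*-distribˡ-sum w (q A)))) ⟩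
      w * sum (q A) - w              ≈⟨ +-congʳ (trans (*-congˡ (q-total A)) (*-identityʳ w)) ⟩
      w - w                          ≈⟨ -‿inverseʳ w ⟩
      0#                             ∎
      where
      open ≤-Reasoning
      w = ι (weight A)
      C = ι (ℕ⇒ℚ (card (proj₁ A)))
      cancel : ∀ {x} → x * u ≈ u → x ≈ 1#
      cancel {x} xu≈u = begin-equality
        x                        ≈⟨ trans (*-congˡ nu≈1) (*-identityʳ x) ⟨
        x * sum {n} (λ _ → u)    ≈⟨ *-distribˡ-sum {n} x (λ _ → u) ⟩
        sum {n} (λ _ → x * u)    ≈⟨ sum-cong {n} (λ _ → xu≈u) ⟩
        sum {n} (λ _ → u)        ≈⟨ nu≈1 ⟩
        1#                       ∎
      mass≈Cu : mass p (proj₁ A) ≈ C * u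
      mass≈Cu = trans (sum-cong λ i → *-congˡ (p≈u i))
        (trans (sym (*-distribʳ-sum u λ i → ind (lookup (proj₁ A) i))) (*-congʳ (sum-ind (proj₁ A))))
      q≈w : ∀ i → lookup (proj₁ A) i ≡ true → q A i ≈ w
      q≈w i i∈A = begin-equality
        q A i            ≈⟨ trans (*-congˡ (card*weight A)) (*-identityʳ _) ⟨
        q A i * (C * w)  ≈⟨ *-assoc _ _ _ ⟨
        q A i * C * w    ≈⟨ *-congʳ (cancel (trans (trans (*-assoc _ _ _) (*-congˡ (sym mass≈Cu))) (trans (q-inside A i i∈A) (p≈u i)))) ⟩
        1# * w           ≈⟨ *-identityˡ w ⟩
        w                ∎
      q*q≈w*q : ∀ i → q A i * q A i ≈ w * q A i
      q*q≈w*q i with lookup (proj₁ A) i in eq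
      ... | true = *-congʳ (q≈w i eq)
      ... | false = trans (trans (*-congˡ (q-outside A i eq)) (zeroʳ _)) (sym (trans (*-congˡ (q-outside A i eq)) (zeroʳ w)))

-- The test

1/4 1/8 8ℚ 2000ℚ : ℚ
1/4 = ½ ℚ.* ½
1/8 = ½ ℚ.* (½ ℚ.* ½)
8ℚ = ℕ⇒ℚ 8
2000ℚ = ℕ⇒ℚ 2000

ℕ⇒ℚ-* : ∀ m n → ℕ⇒ℚ (m ℕ.* n) ≡ ℕ⇒ℚ m ℚ.* ℕ⇒ℚ n
ℕ⇒ℚ-* zero n = ≡.sym (ℚ.*-zeroˡ (ℕ⇒ℚ n))
ℕ⇒ℚ-* (suc m) n = begin
  ℕ⇒ℚ (n ℕ.+ m ℕ.* n)                  ≡⟨ ≡.trans (Defs.ℕ⇒ℚ-+ n (m ℕ.* n)) (≡.cong (ℕ⇒ℚ n ℚ.+_) (ℕ⇒ℚ-* m n)) ⟩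
  ℕ⇒ℚ n ℚ.+ ℕ⇒ℚ m ℚ.* ℕ⇒ℚ n            ≡⟨ solve 2 (λ m n → n :+ m :* n := (con 1ℚ :+ m) :* n) ≡.refl (ℕ⇒ℚ m) (ℕ⇒ℚ n) ⟩
  (1ℚ ℚ.+ ℕ⇒ℚ m) ℚ.* ℕ⇒ℚ n             ≡⟨ ≡.cong (ℚ._* ℕ⇒ℚ n) (Defs.ℕ⇒ℚ-+ 1 m) ⟨
  ℕ⇒ℚ (suc m) ℚ.* ℕ⇒ℚ n                ∎
  where
  open ≡.≡-Reasoning
  open ℚ-Solver

0≤ℕ⇒ℚ : ∀ n → 0ℚ ℚ.≤ ℕ⇒ℚ n
0≤ℕ⇒ℚ n = Defs.ℕ⇒ℚ-mono-≤ {0} {n} z≤n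

-- Bernoulli's inequality
1+nx≤[1+x]^n : ∀ {x} → 0ℚ ℚ.≤ x → ∀ n → 1ℚ ℚ.+ ℕ⇒ℚ n ℚ.* x ℚ.≤ (1ℚ ℚ.+ x) ^ℚ n
1+nx≤[1+x]^n {x} 0≤x zero = ℚ.≤-reflexive (solve 1 (λ x → con 1ℚ :+ con 0ℚ :* x := con 1ℚ) ≡.refl x)
  where open ℚ-Solver
1+nx≤[1+x]^n {x} 0≤x (suc n) = begin
  1ℚ ℚ.+ ℕ⇒ℚ (suc n) ℚ.* x
    ≡⟨ ≡.cong (λ k → 1ℚ ℚ.+ k ℚ.* x) (Defs.ℕ⇒ℚ-+ 1 n) ⟩
  1ℚ ℚ.+ (1ℚ ℚ.+ ℕ⇒ℚ n) ℚ.* x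
    ≤⟨ 0≤q-p⇒p≤q (≡.subst (0ℚ ℚ.≤_)
         (solve 2 (λ x n → n :* (x :* x) := (con 1ℚ :+ x) :* (con 1ℚ :+ n :* x) :- (con 1ℚ :+ (con 1ℚ :+ n) :* x)) ≡.refl x (ℕ⇒ℚ n))
         (ℚ-*-nonNeg (0≤ℕ⇒ℚ n) (ℚ-*-nonNeg 0≤x 0≤x))) ⟩
  (1ℚ ℚ.+ x) ℚ.* (1ℚ ℚ.+ ℕ⇒ℚ n ℚ.* x)
    ≤⟨ ℚ.*-monoˡ-≤-nonNeg (1ℚ ℚ.+ x) {{ℚ.nonNegative (ℚ-+-nonNeg Defs.0≤1 0≤x)}} (1+nx≤[1+x]^n 0≤x n) ⟩
  (1ℚ ℚ.+ x) ℚ.* (1ℚ ℚ.+ x) ^ℚ n ∎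
  where
  open ℚ.≤-Reasoning
  open ℚ-Solver

-- Multiply by (1 + x) ^ m, which is at least 1 + m x = 2.
[1-1/m]^m≤½ : ∀ {x} m → 0ℚ ℚ.≤ x → x ℚ.≤ 1ℚ → ℕ⇒ℚ m ℚ.* x ≡ 1ℚ → (1ℚ ℚ.- x) ^ℚ m ℚ.≤ ½
[1-1/m]^m≤½ {x} m 0≤x x≤1 mx≡1 = begin
  y ^ℚ m
    ≡⟨ solve 1 (λ y → y := con ½ :* ((con 1ℚ :+ con 1ℚ) :* y)) ≡.refl (y ^ℚ m) ⟩
  ½ ℚ.* ((1ℚ ℚ.+ 1ℚ) ℚ.* y ^ℚ m)
    ≡⟨ ≡.cong (λ z → ½ ℚ.* ((1ℚ ℚ.+ z) ℚ.* y ^ℚ m)) mx≡1 ⟨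
  ½ ℚ.* ((1ℚ ℚ.+ ℕ⇒ℚ m ℚ.* x) ℚ.* y ^ℚ m)
    ≤⟨ ℚ.*-monoˡ-≤-nonNeg ½ (ℚ.*-monoʳ-≤-nonNeg (y ^ℚ m) {{ℚ.nonNegative (Defs.^-nonNeg 0≤y m)}} (1+nx≤[1+x]^n 0≤x m)) ⟩
  ½ ℚ.* ((1ℚ ℚ.+ x) ^ℚ m ℚ.* y ^ℚ m)
    ≡⟨ ≡.cong (½ ℚ.*_) (^ℚ-distrib-* (1ℚ ℚ.+ x) y m) ⟨
  ½ ℚ.* ((1ℚ ℚ.+ x) ℚ.* y) ^ℚ m
    ≤⟨ ℚ.*-monoˡ-≤-nonNeg ½ (Defs.^-monoˡ-≤ (ℚ-*-nonNeg (ℚ-+-nonNeg Defs.0≤1 0≤x) 0≤y)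
         (0≤q-p⇒p≤q (≡.subst (0ℚ ℚ.≤_)
           (solve 1 (λ x → x :* x := con 1ℚ :- (con 1ℚ :+ x) :* (con 1ℚ :- x)) ≡.refl x) (ℚ-*-nonNeg 0≤x 0≤x))) m) ⟩
  ½ ℚ.* 1ℚ ^ℚ m
    ≡⟨ ≡.cong (½ ℚ.*_) (1^ m) ⟩
  ½ ∎
  where
  open ℚ.≤-Reasoning
  open ℚ-Solver
  y = 1ℚ ℚ.- x
  0≤y = Defs.p≤q⇒0≤q-p x≤1
  1^ : ∀ m → 1ℚ ^ℚ m ≡ 1ℚ
  1^ zero = ≡.refl
  1^ (suc m) = ≡.trans (ℚ.*-identityˡ (1ℚ ^ℚ m)) (1^ m)

-- Two cases in which q m = p: conditioning on positive mass, where v = 1 / m, and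
-- on mass zero
module Conditioning (R : OrderedRing) where
  open OrderedRingProperties R

  conditioned : ∀ {q p v m} → q ≈ p * v → m * v ≈ 1# → q * m ≈ p
  conditioned {q} {p} {v} {m} q≈pv mv≈1 = begin-equality
    q * m        ≈⟨ *-congʳ q≈pv ⟩
    p * v * m    ≈⟨ trans (*-assoc p v m) (*-congˡ (*-comm v m)) ⟩
    p * (m * v)  ≈⟨ trans (*-congˡ mv≈1) (*-identityʳ p) ⟩
    p            ∎
    where open ≤-Reasoning

  null : ∀ {q p m} → m ≤ 0# → 0# ≤ p → p ≤ m → q * m ≈ p
  null {q} {p} {m} m≤0 0≤p p≤m = trans (trans (*-congˡ (≤-antisym m≤0 (≤-trans 0≤p p≤m))) (zeroʳ q))
    (≤-antisym 0≤p (≤-trans p≤m m≤0))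

  ≈-stable : ∀ {x y} → ¬ ¬ x ≈ y → x ≈ y
  ≈-stable h = ≤-antisym (≤-stable λ k → h λ e → k (≤-reflexive e)) (≤-stable λ k → h λ e → k (≤-reflexive (sym e)))

  1-mono : ∀ {x y} → x ≤ y → 1# - y ≤ 1# - x
  1-mono x≤y = +-mono-≤ ≤-refl (-‿mono-≤ x≤y)

  ind*≈if : ∀ b x → ind b * x ≈ (if b then x else 0#)
  ind*≈if true x = *-identityˡ x
  ind*≈if false x = zeroˡ x

-- The test with distance parameter e = 1 / (1 + E) and error probability
-- β = 2 ^ - b.  Levels up to K suffice since 2 ^ - K ≤ 1 / n, and g = 1 / G is the
-- lower bound for the expected gap.
module Test (n : ℕ) .{{_ : ℕ.NonZero n}} (E b : ℕ) where

  K κ r G m : ℕ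
  K = suc ⌊log₂ n ⌋
  κ = suc ⌊log₂ K ⌋
  r = κ ℕ.+ 2 ℕ.^ κ ℕ.* n
  G = 2000 ℕ.* (2 ℕ.^ κ ℕ.* (suc E ℕ.* suc E))
  m = 8 ℕ.* (G ℕ.* G)

  -- The number of rounds, opaque so that conversion checking does not unfold
  -- the product
  opaque
    M : ℕ
    M = m ℕ.* (b ℕ.+ b)

    M≡ : M ≡ m ℕ.* (b ℕ.+ b)
    M≡ = ≡.refl

  e g t B β : ℚ
  e = ℤ.+ 1 ℚ./ suc E
  g = ½ ^ℚ κ ℚ.* 1/2000 ℚ.* (e ℚ.* e)
  t = 1/4 ℚ.* g
  B = 2ℚ ^ℚ b
  β = ½ ^ℚ b

  K<2^κ : K ℕ.< 2 ℕ.^ κ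
  K<2^κ = Defs.n<2^[1+⌊log₂n⌋] K

  Gg≡1 : ℕ⇒ℚ G ℚ.* g ≡ 1ℚ
  Gg≡1 = begin
    ℕ⇒ℚ G ℚ.* g
      ≡⟨ ≡.cong (ℚ._* g) (≡.trans (ℕ⇒ℚ-* 2000 (2 ℕ.^ κ ℕ.* (suc E ℕ.* suc E))) (≡.cong (2000ℚ ℚ.*_)
           (≡.trans (ℕ⇒ℚ-* (2 ℕ.^ κ) (suc E ℕ.* suc E)) (≡.cong₂ ℚ._*_ (Defs.ℕ⇒ℚ-2^ κ) (ℕ⇒ℚ-* (suc E) (suc E)))))) ⟩
    2000ℚ ℚ.* (2ℚ ^ℚ κ ℚ.* (ℕ⇒ℚ (suc E) ℚ.* ℕ⇒ℚ (suc E))) ℚ.* g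
      ≡⟨ solve 5 (λ c x y a h → c :* (x :* (a :* a)) :* (y :* con 1/2000 :* (h :* h)) := (c :* con 1/2000) :* ((x :* y) :* ((a :* h) :* (a :* h))))
           ≡.refl 2000ℚ (2ℚ ^ℚ κ) (½ ^ℚ κ) (ℕ⇒ℚ (suc E)) e ⟩
    (2000ℚ ℚ.* 1/2000) ℚ.* ((2ℚ ^ℚ κ ℚ.* ½ ^ℚ κ) ℚ.* ((ℕ⇒ℚ (suc E) ℚ.* e) ℚ.* (ℕ⇒ℚ (suc E) ℚ.* e)))
      ≡⟨ ≡.cong₂ (λ x y → (2000ℚ ℚ.* 1/2000) ℚ.* (x ℚ.* (y ℚ.* y))) (2^k*½^k≡1 κ) (ℕ⇒ℚ*1/n≡1 (suc E)) ⟩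
    (2000ℚ ℚ.* 1/2000) ℚ.* (1ℚ ℚ.* (1ℚ ℚ.* 1ℚ))
      ≡⟨⟩
    1ℚ ∎
    where
    open ≡.≡-Reasoning
    open ℚ-Solver

  0≤e = 0≤1/n (suc E)

  ½^≤1 : ∀ k → ½ ^ℚ k ℚ.≤ 1ℚ
  ½^≤1 zero = ℚ.≤-refl
  ½^≤1 (suc k) = ℚ.≤-trans (Defs.½^≤½ k) (ℚ.≤ᵇ⇒≤ _)

  0≤g : 0ℚ ℚ.≤ g
  0≤g = ℚ-*-nonNeg (ℚ-*-nonNeg (0≤½^ κ) (ℚ.nonNegative⁻¹ 1/2000)) (ℚ-*-nonNeg 0≤e 0≤e)

  g≤1 : g ℚ.≤ 1ℚ
  g≤1 = Defs.*-mono-≤ (ℚ-*-nonNeg (0≤½^ κ) (ℚ.nonNegative⁻¹ 1/2000)) Defs.0≤1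
    (Defs.*-mono-≤ (0≤½^ κ) Defs.0≤1 (½^≤1 κ) (ℚ.≤ᵇ⇒≤ _)) (Defs.*-mono-≤ 0≤e Defs.0≤1 (1/n≤1 (suc E)) (1/n≤1 (suc E)))

  0≤t : 0ℚ ℚ.≤ t
  0≤t = ℚ-*-nonNeg (ℚ.nonNegative⁻¹ 1/4) 0≤g

  t≤½ : t ℚ.≤ ½
  t≤½ = ℚ.≤-trans (ℚ.*-monoˡ-≤-nonNeg 1/4 g≤1) (ℚ.≤ᵇ⇒≤ _)

  -- With t = g / 4 the base is 1 - g² / 8 = 1 - 1 / m, whose m-th power is at
  -- most 1 / 2.
  decay : B ℚ.* (1ℚ ℚ.+ 2ℚ ℚ.* (t ℚ.* t) ℚ.- t ℚ.* g) ^ℚ M ℚ.≤ β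
  decay = begin
    B ℚ.* (1ℚ ℚ.+ 2ℚ ℚ.* (t ℚ.* t) ℚ.- t ℚ.* g) ^ℚ M
      ≡⟨ ≡.cong (λ z → B ℚ.* z ^ℚ M) (solve 1 (λ g → con 1ℚ :+ con 2ℚ :* (con 1/4 :* g :* (con 1/4 :* g)) :- con 1/4 :* g :* g :=
                                              con 1ℚ :- con 1/8 :* (g :* g)) ≡.refl g) ⟩
    B ℚ.* (1ℚ ℚ.- x) ^ℚ M
      ≡⟨ ≡.cong (λ k → B ℚ.* (1ℚ ℚ.- x) ^ℚ k) M≡ ⟩
    B ℚ.* (1ℚ ℚ.- x) ^ℚ (m ℕ.* (b ℕ.+ b))
      ≡⟨ ≡.cong (B ℚ.*_) (^ℚ-assocʳ (1ℚ ℚ.- x) m (b ℕ.+ b)) ⟨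
    B ℚ.* ((1ℚ ℚ.- x) ^ℚ m) ^ℚ (b ℕ.+ b)
      ≤⟨ ℚ.*-monoˡ-≤-nonNeg B {{ℚ.nonNegative (0≤2^ b)}}
           (Defs.^-monoˡ-≤ (Defs.^-nonNeg (Defs.p≤q⇒0≤q-p x≤1) m) ([1-1/m]^m≤½ m 0≤x x≤1 mx≡1) (b ℕ.+ b)) ⟩
    B ℚ.* ½ ^ℚ (b ℕ.+ b)
      ≡⟨ ≡.cong (B ℚ.*_) (^ℚ-homo-* ½ b b) ⟩
    B ℚ.* (β ℚ.* β)
      ≡⟨ ℚ.*-assoc B β β ⟨
    B ℚ.* β ℚ.* β
      ≡⟨ ≡.trans (≡.cong (ℚ._* β) (2^k*½^k≡1 b)) (ℚ.*-identityˡ β) ⟩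
    β ∎
    where
    open ℚ.≤-Reasoning
    open ℚ-Solver
    x = 1/8 ℚ.* (g ℚ.* g)
    0≤x = ℚ-*-nonNeg {1/8} (ℚ.nonNegative⁻¹ 1/8) (ℚ-*-nonNeg 0≤g 0≤g)
    x≤1 : x ℚ.≤ 1ℚ
    x≤1 = Defs.*-mono-≤ {1/8} {1ℚ} (ℚ.nonNegative⁻¹ 1/8) Defs.0≤1 (ℚ.≤ᵇ⇒≤ _) (Defs.*-mono-≤ 0≤g Defs.0≤1 g≤1 g≤1)
    mx≡1 : ℕ⇒ℚ m ℚ.* x ≡ 1ℚ
    mx≡1 = ≡.trans (≡.cong (ℚ._* x) (≡.trans (ℕ⇒ℚ-* 8 (G ℕ.* G)) (≡.cong (8ℚ ℚ.*_) (ℕ⇒ℚ-* G G))))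
      (≡.trans (solve 2 (λ a g → con 8ℚ :* (a :* a) :* (con 1/8 :* (g :* g)) := (a :* g) :* (a :* g)) ≡.refl (ℕ⇒ℚ G) g)
        (≡.cong (λ z → z ℚ.* z) Gg≡1))

  ½^K≤1/n : ½ ^ℚ K ℚ.≤ ℤ.+ 1 ℚ./ n
  ½^K≤1/n = begin
    ½ ^ℚ K
      ≡⟨ ≡.trans (≡.cong (½ ^ℚ K ℚ.*_) (ℕ⇒ℚ*1/n≡1 n)) (ℚ.*-identityʳ (½ ^ℚ K)) ⟨
    ½ ^ℚ K ℚ.* (ℕ⇒ℚ n ℚ.* (ℤ.+ 1 ℚ./ n))
      ≤⟨ ℚ.*-monoˡ-≤-nonNeg (½ ^ℚ K) {{ℚ.nonNegative (0≤½^ K)}} (ℚ.*-monoʳ-≤-nonNeg (ℤ.+ 1 ℚ./ n) {{ℚ.nonNegative (0≤1/n n)}}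
           (ℚ.≤-trans (Defs.ℕ⇒ℚ-mono-≤ {n} {2 ℕ.^ K} (ℕ.<⇒≤ (Defs.n<2^[1+⌊log₂n⌋] n))) (ℚ.≤-reflexive (Defs.ℕ⇒ℚ-2^ K)))) ⟩
    ½ ^ℚ K ℚ.* (2ℚ ^ℚ K ℚ.* (ℤ.+ 1 ℚ./ n))
      ≡⟨ solve 3 (λ a b c → a :* (b :* c) := (b :* a) :* c) ≡.refl (½ ^ℚ K) (2ℚ ^ℚ K) (ℤ.+ 1 ℚ./ n) ⟩
    (2ℚ ^ℚ K ℚ.* ½ ^ℚ K) ℚ.* (ℤ.+ 1 ℚ./ n)
      ≡⟨ ≡.trans (≡.cong (ℚ._* (ℤ.+ 1 ℚ./ n)) (2^k*½^k≡1 K)) (ℚ.*-identityˡ (ℤ.+ 1 ℚ./ n)) ⟩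
    ℤ.+ 1 ℚ./ n ∎
    where
    open ℚ.≤-Reasoning
    open ℚ-Solver

  open Rounds (randomQuery n κ) public
  open Betting (randomQuery n κ) weight t n public using (accepts)

  module Correctness (R : OrderedRing) where
    open OrderedRingProperties R
    open Expectation R
    open ConditionalLaws R n

    -- The probability of each element under the uniform distribution
    u : Carrier
    u = ι (ℤ.+ 1 ℚ./ n)

    0≤u : 0# ≤ u
    0≤u = ι-nonNeg (0≤1/n n)

    nu≈1 : sum {n} (λ _ → u) ≈ 1#
    nu≈1 = begin-equality
      sum {n} (λ _ → u)                              ≈⟨ sum-cong {n} (λ i → *-identityˡ u) ⟨
      sum {n} (λ _ → 1# * u)                         ≈⟨ *-distribʳ-sum {n} u (λ _ → 1#) ⟨
      sum {n} (λ _ → 1#) * u                         ≈⟨ *-congʳ (sum-1 n) ⟩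
      ι (ℕ⇒ℚ n) * u                                  ≈⟨ ι-* (ℕ⇒ℚ n) (ℤ.+ 1 ℚ./ n) ⟨
      ι (ℕ⇒ℚ n ℚ.* (ℤ.+ 1 ℚ./ n))                    ≡⟨ ≡.cong ι (ℕ⇒ℚ*1/n≡1 n) ⟩
      ι 1ℚ                                           ≈⟨ ι-1 ⟩
      1#                                             ∎
      where
      open ≤-Reasoning
      sum-1 : ∀ k → sum {k} (λ _ → 1#) ≈ ι (ℕ⇒ℚ k)
      sum-1 zero = sym ι-0
      sum-1 (suc k) = trans (+-cong (sym ι-1) (sum-1 k)) (trans (sym (ι-+ 1ℚ (ℕ⇒ℚ k))) (reflexive (≡.cong ι (≡.sym (Defs.ℕ⇒ℚ-+ 1 k)))))

    module _ {p q} (conditional : IsConditional p q) where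
      open IsConditional conditional
      open ExpectedGap R n using (gap-bound; uniform⇒gap≈0)
      open Gap conditional using (gap)
      private module Bets = Betting (randomQuery n κ) weight t n

      Pr : ((ω : Vec Bool (M ℕ.* r)) → Vec (Fin n) (length (roundQueries M ω)) → Bool) → Carrier
      Pr v = 𝔼-coins (M ℕ.* r) λ ω → Samples.𝔼-samples q (roundQueries M ω) λ js → ind (v ω js)

      Pr[accept] Pr[reject] : Carrier
      Pr[accept] = Pr (accepts B M)
      Pr[reject] = Pr (λ ω js → not (accepts B M ω js))

      private
        Pr-total : Pr[accept] + Pr[reject] ≈ 1#
        Pr-total = Bets.Pr-total weight-nonNeg weight≤1 0≤t t≤½ R q q-nonNeg q-total M (accepts B M)

        complement : ∀ {x y c} → x + y ≈ 1# → x ≤ c → 1# - c ≤ y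
        complement {x} {y} {c} x+y≈1 x≤c = begin
          1# - c       ≤⟨ +-mono-≤ ≤-refl (-‿mono-≤ x≤c) ⟩
          1# - x       ≈⟨ +-congʳ x+y≈1 ⟨
          x + y - x    ≈⟨ solve 2 (λ x y → x :+ y :- x := y) refl x y ⟩
          y            ∎
          where
          open ≤-Reasoning
          open Solver

        βB≡1 : β ℚ.* B ≡ 1ℚ
        βB≡1 = ≡.trans (ℚ.*-comm β B) (2^k*½^k≡1 b)

      accepts-uniform : (∀ i → p i ≈ u) → 1# - ι β ≤ Pr[accept]
      accepts-uniform p≈u = complement (trans (+-comm Pr[reject] Pr[accept]) Pr-total)
        (Bets.rejects-rarely weight-nonNeg weight≤1 0≤t t≤½ R q q-nonNeg q-total B β (0≤2^ b) (0≤½^ b) βB≡1 M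
          (trans (𝔼-coins-cong r λ ω → uniform⇒gap≈0 conditional u 0≤u nu≈1 p≈u (randomQuery n κ ω)) (𝔼-coins-const r 0#)))

      rejects-far : ∀ {d} (distances : Fin n → Carrier) → (∀ i → distances i ≈ ∣ p i - u ∣) → d ≈ ι ½ * sum distances →
                    ι e ≤ d → 1# - ι β ≤ Pr[reject]
      rejects-far distances eqs eq e≤d = complement Pr-total
        (Bets.accepts-rarely weight-nonNeg weight≤1 0≤t t≤½ R q q-nonNeg q-total B β (0≤2^ b) (0≤½^ b) βB≡1 M
          (gap-bound conditional u 0≤u nu≈1 κ K K<2^κ (ι-mono ½^K≤1/n) 0≤e
            (≤-respʳ (trans eq (*-congˡ (sum-cong eqs))) e≤d)) decay)

-- The real numbers as an ordered ring

-- As ≃ and ≤ unfold to function types, the real arguments of lemmas about them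
-- are mostly given explicitly.

open import Defs

eventually : ∀ {P : ℕ → Set} → (∀ n → P n) → Eventually P
eventually h = 0 , λ n _ → h n

eventually-map₂ : ∀ {P Q S : ℕ → Set} → (∀ n → P n → Q n → S n) → Eventually P → Eventually Q → Eventually S
eventually-map₂ f (N , p) (M , q) = N ℕ.⊔ M , λ n N⊔M≤n →
  f n (p n (ℕ.m⊔n≤o⇒m≤o N M N⊔M≤n)) (q n (ℕ.m⊔n≤o⇒n≤o N M N⊔M≤n))

eventually-map : ∀ {P Q : ℕ → Set} → (∀ n → P n → Q n) → Eventually P → Eventually Q
eventually-map f (N , p) = N , λ n N≤n → f n (p n N≤n)

half : ∀ {ε} → 0ℚ ℚ.< ε → 0ℚ ℚ.< ε ℚ.* ½
half 0<ε = *-pos 0<ε 0<½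

p≤p+q : ∀ {p q} → 0ℚ ℚ.≤ q → p ℚ.≤ p ℚ.+ q
p≤p+q {p} {q} 0≤q = ≡.subst (ℚ._≤ p ℚ.+ q) (ℚ.+-identityʳ p) (ℚ.+-monoʳ-≤ p 0≤q)

≤-pointwise : ∀ {x y} → (∀ n → seq x n ℚ.≤ seq y n) → x ≤ y
≤-pointwise h ε 0<ε = eventually λ n → ℚ.≤-trans (h n) (p≤p+q (ℚ.<⇒≤ 0<ε))

ℝ-≤-trans : ∀ {x y z} → x ≤ y → y ≤ z → x ≤ z
ℝ-≤-trans {x} {y} {z} x≤y y≤z ε 0<ε = eventually-map₂
  (λ n h₁ h₂ → ℚ.≤-trans h₁ (ℚ.≤-trans (ℚ.+-monoˡ-≤ (ε ℚ.* ½) h₂)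
    (ℚ.≤-reflexive (≡.trans (ℚ.+-assoc (seq z n) (ε ℚ.* ½) (ε ℚ.* ½)) (≡.cong (seq z n ℚ.+_) (½ε+½ε≡ε ε))))))
  (x≤y (ε ℚ.* ½) (half 0<ε)) (y≤z (ε ℚ.* ½) (half 0<ε))

ℝ-≤-antisym : ∀ {x y} → x ≤ y → y ≤ x → x ≃ y
ℝ-≤-antisym x≤y y≤x ε 0<ε = eventually-map₂ (λ n → ≤+⇒∣p-q∣≤) (x≤y ε 0<ε) (y≤x ε 0<ε)

ℝ-≤-reflexive : ∀ {x y} → x ≃ y → x ≤ y
ℝ-≤-reflexive {x} {y} x≃y ε 0<ε = eventually-map (λ n → ∣p-q∣≤⇒p≤q+ {seq x n} {seq y n}) (x≃y ε 0<ε)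

ℝ-sym : ∀ {x y} → x ≃ y → y ≃ x
ℝ-sym {x} {y} x≃y ε 0<ε = eventually-map (λ n → ≡.subst (ℚ._≤ ε) (∣p-q∣-sym (seq x n) (seq y n))) (x≃y ε 0<ε)

≃-pointwise : ∀ {x y} → (∀ n → seq x n ≡ seq y n) → x ≃ y
≃-pointwise {x} {y} h = ℝ-≤-antisym {x} {y}
  (≤-pointwise {x} {y} λ n → ℚ.≤-reflexive (h n)) (≤-pointwise {y} {x} λ n → ℚ.≤-reflexive (≡.sym (h n)))

ℝ-trans : ∀ {x y z} → x ≃ y → y ≃ z → x ≃ z
ℝ-trans {x} {y} {z} x≃y y≃z = ℝ-≤-antisym {x} {z}
  (ℝ-≤-trans {x} {y} {z} (ℝ-≤-reflexive {x} {y} x≃y) (ℝ-≤-reflexive {y} {z} y≃z))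
  (ℝ-≤-trans {z} {y} {x} (ℝ-≤-reflexive {z} {y} (ℝ-sym {y} {z} y≃z)) (ℝ-≤-reflexive {y} {x} (ℝ-sym {x} {y} x≃y)))

ℝ-+-mono-≤ : ∀ {x y u v} → x ≤ y → u ≤ v → x + u ≤ y + v
ℝ-+-mono-≤ {x} {y} {u} {v} x≤y u≤v ε 0<ε = eventually-map₂
  (λ n h₁ h₂ → ℚ.≤-trans (ℚ.+-mono-≤ h₁ h₂) (ℚ.≤-reflexive (≡.trans
    (solve 3 (λ y v e → (y :+ e) :+ (v :+ e) := (y :+ v) :+ (e :+ e)) ≡.refl (seq y n) (seq v n) (ε ℚ.* ½))
    (≡.cong (seq y n ℚ.+ seq v n ℚ.+_) (½ε+½ε≡ε ε)))))
  (x≤y (ε ℚ.* ½) (half 0<ε)) (u≤v (ε ℚ.* ½) (half 0<ε))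
  where open ℚ-Solver

ℝ-+-cong : ∀ {x y u v} → x ≃ y → u ≃ v → x + u ≃ y + v
ℝ-+-cong {x} {y} {u} {v} x≃y u≃v = ℝ-≤-antisym {x + u} {y + v}
  (ℝ-+-mono-≤ {x} {y} {u} {v} (ℝ-≤-reflexive {x} {y} x≃y) (ℝ-≤-reflexive {u} {v} u≃v))
  (ℝ-+-mono-≤ {y} {x} {v} {u} (ℝ-≤-reflexive {y} {x} (ℝ-sym {x} {y} x≃y)) (ℝ-≤-reflexive {v} {u} (ℝ-sym {u} {v} u≃v)))

ℝ-neg-cong : ∀ {x y} → x ≃ y → - x ≃ - y
ℝ-neg-cong {x} {y} x≃y ε 0<ε = eventually-map
  (λ n → ≡.subst (ℚ._≤ ε) (≡.trans (∣p-q∣-sym (seq x n) (seq y n))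
    (≡.cong ℚ.∣_∣ (solve 2 (λ x y → y :- x := :- x :- (:- y)) ≡.refl (seq x n) (seq y n)))))
  (x≃y ε 0<ε)
  where open ℚ-Solver

ℝ-*-congʳ : ∀ {x y} z → x ≃ y → x * z ≃ y * z
ℝ-*-congʳ {x} {y} z x≃y ε 0<ε = eventually-map₂
  (λ n ∣x-y∣≤ ∣z∣≤B → begin
    ℚ.∣ seq x n ℚ.* seq z n ℚ.- seq y n ℚ.* seq z n ∣
      ≡⟨ ≡.cong ℚ.∣_∣ (solve 3 (λ x y z → x :* z :- y :* z := (x :- y) :* z) ≡.refl (seq x n) (seq y n) (seq z n)) ⟩
    ℚ.∣ (seq x n ℚ.- seq y n) ℚ.* seq z n ∣
      ≡⟨ ℚ.∣p*q∣≡∣p∣*∣q∣ (seq x n ℚ.- seq y n) (seq z n) ⟩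
    ℚ.∣ seq x n ℚ.- seq y n ∣ ℚ.* ℚ.∣ seq z n ∣
      ≤⟨ *-mono-≤ (ℚ.0≤∣p∣ (seq x n ℚ.- seq y n)) (ℚ.<⇒≤ 0<B) ∣x-y∣≤ ∣z∣≤B ⟩
    ε ℚ.* reciprocal 0<B ℚ.* B
      ≡⟨ solve 3 (λ e r b → e :* r :* b := e :* (b :* r)) ≡.refl ε (reciprocal 0<B) B ⟩
    ε ℚ.* (B ℚ.* reciprocal 0<B)
      ≡⟨ ≡.trans (≡.cong (ε ℚ.*_) (p*reciprocal 0<B)) (ℚ.*-identityʳ ε) ⟩
    ε ∎)
  (x≃y (ε ℚ.* reciprocal 0<B) (*-pos 0<ε (reciprocal-pos 0<B))) (proj₂ (proj₂ (bounded z)))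
  where
  open ℚ.≤-Reasoning
  open ℚ-Solver
  B = proj₁ (bounded z)
  0<B = proj₁ (proj₂ (bounded z))

ℝ-*-comm : ∀ x y → x * y ≃ y * x
ℝ-*-comm x y = ≃-pointwise {x * y} {y * x} λ n → ℚ.*-comm (seq x n) (seq y n)

ℝ-*-cong : ∀ {x y u v} → x ≃ y → u ≃ v → x * u ≃ y * v
ℝ-*-cong {x} {y} {u} {v} x≃y u≃v = ℝ-trans {x * u} {y * u} {y * v} (ℝ-*-congʳ {x} {y} u x≃y)
  (ℝ-trans {y * u} {u * y} {y * v} (ℝ-*-comm y u)
    (ℝ-trans {u * y} {v * y} {y * v} (ℝ-*-congʳ {u} {v} y u≃v) (ℝ-*-comm v y)))

ℝ-0≤x⇒∣x∣≃x : ∀ {x} → 0ℝ ≤ x → ∣ x ∣ ≃ x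
ℝ-0≤x⇒∣x∣≃x {x} 0≤x ε 0<ε = eventually-map (λ n h → near (seq x n) h) (0≤x (ε ℚ.* ½) (half 0<ε))
  where
  open ℚ-Solver
  near : ∀ p → 0ℚ ℚ.≤ p ℚ.+ ε ℚ.* ½ → ℚ.∣ ℚ.∣ p ∣ ℚ.- p ∣ ℚ.≤ ε
  near p h = ≤+⇒∣p-q∣≤ (∣-∣≤ (p≤p+q (ℚ.<⇒≤ 0<ε)) (0≤q-p⇒p≤q (≡.subst (0ℚ ℚ.≤_)
      (solve 2 (λ p e → (p :+ e :* con ½) :+ (p :+ e :* con ½) := p :+ e :- (:- p)) ≡.refl p ε) (ℚ-+-nonNeg h h))))
    (ℚ.≤-trans (p≤∣p∣ p) (p≤p+q (ℚ.<⇒≤ 0<ε)))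

ℝ-x≤0⇒∣x∣≃-x : ∀ {x} → x ≤ 0ℝ → ∣ x ∣ ≃ - x
ℝ-x≤0⇒∣x∣≃-x {x} x≤0 = ℝ-trans {∣ x ∣} {∣ - x ∣} { - x}
  (≃-pointwise {∣ x ∣} {∣ - x ∣} λ n → ≡.sym (ℚ.∣-p∣≡∣p∣ (seq x n)))
  (ℝ-0≤x⇒∣x∣≃x { - x} λ ε 0<ε → eventually-map (λ n h → 0≤q-p⇒p≤q (≡.subst (0ℚ ℚ.≤_)
      (solve 2 (λ x e → con 0ℚ :+ e :- x := :- x :+ e :- con 0ℚ) ≡.refl (seq x n) ε) (p≤q⇒0≤q-p h))) (x≤0 ε 0<ε))
  where open ℚ-Solver

-- The product agrees with that of the absolute values, which is termwise
-- nonnegative.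
ℝ-*-nonNeg : ∀ {x y} → 0ℝ ≤ x → 0ℝ ≤ y → 0ℝ ≤ x * y
ℝ-*-nonNeg {x} {y} 0≤x 0≤y = ℝ-≤-trans {0ℝ} {∣ x ∣ * ∣ y ∣} {x * y}
  (≤-pointwise {0ℝ} {∣ x ∣ * ∣ y ∣} λ n → ℚ-*-nonNeg (ℚ.0≤∣p∣ (seq x n)) (ℚ.0≤∣p∣ (seq y n)))
  (ℝ-≤-reflexive {∣ x ∣ * ∣ y ∣} {x * y} (ℝ-*-cong {∣ x ∣} {x} {∣ y ∣} {y} (ℝ-0≤x⇒∣x∣≃x {x} 0≤x) (ℝ-0≤x⇒∣x∣≃x {y} 0≤y)))

-- Comparison up to a tolerance is decidable.
compare : ∀ x y η → 0ℚ ℚ.< η → Eventually (λ n → seq x n ℚ.≤ seq y n ℚ.+ η) ⊎ y < x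
compare x y η 0<η = decide (seq x N ℚ.≤? seq y N ℚ.+ (θ ℚ.+ θ))
  where
  open ℚ.≤-Reasoning
  open ℚ-Solver
  θ = η ℚ.* ½ ℚ.* ½
  0<θ = half (half 0<η)
  cx = cauchy x θ 0<θ
  cy = cauchy y (θ ℚ.* ½) (half 0<θ)
  N = proj₁ cx ℕ.⊔ proj₁ cy
  x-near : ∀ m n → N ℕ.≤ m → N ℕ.≤ n → seq x m ℚ.≤ seq x n ℚ.+ θ
  x-near m n N≤m N≤n = ∣p-q∣≤⇒p≤q+ {seq x m} {seq x n}
    (proj₂ cx m n (ℕ.m⊔n≤o⇒m≤o (proj₁ cx) _ N≤m) (ℕ.m⊔n≤o⇒m≤o (proj₁ cx) _ N≤n))
  y-near : ∀ m n → N ℕ.≤ m → N ℕ.≤ n → seq y m ℚ.≤ seq y n ℚ.+ θ ℚ.* ½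
  y-near m n N≤m N≤n = ∣p-q∣≤⇒p≤q+ {seq y m} {seq y n}
    (proj₂ cy m n (ℕ.m⊔n≤o⇒n≤o (proj₁ cx) _ N≤m) (ℕ.m⊔n≤o⇒n≤o (proj₁ cx) _ N≤n))
  below : ∀ a b c d → a ℚ.≤ b ℚ.+ θ → b ℚ.≤ c ℚ.+ (θ ℚ.+ θ) → c ℚ.≤ d ℚ.+ θ ℚ.* ½ → a ℚ.≤ d ℚ.+ η
  below a b c d h₁ h₂ h₃ = begin
    a                                          ≤⟨ h₁ ⟩
    b ℚ.+ θ                                    ≤⟨ ℚ.+-monoˡ-≤ θ h₂ ⟩
    c ℚ.+ (θ ℚ.+ θ) ℚ.+ θ                      ≤⟨ ℚ.+-monoˡ-≤ θ (ℚ.+-monoˡ-≤ (θ ℚ.+ θ) h₃) ⟩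
    d ℚ.+ θ ℚ.* ½ ℚ.+ (θ ℚ.+ θ) ℚ.+ θ          ≤⟨ p≤p+q (ℚ.<⇒≤ (half 0<θ)) ⟩
    d ℚ.+ θ ℚ.* ½ ℚ.+ (θ ℚ.+ θ) ℚ.+ θ ℚ.+ θ ℚ.* ½
      ≡⟨ solve 2 (λ d e → let t = e :* con ½ :* con ½ in
           d :+ t :* con ½ :+ (t :+ t) :+ t :+ t :* con ½ := d :+ e) ≡.refl d η ⟩
    d ℚ.+ η                                    ∎
  above : ∀ a b c d → a ℚ.≤ b ℚ.+ θ ℚ.* ½ → b ℚ.+ (θ ℚ.+ θ) ℚ.≤ c → c ℚ.≤ d ℚ.+ θ → a ℚ.+ θ ℚ.* ½ ℚ.≤ d
  above a b c d h₁ h₂ h₃ = begin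
    a ℚ.+ θ ℚ.* ½                              ≤⟨ ℚ.+-monoˡ-≤ (θ ℚ.* ½) h₁ ⟩
    b ℚ.+ θ ℚ.* ½ ℚ.+ θ ℚ.* ½                  ≡⟨ solve 2 (λ b t → b :+ t :* con ½ :+ t :* con ½ := b :+ (t :+ t) :- t) ≡.refl b θ ⟩
    b ℚ.+ (θ ℚ.+ θ) ℚ.- θ                      ≤⟨ ℚ.+-monoˡ-≤ (ℚ.- θ) (ℚ.≤-trans h₂ h₃) ⟩
    d ℚ.+ θ ℚ.- θ                              ≡⟨ solve 2 (λ d t → d :+ t :- t := d) ≡.refl d θ ⟩
    d                                          ∎
  decide : Dec (seq x N ℚ.≤ seq y N ℚ.+ (θ ℚ.+ θ)) → Eventually (λ n → seq x n ℚ.≤ seq y n ℚ.+ η) ⊎ y < x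
  decide (yes h) = inj₁ (N , λ n N≤n → below (seq x n) (seq x N) (seq y N) (seq y n)
    (x-near n N N≤n ℕ.≤-refl) h (y-near N n ℕ.≤-refl N≤n))
  decide (no h) = inj₂ (θ ℚ.* ½ , half 0<θ , N , λ n N≤n →
    above (seq y n) (seq y N) (seq x N) (seq x n)
    (y-near n N N≤n ℕ.≤-refl) (ℚ.<⇒≤ (ℚ.≰⇒> h)) (x-near N n ℕ.≤-refl N≤n))

<⇒≤ : ∀ {x y} → x < y → x ≤ y
<⇒≤ {x} {y} (e , 0<e , N , h) ε 0<ε = N , λ n N≤n →
  ℚ.≤-trans (p≤p+q (ℚ.<⇒≤ 0<e)) (ℚ.≤-trans (h n N≤n) (p≤p+q (ℚ.<⇒≤ 0<ε)))

<⇒≱ : ∀ {x y} → x < y → ¬ y ≤ x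
<⇒≱ {x} {y} (e , 0<e , x<y) y≤x = ℚ.<-irrefl ≡.refl (begin-strict
  0ℚ                 <⟨ half 0<e ⟩
  e ℚ.* ½            ≡⟨ solve 2 (λ x e → e :* con ½ := x :+ e :- (x :+ e :* con ½)) ≡.refl (seq x N) e ⟩
  seq x N ℚ.+ e ℚ.- (seq x N ℚ.+ e ℚ.* ½)  ≤⟨ ℚ.+-monoˡ-≤ (ℚ.- (seq x N ℚ.+ e ℚ.* ½)) (proj₂ both N ℕ.≤-refl) ⟩
  seq x N ℚ.+ e ℚ.* ½ ℚ.- (seq x N ℚ.+ e ℚ.* ½)  ≡⟨ ℚ.+-inverseʳ (seq x N ℚ.+ e ℚ.* ½) ⟩
  0ℚ                 ∎)
  where
  open ℚ.≤-Reasoning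
  open ℚ-Solver
  both : Eventually λ n → seq x n ℚ.+ e ℚ.≤ seq x n ℚ.+ e ℚ.* ½
  both = eventually-map₂ (λ n → ℚ.≤-trans) x<y (y≤x (e ℚ.* ½) (half 0<e))
  N = proj₁ both

ℝ-≮⇒≥ : ∀ {x y} → ¬ x < y → y ≤ x
ℝ-≮⇒≥ {x} {y} x≮y ε 0<ε = [ (λ y≤x+ε → y≤x+ε) , (λ x<y → contradiction x<y x≮y) ]′ (compare y x ε 0<ε)

ℝ-≰⇒≥ : ∀ {x y} → ¬ x ≤ y → y ≤ x
ℝ-≰⇒≥ {x} {y} x≰y = ℝ-≮⇒≥ {x} {y} λ x<y → x≰y (<⇒≤ {x} {y} x<y)

ℝ-≤-stable : ∀ {x y} → ¬ ¬ x ≤ y → x ≤ y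
ℝ-≤-stable {x} {y} ¬¬x≤y ε 0<ε = [ (λ x≤y+ε → x≤y+ε) , (λ y<x → contradiction (<⇒≱ {y} {x} y<x) ¬¬x≤y) ]′ (compare x y ε 0<ε)

ℝ-commutativeRing : CommutativeRing 0ℓ 0ℓ
ℝ-commutativeRing = record
  { Carrier = ℝ ; _≈_ = _≃_ ; _+_ = _+_ ; _*_ = _*_ ; -_ = -_ ; 0# = 0ℝ ; 1# = 1ℝ
  ; isCommutativeRing = record
    { isRing = record
      { +-isAbelianGroup = record
        { isGroup = record
          { isMonoid = record
            { isSemigroup = record
              { isMagma = record
                { isEquivalence = record
                  { refl = λ {x} → ≃-pointwise {x} {x} λ n → ≡.refl
                  ; sym = λ {x} {y} → ℝ-sym {x} {y}
                  ; trans = λ {x} {y} {z} → ℝ-trans {x} {y} {z} }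
                ; ∙-cong = λ {x} {y} {u} {v} → ℝ-+-cong {x} {y} {u} {v} }
              ; assoc = λ x y z → ≃-pointwise {(x + y) + z} {x + (y + z)} λ n → ℚ.+-assoc (seq x n) (seq y n) (seq z n) }
            ; identity = (λ x → ≃-pointwise {0ℝ + x} {x} λ n → ℚ.+-identityˡ (seq x n))
                       , (λ x → ≃-pointwise {x + 0ℝ} {x} λ n → ℚ.+-identityʳ (seq x n)) }
          ; inverse = (λ x → ≃-pointwise {(- x) + x} {0ℝ} λ n → ℚ.+-inverseˡ (seq x n))
                    , (λ x → ≃-pointwise {x + (- x)} {0ℝ} λ n → ℚ.+-inverseʳ (seq x n))
          ; ⁻¹-cong = λ {x} {y} → ℝ-neg-cong {x} {y} }
        ; comm = λ x y → ≃-pointwise {x + y} {y + x} λ n → ℚ.+-comm (seq x n) (seq y n) }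
      ; *-cong = λ {x} {y} {u} {v} → ℝ-*-cong {x} {y} {u} {v}
      ; *-assoc = λ x y z → ≃-pointwise {(x * y) * z} {x * (y * z)} λ n → ℚ.*-assoc (seq x n) (seq y n) (seq z n)
      ; *-identity = (λ x → ≃-pointwise {1ℝ * x} {x} λ n → ℚ.*-identityˡ (seq x n))
                   , (λ x → ≃-pointwise {x * 1ℝ} {x} λ n → ℚ.*-identityʳ (seq x n))
      ; distrib = (λ x y z → ≃-pointwise {x * (y + z)} {x * y + x * z} λ n → ℚ.*-distribˡ-+ (seq x n) (seq y n) (seq z n))
                , (λ x y z → ≃-pointwise {(y + z) * x} {y * x + z * x} λ n → ℚ.*-distribʳ-+ (seq x n) (seq y n) (seq z n)) }
    ; *-comm = ℝ-*-comm } }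

ℝ-orderedRing : OrderedRing
ℝ-orderedRing = record
  { commutativeRing = ℝ-commutativeRing
  ; _≤_ = _≤_
  ; ≤-reflexive = λ {x} {y} → ℝ-≤-reflexive {x} {y}
  ; ≤-trans = λ {x} {y} {z} → ℝ-≤-trans {x} {y} {z}
  ; ≤-antisym = λ {x} {y} → ℝ-≤-antisym {x} {y}
  ; ≤-stable = λ {x} {y} → ℝ-≤-stable {x} {y}
  ; ≰⇒≥ = λ {x} {y} → ℝ-≰⇒≥ {x} {y}
  ; +-mono-≤ = λ {x} {y} {u} {v} → ℝ-+-mono-≤ {x} {y} {u} {v}
  ; *-nonNeg = λ {x} {y} → ℝ-*-nonNeg {x} {y}
  ; ∣_∣ = ∣_∣
  ; 0≤x⇒∣x∣≈x = λ {x} → ℝ-0≤x⇒∣x∣≃x {x}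
  ; x≤0⇒∣x∣≈-x = λ {x} → ℝ-x≤0⇒∣x∣≃-x {x}
  ; ι = fromℚ
  ; ι-+ = λ p q → ≃-pointwise {fromℚ (p ℚ.+ q)} {fromℚ p + fromℚ q} λ _ → ≡.refl
  ; ι-* = λ p q → ≃-pointwise {fromℚ (p ℚ.* q)} {fromℚ p * fromℚ q} λ _ → ≡.refl
  ; ι-neg = λ p → ≃-pointwise {fromℚ (ℚ.- p)} { - fromℚ p} λ _ → ≡.refl
  ; ι-0 = ≃-pointwise {0ℝ} {0ℝ} λ _ → ≡.refl
  ; ι-1 = ≃-pointwise {1ℝ} {1ℝ} λ _ → ≡.refl
  ; ι-mono = λ {p} {q} p≤q → ≤-pointwise {fromℚ p} {fromℚ q} λ _ → p≤q
  }

x*x⁻¹≃1 : ∀ x (0<x : 0ℝ < x) → x * (x ⁻¹[ 0<x ]) ≃ 1ℝ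
x*x⁻¹≃1 x (c , 0<c , N , c≤x) ε 0<ε = N , λ n N≤n → ≡.subst (ℚ._≤ ε) (≡.sym (≡.cong (λ p → ℚ.∣ p ℚ.- 1ℚ ∣) (begin
  seq x n ℚ.* reciprocal (⊔-pos (seq x n) 0<c)
    ≡⟨ ≡.cong (ℚ._* reciprocal (⊔-pos (seq x n) 0<c))
         (ℚ.p≥q⇒p⊔q≡p (≡.subst (ℚ._≤ seq x n) (ℚ.+-identityˡ c) (c≤x n N≤n))) ⟨
  (seq x n ℚ.⊔ c) ℚ.* reciprocal (⊔-pos (seq x n) 0<c)
    ≡⟨ p*reciprocal (⊔-pos (seq x n) 0<c) ⟩
  1ℚ ∎))) (ℚ.<⇒≤ 0<ε)
  where open ≡.≡-Reasoning

-- The operations and lemmas of the ordered ring ℝ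
module P = OrderedRingProperties ℝ-orderedRing

-- Rational approximations of reciprocals and logarithms

-- A term of the sequence that lies late enough determines x up to a factor of 4.
-- The positive lower bound supplied with 0ℝ < x may be far from x.
approximation : ∀ x → 0ℝ < x → ∃ λ d → 0ℚ ℚ.< d × Eventually λ n → d ℚ.≤ seq x n × seq x n ℚ.≤ 4ℚ ℚ.* d
approximation x (c , 0<c , N₀ , c≤x) = s ℚ.* ½ , half 0<s , N , λ n N≤n → lower n (near N n ℕ.≤-refl N≤n) , upper n (near n N N≤n ℕ.≤-refl)
  where
  open ℚ.≤-Reasoning
  open ℚ-Solver
  cx = cauchy x (c ℚ.* ½) (half 0<c)
  N = N₀ ℕ.⊔ proj₁ cx
  s = seq x N
  c≤s : c ℚ.≤ s
  c≤s = ≡.subst (ℚ._≤ s) (ℚ.+-identityˡ c) (c≤x N (ℕ.m≤m⊔n N₀ (proj₁ cx)))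
  0<s = ℚ.<-≤-trans 0<c c≤s
  near : ∀ m n → N ℕ.≤ m → N ℕ.≤ n → seq x m ℚ.≤ seq x n ℚ.+ s ℚ.* ½
  near m n N≤m N≤n = ℚ.≤-trans
    (∣p-q∣≤⇒p≤q+ {seq x m} {seq x n} (proj₂ cx m n (ℕ.m⊔n≤o⇒n≤o N₀ _ N≤m) (ℕ.m⊔n≤o⇒n≤o N₀ _ N≤n)))
    (ℚ.+-monoʳ-≤ (seq x n) (ℚ.*-monoʳ-≤-nonNeg ½ c≤s))
  lower : ∀ n → s ℚ.≤ seq x n ℚ.+ s ℚ.* ½ → s ℚ.* ½ ℚ.≤ seq x n
  lower n h = 0≤q-p⇒p≤q (≡.subst (0ℚ ℚ.≤_)
    (solve 2 (λ x s → x :+ s :* con ½ :- s := x :- s :* con ½) ≡.refl (seq x n) s) (p≤q⇒0≤q-p h))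
  upper : ∀ n → seq x n ℚ.≤ s ℚ.+ s ℚ.* ½ → seq x n ℚ.≤ 4ℚ ℚ.* (s ℚ.* ½)
  upper n h = begin
    seq x n                          ≤⟨ h ⟩
    s ℚ.+ s ℚ.* ½                    ≤⟨ p≤p+q (ℚ.<⇒≤ (half 0<s)) ⟩
    s ℚ.+ s ℚ.* ½ ℚ.+ s ℚ.* ½        ≡⟨ solve 1 (λ s → s :+ s :* con ½ :+ s :* con ½ := con 4ℚ :* (s :* con ½)) ≡.refl s ⟩
    4ℚ ℚ.* (s ℚ.* ½)                 ∎

-- A rational number between 1 / x and 4 / x
inverseApprox : ∀ x → 0ℝ < x → ℚ
inverseApprox x 0<x = reciprocal (proj₁ (proj₂ (approximation x 0<x)))

inverseApprox-nonNeg : ∀ x 0<x → 0ℚ ℚ.≤ inverseApprox x 0<x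
inverseApprox-nonNeg x 0<x = ℚ.<⇒≤ (reciprocal-pos (proj₁ (proj₂ (approximation x 0<x))))

-- The inequality 1 / x ≤ inverseApprox x, in the form in which it is used
inverseApprox-lower : ∀ x 0<x {X Y} → inverseApprox x 0<x ℚ.≤ X → X ℚ.* Y ≡ 1ℚ → 0ℚ ℚ.≤ Y → fromℚ Y ≤ x
inverseApprox-lower x 0<x {X} {Y} v≤X XY≡1 0≤Y ε 0<ε = eventually-map
  (λ n h → ℚ.≤-trans (ℚ.≤-trans Y≤d (proj₁ h)) (p≤p+q (ℚ.<⇒≤ 0<ε))) (proj₂ (proj₂ (approximation x 0<x)))
  where
  open ℚ.≤-Reasoning
  open ℚ-Solver
  d = proj₁ (approximation x 0<x)
  0<d = proj₁ (proj₂ (approximation x 0<x))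
  Y≤d : Y ℚ.≤ d
  Y≤d = begin
    Y                                    ≡⟨ ≡.trans (≡.cong (ℚ._* Y) (p*reciprocal 0<d)) (ℚ.*-identityˡ Y) ⟨
    d ℚ.* reciprocal 0<d ℚ.* Y           ≤⟨ ℚ.*-monoʳ-≤-nonNeg Y {{ℚ.nonNegative 0≤Y}} (ℚ.*-monoˡ-≤-nonNeg d {{ℚ.nonNegative (ℚ.<⇒≤ 0<d)}} v≤X) ⟩
    d ℚ.* X ℚ.* Y                        ≡⟨ ≡.trans (ℚ.*-assoc d X Y) (≡.trans (≡.cong (d ℚ.*_) XY≡1) (ℚ.*-identityʳ d)) ⟩
    d                                    ∎

reciprocal-scale : ∀ {a d} (0<a : 0ℚ ℚ.< a) (0<d : 0ℚ ℚ.< d) → a ℚ.≤ 4ℚ ℚ.* d → reciprocal 0<d ℚ.≤ 4ℚ ℚ.* reciprocal 0<a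
reciprocal-scale {a} {d} 0<a 0<d a≤4d = begin
  v                        ≡⟨ ≡.trans (≡.cong (v ℚ.*_) (p*reciprocal 0<a)) (ℚ.*-identityʳ v) ⟨
  v ℚ.* (a ℚ.* w)          ≤⟨ ℚ.*-monoˡ-≤-nonNeg v {{ℚ.nonNegative (ℚ.<⇒≤ (reciprocal-pos 0<d))}}
                                (ℚ.*-monoʳ-≤-nonNeg w {{ℚ.nonNegative (ℚ.<⇒≤ (reciprocal-pos 0<a))}} a≤4d) ⟩
  v ℚ.* (4ℚ ℚ.* d ℚ.* w)   ≡⟨ solve 4 (λ v c d w → v :* (c :* d :* w) := c :* w :* (d :* v)) ≡.refl v 4ℚ d w ⟩
  4ℚ ℚ.* w ℚ.* (d ℚ.* v)   ≡⟨ ≡.trans (≡.cong (4ℚ ℚ.* w ℚ.*_) (p*reciprocal 0<d)) (ℚ.*-identityʳ (4ℚ ℚ.* w)) ⟩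
  4ℚ ℚ.* w                 ∎
  where
  open ℚ.≤-Reasoning
  open ℚ-Solver
  v = reciprocal 0<d
  w = reciprocal 0<a

inverseApprox-upper : ∀ x 0<x → Eventually λ n → inverseApprox x 0<x ℚ.≤ 4ℚ ℚ.* seq (x ⁻¹[ 0<x ]) n
inverseApprox-upper x 0<x@(c , 0<c , c≤x) = eventually-map₂
  (λ n c≤xn bounds → reciprocal-scale (⊔-pos (seq x n) 0<c) (proj₁ (proj₂ (approximation x 0<x)))
    (ℚ.⊔-lub (proj₂ bounds) (ℚ.≤-trans (≡.subst (ℚ._≤ seq x n) (ℚ.+-identityˡ c) c≤xn) (proj₂ bounds))))
  c≤x (proj₂ (proj₂ (approximation x 0<x)))

-- The summand 1 in 1 + c absorbs the rounding in log₂-approx.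
log₂-bound : ∀ {p} j c k → 1ℚ ℚ.≤ p → 2ℚ ^ℚ j ℚ.≤ 2ℚ ^ℚ c ℚ.* p → ℕ⇒ℚ j ℚ.≤ ℕ⇒ℚ (suc c) ℚ.+ log₂-approx p k
log₂-bound {p} j c k 1≤p h = ℚ.≤-trans
  (/-mono-≤ j 0 (suc c ℕ.* suc k ℕ.+ a ℕ.* 1) (k ℕ.+ 0) (begin
    j ℕ.* suc (k ℕ.+ 0)                          ≡⟨ ≡.cong (λ k → j ℕ.* suc k) (ℕ.+-identityʳ k) ⟩
    j ℕ.* suc k                                  ≤⟨ 2^-cancel-≤ (j ℕ.* suc k) (c ℕ.* suc k ℕ.+ suc a) powers ⟩
    c ℕ.* suc k ℕ.+ suc a                        ≤⟨ ℕ.+-monoʳ-≤ (c ℕ.* suc k) (ℕ.m≤n+m (suc a) k) ⟩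
    c ℕ.* suc k ℕ.+ (k ℕ.+ suc a)                ≡⟨ solve 3 (λ x k a → x :+ (k :+ (con 1 :+ a)) := (con 1 :+ k :+ x :+ a :* con 1) :* con 1) ≡.refl (c ℕ.* suc k) k a ⟩
    (suc c ℕ.* suc k ℕ.+ a ℕ.* 1) ℕ.* 1          ∎))
  (ℚ.≤-reflexive (≡.sym (/-+ (suc c) 0 a k)))
  where
  open ℕ.≤-Reasoning
  open ℕ-Solver
  a = ⌊log₂⌊ p ^ℚ suc k ⌋⌋
  0≤p = ℚ.≤-trans 0≤1 1≤p
  powers : 2ℚ ^ℚ (j ℕ.* suc k) ℚ.≤ 2ℚ ^ℚ (c ℕ.* suc k ℕ.+ suc a)
  powers = ℚR.begin
    2ℚ ^ℚ (j ℕ.* suc k)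
      ℚR.≡⟨ ^ℚ-assocʳ 2ℚ j (suc k) ⟨
    (2ℚ ^ℚ j) ^ℚ suc k
      ℚR.≤⟨ ^-monoˡ-≤ (0≤2^ j) h (suc k) ⟩
    (2ℚ ^ℚ c ℚ.* p) ^ℚ suc k
      ℚR.≡⟨ ^ℚ-distrib-* (2ℚ ^ℚ c) p (suc k) ⟩
    (2ℚ ^ℚ c) ^ℚ suc k ℚ.* p ^ℚ suc k
      ℚR.≡⟨ ≡.cong (ℚ._* p ^ℚ suc k) (^ℚ-assocʳ 2ℚ c (suc k)) ⟩
    2ℚ ^ℚ (c ℕ.* suc k) ℚ.* p ^ℚ suc k
      ℚR.≤⟨ ℚ.*-monoˡ-≤-nonNeg (2ℚ ^ℚ (c ℕ.* suc k)) {{ℚ.nonNegative (0≤2^ (c ℕ.* suc k))}}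
              (p≤2^[1+⌊log₂⌊p⌋⌋] (p ^ℚ suc k) (^-nonNeg 0≤p (suc k))) ⟩
    2ℚ ^ℚ (c ℕ.* suc k) ℚ.* 2ℚ ^ℚ suc a
      ℚR.≡⟨ ^ℚ-homo-* 2ℚ (c ℕ.* suc k) (suc a) ⟨
    2ℚ ^ℚ (c ℕ.* suc k ℕ.+ suc a) ℚR.∎
    where module ℚR = ℚ.≤-Reasoning

-- The test for real distributions

module _ (n : ℕ) .{{_ : ℕ.NonZero n}} where

  module Laws = ConditionalLaws ℝ-orderedRing n
  module Conditioned = Conditioning ℝ-orderedRing
  module 𝔼ℝ = Expectation ℝ-orderedRing

  module _ {μ : Distribution n} (O : ConditionalOracle μ) where

    mass≃mass : ∀ A → Laws.mass (prob μ) A ≃ mass μ A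
    mass≃mass A = P.sum-cong {n} {λ i → P.ind (lookup A i) * prob μ i} {λ i → if lookup A i then prob μ i else 0ℝ}
      λ i → Conditioned.ind*≈if (lookup A i) (prob μ i)

    prob≤mass : ∀ A i → lookup A i ≡ true → prob μ i ≤ mass μ A
    prob≤mass A i i∈A = ≡.subst (_≤ mass μ A) (≡.cong (λ b → if b then prob μ i else 0ℝ) i∈A)
      (P.f≤sum {n} {λ i → if lookup A i then prob μ i else 0ℝ} (λ i → 0≤if (lookup A i) i) i)
      where
      0≤if : ∀ b i → 0ℝ ≤ (if b then prob μ i else 0ℝ)
      0≤if true i = nonNegative μ i
      0≤if false i = P.≤-refl {0ℝ}

    -- If A does not have positive mass, then its mass and prob μ i are both zero.
    -- The two cases need not be decided since the equation is stable.
    law-inside : ∀ A i → lookup (proj₁ A) i ≡ true → prob (law O A) i * Laws.mass (prob μ) (proj₁ A) ≃ prob μ i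
    law-inside A i i∈A = ℝ-trans {prob (law O A) i * Laws.mass (prob μ) (proj₁ A)} {prob (law O A) i * m} {prob μ i}
      (ℝ-*-cong {prob (law O A) i} {prob (law O A) i} {Laws.mass (prob μ) (proj₁ A)} {m} (P.refl {prob (law O A) i}) (mass≃mass (proj₁ A)))
      (Conditioned.≈-stable {prob (law O A) i * m} {prob μ i} λ ≄ → ≄ (Conditioned.null {prob (law O A) i} {prob μ i} {m}
        (ℝ-≮⇒≥ {0ℝ} {m} λ 0<m → ≄ (Conditioned.conditioned {prob (law O A) i} {prob μ i} {m ⁻¹[ 0<m ]} {m}
          (conditional O A 0<m (lookup⇒[]= i (proj₁ A) i∈A)) (x*x⁻¹≃1 m 0<m)))
        (nonNegative μ i) (prob≤mass (proj₁ A) i i∈A)))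
      where
      m = mass μ (proj₁ A)

    isConditional : Laws.IsConditional (prob μ) (λ A → prob (law O A))
    isConditional = record
      { p-nonNeg = nonNegative μ
      ; p-total = total μ
      ; q-nonNeg = λ A → nonNegative (law O A)
      ; q-total = λ A → total (law O A)
      ; q-outside = λ A i i∉A → supported O A λ i∈A → true≢false (≡.trans (≡.sym ([]=⇒lookup i∈A)) i∉A)
      ; q-inside = law-inside }
      where
      true≢false : ¬ true ≡ false
      true≢false ()

    open 𝔼ℝ.Samples (λ A → prob (law O A)) using () renaming (𝔼-samples to 𝔼-samples′)

    -- Expectations over the ordered ring ℝ agree with those for oracles.
    𝔼-samples-agree : ∀ As {f g} → (∀ js → f js ≃ g js) → 𝔼-samples′ As f ≃ 𝔼-samples O As g
    𝔼-samples-agree [] h = h []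
    𝔼-samples-agree (A ∷ As) {f} {g} h = P.sum-cong {n}
      {λ j → prob (law O A) j P.* 𝔼-samples′ As (λ js → f (j ∷ js))}
      {λ j → prob (law O A) j * 𝔼-samples O As (λ js → g (j ∷ js))} λ j →
      *-agree {prob (law O A) j} {𝔼-samples′ As (λ js → f (j ∷ js))} {𝔼-samples O As (λ js → g (j ∷ js))}
        (𝔼-samples-agree As λ js → h (j ∷ js))
      where
      *-agree : ∀ {x u v} → u ≃ v → x P.* u ≃ x * v
      *-agree {x} {u} {v} = ℝ-*-cong {x} {x} {u} {v} (P.refl {x})

  𝔼-coins-agree : ∀ r {f g} → (∀ ω → f ω ≃ g ω) → 𝔼ℝ.𝔼-coins r f ≃ 𝔼-coins r g
  𝔼-coins-agree zero h = h []
  𝔼-coins-agree (suc r) {f} {g} h = average-agree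
    {𝔼ℝ.𝔼-coins r λ ω → f (true ∷ ω)} {𝔼-coins r λ ω → g (true ∷ ω)}
    {𝔼ℝ.𝔼-coins r λ ω → f (false ∷ ω)} {𝔼-coins r λ ω → g (false ∷ ω)}
    (𝔼-coins-agree r λ ω → h (true ∷ ω)) (𝔼-coins-agree r λ ω → h (false ∷ ω))
    where
    average-agree : ∀ {x y u v} → x ≃ y → u ≃ v → P.ι ½ P.* (x P.+ u) ≃ fromℚ ½ * (y + v)
    average-agree {x} {y} {u} {v} x≃y u≃v = ℝ-*-cong {fromℚ ½} {fromℚ ½} {x + u} {y + v} (P.refl {fromℚ ½}) (ℝ-+-cong {x} {y} {u} {v} x≃y u≃v)

  ind≃indicator : ∀ b → P.ind b ≃ indicator b
  ind≃indicator true = P.refl {1ℝ}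
  ind≃indicator false = P.refl {0ℝ}

  -- The uniform distribution, whose distance from μ enters soundness
  uniform : Distribution n
  uniform = record
    { prob = λ _ → fromℚ (ℤ.1ℤ ℚ./ n)
    ; nonNegative = λ _ → ≤-pointwise {0ℝ} {fromℚ (ℤ.1ℤ ℚ./ n)} λ _ → 0≤1/n n
    ; total = Test.Correctness.nu≈1 n 0 0 ℝ-orderedRing }

  module _ (E b : ℕ) where
    open Test n E b using (M; r; B; β; e; roundQueries; accepts)

    testAlgorithm : NonAdaptiveAlgorithm n
    testAlgorithm = record { coins = M ℕ.* r ; queries = roundQueries M ; verdict = accepts B M }

    module _ {μ : Distribution n} (O : ConditionalOracle μ) {δ : ℝ} (β≤δ : fromℚ β ≤ δ) where
      module T = Test.Correctness n E b ℝ-orderedRing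

      -- A bound for the probability of a verdict v over the ordered ring ℝ bounds
      -- the probability of v with the oracle O.
      transfer : ∀ v → P.1# P.- P.ι β P.≤ T.Pr (isConditional O) v →
                 1ℝ - δ ≤ 𝔼-coins (M ℕ.* r) (λ ω → 𝔼-samples O (roundQueries M ω) λ js → indicator (v ω js))
      transfer v h = ℝ-≤-trans {1ℝ - δ} {P.1# P.- P.ι β} {Y} (Conditioned.1-mono {fromℚ β} {δ} β≤δ)
        (ℝ-≤-trans {P.1# P.- P.ι β} {T.Pr (isConditional O) v} {Y} h
          (ℝ-≤-reflexive {T.Pr (isConditional O) v} {Y} (𝔼-coins-agree (M ℕ.* r) λ ω →
            𝔼-samples-agree O (roundQueries M ω) {λ js → P.ind (v ω js)} {λ js → indicator (v ω js)} λ js → ind≃indicator (v ω js))))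
        where
        Y : ℝ
        Y = 𝔼-coins (M ℕ.* r) λ ω → 𝔼-samples O (roundQueries M ω) λ js → indicator (v ω js)

      test-complete : IsUniform μ → 1ℝ - δ ≤ Pr[ testAlgorithm accepts O ]
      test-complete μ-uniform = transfer (accepts B M) (T.accepts-uniform (isConditional O) μ-uniform)

      test-sound : ∀ {ε} → fromℚ e ≤ ε → Far ε μ IsUniform → 1ℝ - δ ≤ Pr[ testAlgorithm rejects O ]
      test-sound {ε} e≤ε far = transfer (λ ω js → not (accepts B M ω js))
        (T.rejects-far (isConditional O) {variationDistance μ uniform} (λ i → ∣ prob μ i - prob uniform i ∣)
          (λ i → distance-agree (prob μ i)) (half-sum-agree λ i → ∣ prob μ i - prob uniform i ∣)
          (ℝ-≤-trans {fromℚ e} {ε} {variationDistance μ uniform} e≤ε (far uniform λ i → P.refl {fromℚ (ℤ.1ℤ ℚ./ n)})))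
        where
        distance-agree : ∀ x → ∣ x - fromℚ (ℤ.1ℤ ℚ./ n) ∣ ≃ P.∣ x P.- T.u ∣
        distance-agree x = P.refl {∣ x - fromℚ (ℤ.1ℤ ℚ./ n) ∣}
        half-sum-agree : ∀ (d : Fin n → ℝ) → fromℚ ½ * sum d ≃ P.ι ½ P.* P.sum d
        half-sum-agree d = P.refl {fromℚ ½ * sum d}

-- The number of samples

-- The product of a rational number and a polynomial
scale : ∀ k → ℚ → Poly k → Poly k
scale zero a c = fromℚ a * c
scale (suc k) a = map (scale k a)

-- The product of a polynomial in the first variable, given by its coefficients,
-- and a polynomial in the other variables
_⊗_ : ∀ {k} → List ℚ → Poly k → Poly (suc k)
as ⊗ P = map (λ a → scale _ a P) as

-- The value at x of the polynomial with the given coefficients, constant term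
-- first
horner : List ℚ → ℚ → ℚ
horner [] x = 0ℚ
horner (a ∷ as) x = a ℚ.+ x ℚ.* horner as x

eval-scale : ∀ k a (P : Poly k) xs i → seq (eval (scale k a P) xs) i ≡ a ℚ.* seq (eval P xs) i
eval-scale zero a c [] i = ≡.refl
eval-scale (suc k) a [] (x ∷ xs) i = ≡.sym (ℚ.*-zeroʳ a)
eval-scale (suc k) a (c ∷ cs) (x ∷ xs) i = ≡.trans
  (≡.cong₂ (λ u v → u ℚ.+ seq x i ℚ.* v) (eval-scale k a c xs i) (eval-scale (suc k) a cs (x ∷ xs) i))
  (solve 4 (λ a c x d → a :* c :+ x :* (a :* d) := a :* (c :+ x :* d)) ≡.refl a (seq (eval c xs) i) (seq x i) (seq (eval {suc k} cs (x ∷ xs)) i))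
  where open ℚ-Solver

eval-⊗ : ∀ {k} as (P : Poly k) x xs i → seq (eval {suc k} (as ⊗ P) (x ∷ xs)) i ≡ horner as (seq x i) ℚ.* seq (eval P xs) i
eval-⊗ [] P x xs i = ≡.sym (ℚ.*-zeroˡ (seq (eval P xs) i))
eval-⊗ {k} (a ∷ as) P x xs i = ≡.trans
  (≡.cong₂ (λ u v → u ℚ.+ seq x i ℚ.* v) (eval-scale k a P xs i) (eval-⊗ as P x xs i))
  (solve 4 (λ a y x h → a :* y :+ x :* (h :* y) := (a :+ x :* h) :* y) ≡.refl a (seq (eval P xs) i) (seq x i) (horner as (seq x i)))
  where open ℚ-Solver

-- The coefficients of (4 + 2x)², of (1 + 4y)⁴ and of 4 + z
squareCoeffs fourthCoeffs linearCoeffs : List ℚ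
squareCoeffs = ℕ⇒ℚ 16 ∷ ℕ⇒ℚ 16 ∷ ℕ⇒ℚ 4 ∷ []
fourthCoeffs = ℕ⇒ℚ 1 ∷ ℕ⇒ℚ 16 ∷ ℕ⇒ℚ 96 ∷ ℕ⇒ℚ 256 ∷ ℕ⇒ℚ 256 ∷ []
linearCoeffs = ℕ⇒ℚ 4 ∷ ℕ⇒ℚ 1 ∷ []

-- The test takes 2 M = 8 · 2000² · 4 · (2 ^ κ)² (1 + E)⁴ b samples.
constantCoeff : ℚ
constantCoeff = 8ℚ ℚ.* (2000ℚ ℚ.* 2000ℚ) ℚ.* 4ℚ

-- The factors of this polynomial bound (2 ^ κ)², (1 + E)⁴ and b.
samplePolynomial : Poly 3
samplePolynomial = squareCoeffs ⊗ (fourthCoeffs ⊗ (linearCoeffs ⊗ fromℚ constantCoeff))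

eval-samplePolynomial : ∀ x y z i → seq (eval samplePolynomial (x ∷ y ∷ z ∷ [])) i ≡
  ((4ℚ ℚ.+ 2ℚ ℚ.* seq x i) ℚ.* (4ℚ ℚ.+ 2ℚ ℚ.* seq x i)) ℚ.*
  (((1ℚ ℚ.+ 4ℚ ℚ.* seq y i) ℚ.* (1ℚ ℚ.+ 4ℚ ℚ.* seq y i)) ℚ.* ((1ℚ ℚ.+ 4ℚ ℚ.* seq y i) ℚ.* (1ℚ ℚ.+ 4ℚ ℚ.* seq y i)) ℚ.*
  ((4ℚ ℚ.+ seq z i) ℚ.* constantCoeff))
eval-samplePolynomial x y z i = begin
  seq (eval samplePolynomial (x ∷ y ∷ z ∷ [])) i
    ≡⟨ eval-⊗ squareCoeffs (fourthCoeffs ⊗ (linearCoeffs ⊗ fromℚ constantCoeff)) x (y ∷ z ∷ []) i ⟩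
  horner squareCoeffs (seq x i) ℚ.* seq (eval (fourthCoeffs ⊗ (linearCoeffs ⊗ fromℚ constantCoeff)) (y ∷ z ∷ [])) i
    ≡⟨ ≡.cong (horner squareCoeffs (seq x i) ℚ.*_) (≡.trans
         (eval-⊗ fourthCoeffs (linearCoeffs ⊗ fromℚ constantCoeff) y (z ∷ []) i)
         (≡.cong (horner fourthCoeffs (seq y i) ℚ.*_) (eval-⊗ linearCoeffs (fromℚ constantCoeff) z [] i))) ⟩
  horner squareCoeffs (seq x i) ℚ.* (horner fourthCoeffs (seq y i) ℚ.* (horner linearCoeffs (seq z i) ℚ.* constantCoeff))
    ≡⟨ ≡.cong₂ ℚ._*_ (square (seq x i)) (≡.cong₂ ℚ._*_ (fourth (seq y i)) (≡.cong (ℚ._* constantCoeff) (linear (seq z i)))) ⟩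
  _ ∎
  where
  open ≡.≡-Reasoning
  open ℚ-Solver
  square : ∀ x → horner squareCoeffs x ≡ (4ℚ ℚ.+ 2ℚ ℚ.* x) ℚ.* (4ℚ ℚ.+ 2ℚ ℚ.* x)
  square = solve 1 (λ x → con (ℕ⇒ℚ 16) :+ x :* (con (ℕ⇒ℚ 16) :+ x :* (con 4ℚ :+ x :* con 0ℚ)) :=
    (con 4ℚ :+ con 2ℚ :* x) :* (con 4ℚ :+ con 2ℚ :* x)) ≡.refl
  fourth : ∀ y → horner fourthCoeffs y ≡ ((1ℚ ℚ.+ 4ℚ ℚ.* y) ℚ.* (1ℚ ℚ.+ 4ℚ ℚ.* y)) ℚ.* ((1ℚ ℚ.+ 4ℚ ℚ.* y) ℚ.* (1ℚ ℚ.+ 4ℚ ℚ.* y))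
  fourth = solve 1 (λ y → con 1ℚ :+ y :* (con (ℕ⇒ℚ 16) :+ y :* (con (ℕ⇒ℚ 96) :+ y :* (con (ℕ⇒ℚ 256) :+ y :* (con (ℕ⇒ℚ 256) :+ y :* con 0ℚ)))) :=
    ((con 1ℚ :+ con 4ℚ :* y) :* (con 1ℚ :+ con 4ℚ :* y)) :* ((con 1ℚ :+ con 4ℚ :* y) :* (con 1ℚ :+ con 4ℚ :* y))) ≡.refl
  linear : ∀ z → horner linearCoeffs z ≡ 4ℚ ℚ.+ z
  linear = solve 1 (λ z → con 4ℚ :+ z :* (con 1ℚ :+ z :* con 0ℚ) := con 4ℚ :+ z) ≡.refl

-- The parameters of the test for given ε and δ
module Choice (n : ℕ) .{{_ : ℕ.NonZero n}} (ε δ : ℝ) (0<ε : 0ℝ < ε) (0<δ : 0ℝ < δ) where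
  E j b : ℕ
  E = natFloor (inverseApprox ε 0<ε)
  j = ⌊log₂⌊ inverseApprox δ 0<δ ℚ.⊔ 1ℚ ⌋⌋
  b = suc j

  open Test n E b using (κ; K; G; M; M≡; e; B; β; roundQueries; length-roundQueries)

  e≤ε : fromℚ e ≤ ε
  e≤ε = inverseApprox-lower ε 0<ε (natFloor-upper (inverseApprox ε 0<ε) (inverseApprox-nonNeg ε 0<ε))
    (ℕ⇒ℚ*1/n≡1 (suc E)) (0≤1/n (suc E))

  1≤⊔1 : ∀ p → 1ℚ ℚ.≤ p ℚ.⊔ 1ℚ
  1≤⊔1 p = ℚ.p≤q⊔p p 1ℚ

  β≤δ : fromℚ β ≤ δ
  β≤δ = inverseApprox-lower δ 0<δ
    (ℚ.≤-trans (ℚ.p≤p⊔q v 1ℚ) (p≤2^[1+⌊log₂⌊p⌋⌋] (v ℚ.⊔ 1ℚ) (ℚ.≤-trans 0≤1 (1≤⊔1 v)))) (2^k*½^k≡1 b) (0≤½^ b)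
    where v = inverseApprox δ 0<δ

  2^κ≤ : ∀ i → ℕ⇒ℚ (2 ℕ.^ κ) ℚ.≤ 4ℚ ℚ.+ 2ℚ ℚ.* seq (log₂⁺ (fromℕ n)) i
  2^κ≤ i = begin
    ℕ⇒ℚ (2 ℕ.^ κ)
      ≤⟨ ℕ⇒ℚ-mono-≤ (ℕ.*-monoʳ-≤ 2 (2^⌊log₂n⌋≤n K (s≤s z≤n))) ⟩
    ℕ⇒ℚ (2 ℕ.* suc l)
      ≡⟨ ≡.trans (ℕ⇒ℚ-* 2 (suc l)) (≡.cong (2ℚ ℚ.*_) (ℕ⇒ℚ-+ 1 l)) ⟩
    2ℚ ℚ.* (1ℚ ℚ.+ ℕ⇒ℚ l)
      ≤⟨ ℚ.*-monoˡ-≤-nonNeg 2ℚ (ℚ.+-monoʳ-≤ 1ℚ (log₂-bound l 0 i (1≤⊔1 (ℕ⇒ℚ n)) (begin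
           2ℚ ^ℚ l                 ≡⟨ ℕ⇒ℚ-2^ l ⟨
           ℕ⇒ℚ (2 ℕ.^ l)           ≤⟨ ℕ⇒ℚ-mono-≤ (2^⌊log₂n⌋≤n n (ℕ.>-nonZero⁻¹ n)) ⟩
           ℕ⇒ℚ n                   ≤⟨ ℚ.p≤p⊔q (ℕ⇒ℚ n) 1ℚ ⟩
           ℕ⇒ℚ n ℚ.⊔ 1ℚ            ≡⟨ ℚ.*-identityˡ (ℕ⇒ℚ n ℚ.⊔ 1ℚ) ⟨
           1ℚ ℚ.* (ℕ⇒ℚ n ℚ.⊔ 1ℚ)   ∎))) ⟩
    2ℚ ℚ.* (1ℚ ℚ.+ (1ℚ ℚ.+ seq (log₂⁺ (fromℕ n)) i))
      ≡⟨ solve 1 (λ x → con 2ℚ :* (con 1ℚ :+ (con 1ℚ :+ x)) := con 4ℚ :+ con 2ℚ :* x) ≡.refl (seq (log₂⁺ (fromℕ n)) i) ⟩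
    4ℚ ℚ.+ 2ℚ ℚ.* seq (log₂⁺ (fromℕ n)) i ∎
    where
    open ℚ.≤-Reasoning
    open ℚ-Solver
    l = ⌊log₂ n ⌋

  1+E≤ : Eventually λ i → ℕ⇒ℚ (suc E) ℚ.≤ 1ℚ ℚ.+ 4ℚ ℚ.* seq (ε ⁻¹[ 0<ε ]) i
  1+E≤ = eventually-map (λ i v≤4y → ℚ.≤-trans (ℚ.≤-reflexive (ℕ⇒ℚ-+ 1 E)) (ℚ.+-monoʳ-≤ 1ℚ
    (ℚ.≤-trans (natFloor-lower (inverseApprox ε 0<ε) (inverseApprox-nonNeg ε 0<ε)) v≤4y))) (inverseApprox-upper ε 0<ε)

  b≤ : Eventually λ i → ℕ⇒ℚ b ℚ.≤ 4ℚ ℚ.+ seq (log₂⁺ (δ ⁻¹[ 0<δ ])) i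
  b≤ = eventually-map (λ i v≤4y → begin
    ℕ⇒ℚ (suc j)
      ≡⟨ ℕ⇒ℚ-+ 1 j ⟩
    1ℚ ℚ.+ ℕ⇒ℚ j
      ≤⟨ ℚ.+-monoʳ-≤ 1ℚ (log₂-bound j 2 i (1≤⊔1 (seq (δ ⁻¹[ 0<δ ]) i)) (ℚ.≤-trans
           (2^⌊log₂⌊p⌋⌋≤p (v ℚ.⊔ 1ℚ) (1≤⊔1 v)) (⊔-scale (seq (δ ⁻¹[ 0<δ ]) i) v≤4y))) ⟩
    1ℚ ℚ.+ (3ℚ ℚ.+ seq (log₂⁺ (δ ⁻¹[ 0<δ ])) i)
      ≡⟨ ℚ.+-assoc 1ℚ 3ℚ (seq (log₂⁺ (δ ⁻¹[ 0<δ ])) i) ⟨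
    4ℚ ℚ.+ seq (log₂⁺ (δ ⁻¹[ 0<δ ])) i ∎) (inverseApprox-upper δ 0<δ)
    where
    open ℚ.≤-Reasoning
    v = inverseApprox δ 0<δ
    ⊔-scale : ∀ p → v ℚ.≤ 4ℚ ℚ.* p → v ℚ.⊔ 1ℚ ℚ.≤ 4ℚ ℚ.* (p ℚ.⊔ 1ℚ)
    ⊔-scale p v≤4p = ℚ.⊔-lub
      (ℚ.≤-trans v≤4p (ℚ.*-monoˡ-≤-nonNeg 4ℚ (ℚ.p≤p⊔q p 1ℚ)))
      (ℚ.≤-trans (ℚ.≤ᵇ⇒≤ {1ℚ} {4ℚ ℚ.* 1ℚ} _) (ℚ.*-monoˡ-≤-nonNeg 4ℚ (1≤⊔1 p)))

  length≡ : ∀ ω → ℕ⇒ℚ (length (roundQueries M ω)) ≡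
    (ℕ⇒ℚ (2 ℕ.^ κ) ℚ.* ℕ⇒ℚ (2 ℕ.^ κ)) ℚ.*
    ((ℕ⇒ℚ (suc E) ℚ.* ℕ⇒ℚ (suc E)) ℚ.* (ℕ⇒ℚ (suc E) ℚ.* ℕ⇒ℚ (suc E)) ℚ.* (ℕ⇒ℚ b ℚ.* constantCoeff))
  length≡ ω = begin
    ℕ⇒ℚ (length (roundQueries M ω))
      ≡⟨ ≡.cong ℕ⇒ℚ (≡.trans (length-roundQueries M ω) (≡.cong (ℕ._* 2) M≡)) ⟩
    ℕ⇒ℚ (8 ℕ.* (G ℕ.* G) ℕ.* (b ℕ.+ b) ℕ.* 2)
      ≡⟨ ≡.trans (ℕ⇒ℚ-* (8 ℕ.* (G ℕ.* G) ℕ.* (b ℕ.+ b)) 2) (≡.cong (ℚ._* 2ℚ)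
           (≡.trans (ℕ⇒ℚ-* (8 ℕ.* (G ℕ.* G)) (b ℕ.+ b)) (≡.cong₂ ℚ._*_
             (≡.trans (ℕ⇒ℚ-* 8 (G ℕ.* G)) (≡.cong (8ℚ ℚ.*_) (≡.trans (ℕ⇒ℚ-* G G) (≡.cong₂ ℚ._*_ G≡ G≡)))) (ℕ⇒ℚ-+ b b)))) ⟩
    8ℚ ℚ.* (g ℚ.* g) ℚ.* (ℕ⇒ℚ b ℚ.+ ℕ⇒ℚ b) ℚ.* 2ℚ
      ≡⟨ solve 5 (λ c d l s b → let g = d :* (l :* (s :* s)) in
           c :* (g :* g) :* (b :+ b) :* con 2ℚ := (l :* l) :* ((s :* s) :* (s :* s) :* (b :* (c :* (d :* d) :* con 4ℚ))))
           ≡.refl 8ℚ 2000ℚ (ℕ⇒ℚ (2 ℕ.^ κ)) (ℕ⇒ℚ (suc E)) (ℕ⇒ℚ b) ⟩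
    _ ∎
    where
    open ≡.≡-Reasoning
    open ℚ-Solver
    g = 2000ℚ ℚ.* (ℕ⇒ℚ (2 ℕ.^ κ) ℚ.* (ℕ⇒ℚ (suc E) ℚ.* ℕ⇒ℚ (suc E)))
    G≡ : ℕ⇒ℚ G ≡ g
    G≡ = ≡.trans (ℕ⇒ℚ-* 2000 (2 ℕ.^ κ ℕ.* (suc E ℕ.* suc E))) (≡.cong (2000ℚ ℚ.*_)
      (≡.trans (ℕ⇒ℚ-* (2 ℕ.^ κ) (suc E ℕ.* suc E)) (≡.cong (ℕ⇒ℚ (2 ℕ.^ κ) ℚ.*_) (ℕ⇒ℚ-* (suc E) (suc E)))))

  few-samples : MakesAtMost (testAlgorithm n E b)
    (eval samplePolynomial (log₂⁺ (fromℕ n) ∷ ε ⁻¹[ 0<ε ] ∷ log₂⁺ (δ ⁻¹[ 0<δ ]) ∷ []))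
  few-samples ω η 0<η = eventually-map₂ (λ i 1+E≤i b≤i → bound i (2^κ≤ i) 1+E≤i b≤i) 1+E≤ b≤
    where
    open ℚ.≤-Reasoning
    x = log₂⁺ (fromℕ n)
    y = ε ⁻¹[ 0<ε ]
    z = log₂⁺ (δ ⁻¹[ 0<δ ])
    0≤C = ℚ.nonNegative⁻¹ constantCoeff
    product-mono : ∀ {p q r s} → 0ℚ ℚ.≤ p → 0ℚ ℚ.≤ r → p ℚ.≤ q → r ℚ.≤ s → p ℚ.* r ℚ.≤ q ℚ.* s
    product-mono 0≤p 0≤r p≤q r≤s = *-mono-≤ 0≤p (ℚ.≤-trans 0≤r r≤s) p≤q r≤s
    square-mono : ∀ {p q} → 0ℚ ℚ.≤ p → p ℚ.≤ q → p ℚ.* p ℚ.≤ q ℚ.* q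
    square-mono 0≤p p≤q = product-mono 0≤p 0≤p p≤q p≤q
    bound : ∀ i → ℕ⇒ℚ (2 ℕ.^ κ) ℚ.≤ 4ℚ ℚ.+ 2ℚ ℚ.* seq x i → ℕ⇒ℚ (suc E) ℚ.≤ 1ℚ ℚ.+ 4ℚ ℚ.* seq y i →
            ℕ⇒ℚ b ℚ.≤ 4ℚ ℚ.+ seq z i →
            ℕ⇒ℚ (length (roundQueries M ω)) ℚ.≤ seq (eval samplePolynomial (x ∷ y ∷ z ∷ [])) i ℚ.+ η
    bound i L≤ S≤ b≤ = begin
      ℕ⇒ℚ (length (roundQueries M ω))
        ≡⟨ length≡ ω ⟩
      _
        ≤⟨ product-mono (ℚ-*-nonNeg 0≤L 0≤L) (ℚ-*-nonNeg (ℚ-*-nonNeg 0≤S² 0≤S²) (ℚ-*-nonNeg (0≤ℕ⇒ℚ b) 0≤C))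
             (square-mono 0≤L L≤) (product-mono (ℚ-*-nonNeg 0≤S² 0≤S²) (ℚ-*-nonNeg (0≤ℕ⇒ℚ b) 0≤C)
               (square-mono 0≤S² (square-mono 0≤S S≤)) (ℚ.*-monoʳ-≤-nonNeg constantCoeff b≤)) ⟩
      _
        ≡⟨ eval-samplePolynomial x y z i ⟨
      seq (eval samplePolynomial (x ∷ y ∷ z ∷ [])) i
        ≤⟨ p≤p+q (ℚ.<⇒≤ 0<η) ⟩
      seq (eval samplePolynomial (x ∷ y ∷ z ∷ [])) i ℚ.+ η ∎
      where
      0≤L = 0≤ℕ⇒ℚ (2 ℕ.^ κ)
      0≤S = 0≤ℕ⇒ℚ (suc E)
      0≤S² = ℚ-*-nonNeg 0≤S 0≤S

uniformityTester : NonAdaptiveTester IsUniform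
uniformityTester = record
  { algorithm = λ n ε δ 0<ε 0<δ → testAlgorithm n (E n ε δ 0<ε 0<δ) (b n ε δ 0<ε 0<δ)
  ; complete = λ n ε δ 0<ε 0<δ μ O → test-complete n (E n ε δ 0<ε 0<δ) (b n ε δ 0<ε 0<δ) O {δ} (β≤δ n ε δ 0<ε 0<δ)
  ; sound = λ n ε δ 0<ε 0<δ μ O → test-sound n (E n ε δ 0<ε 0<δ) (b n ε δ 0<ε 0<δ) O {δ} (β≤δ n ε δ 0<ε 0<δ) {ε} (e≤ε n ε δ 0<ε 0<δ)
  }
  where open Choice

theorem4p1p1 : ∃ λ (p : Poly 3) → Σ (NonAdaptiveTester IsUniform) λ T →
    ∀ (n : ℕ) .{{_ : NonZero n}} (ε δ : ℝ)
    (0<ε : 0ℝ < ε) (ε<1 : ε < 1ℝ) (0<δ : 0ℝ < δ) (δ<1 : δ < 1ℝ) →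
    MakesAtMost (algorithm T n ε δ 0<ε 0<δ)
    (eval p (log₂⁺ (fromℕ n) ∷ ε ⁻¹[ 0<ε ] ∷ log₂⁺ (δ ⁻¹[ 0<δ ]) ∷ []))
theorem4p1p1 = samplePolynomial , uniformityTester , λ n ε δ 0<ε _ 0<δ _ → Choice.few-samples n ε δ 0<ε 0<δ
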